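{- Let $w\in W_B^n$, $m\ge2$, and let $\boldsymbol A=(s_1\boldsymbol a_1)(s_2\boldsymbol a_2)\cdots(s_m\boldsymbol a_m)\in U_m^\pm(w)$. The odd Kashiwara operator $\tilde f_{\bar1}^F$ acts on $\boldsymbol A$ as follows; if $\tilde f_{\bar1}^F\boldsymbol A\neq\mathbf0$, it changes only the first two factors. (1) If the concatenation $\boldsymbol a_1\boldsymbol a_2$ is not unimodal: let $\boldsymbol a_1'$ be $\boldsymbol a_1$ with its last letter removed and $\boldsymbol a_2'$ the word obtained by prepending that letter to $\boldsymbol a_2$. If $\boldsymbol a_2'$ is unimodal, then $\tilde f_{\bar1}^F\boldsymbol A=(s_1\boldsymbol a_1')(s_2\boldsymbol a_2')(s_3\boldsymbol a_3)\cdots$; otherwise $\tilde f_{\bar1}^F\boldsymbol A=\mathbf0$. (2) If $\boldsymbol a_1\boldsymbol a_2$ is unimodal: if $\boldsymbol a_2\ne\emptyset$ and $s_2=-$, then $\tilde f_{\bar1}^F\boldsymbol A=\mathbf0$. Otherwise $\tilde f_{\bar1}^F\boldsymbol A=(s_1'\boldsymbol a_1')(s_2'\boldsymbol a_2')(s_3\boldsymbol a_3)\cdots$ with $\boldsymbol a_1',\boldsymbol a_2'$ as in (1) and $(s_1',s_2')=(0,s_1)$ if $|\boldsymbol a_1|=1$, $(s_1',s_2')=(s_1,-)$ if $|\boldsymbol a_1|\ge2$.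
   Context: Type $B$: $W_B^n$ is generated by $s_0,\dots,s_{n-1}$ (signed permutations, $s_0$ changes the sign of the first entry, $s_i$ swaps positions $i,i+1$); a word $a_1\cdots a_l$ over $\{0,\dots,n-1\}$ is a reduced word of $w$ if $w=s_{a_1}\cdots s_{a_l}$ with $l$ minimal. A word $a_1\cdots a_l$ is unimodal if $a_1>\dots>a_k<a_{k+1}<\dots<a_l$ for some $k$ ($a_1\cdots a_k$ is its decreasing part $R_\downarrow$, the rest its increasing part $R_\uparrow$); the empty word is unimodal. A signed unimodal factorization with $m$ factors of a reduced word $\boldsymbol a$ of $w$ is $\boldsymbol A=(s_1\boldsymbol a_1)\cdots(s_m\boldsymbol a_m)$ with $\boldsymbol a_1\cdots\boldsymbol a_m=\boldsymbol a$, each $\boldsymbol a_i$ unimodal (possibly empty), and $s_i=0$ if $\boldsymbol a_i$ is empty, $s_i\in\{+,-\}$ otherwise; $U_m^\pm(w)$ is the set of all these; $|\boldsymbol a|$ is the number of letters. Shifted diagram $S(\lambda)=\{(i,j):1\le i\le l(\lambda),\ i\le j\le\lambda_i+i-1\}$ for a strict partition $\lambda$ (row $i$, column $j$, row 1 on top; main diagonal $\{(i,i)\}$). A standard decomposition tableau of $w$ of shape $\lambda$ is a filling of $S(\lambda)$ whose rows $P_i$ satisfy: $P_lP_{l-1}\cdots P_1$ is a reduced word of $w$ and $P_i$ is a unimodal subword of maximum length of $P_{i+1}P_i$. Kra\'skiewicz insertion of a letter $a$: let $R$ be the first row. If $Ra$ is unimodal, append $a$ to $R$ and stop. Otherwise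 let $b$ be the smallest element of $R_\uparrow$ with $b\ge a$. If $a=0$ and $R$ contains $101$ as a subsequence, leave $R$ unchanged and insert $0$ into the next row. Otherwise: if $b\ne a$, put $a$ in $b$'s position, $c=b$; if $b=a$, leave $R_\uparrow$, $c=a+1$. Let $d$ be the largest element of $R_\downarrow$ with $d\le c$; if $d\ne c$ put $c$ in $d$'s place, $a'=d$; if $d=c$ leave $R_\downarrow$, $a'=c-1$. Insert $a'$ into the next row likewise. A signed primed tableau of shape $\lambda$ is a filling of $S(\lambda)$ with letters $1'<1<2'<\dots<m'<m$, weakly increasing along rows and columns, with at most one $i'$ per row and one $i$ per column for each $i$. Primed Kra\'skiewicz insertion $\mathrm{KR}'(\boldsymbol A)=(P,T)$: from $(\emptyset,\emptyset)$, for $i=1,\dots,m$ insert the letters of $\boldsymbol a_i$ left to right into $P$ by Kra\'skiewicz insertion; let $(x_1,y_1),\dots,(x_r,y_r)$ be the new boxes (row, column) in order of creation; there is $k$ with $x_1<\dots<x_k\ge\dots\ge x_r$ and $y_1\ge\dots\ge y_k<\dots<y_r$; add to $T$ boxes $(x_1,y_1),\dots,(x_{k-1},y_{k-1})$ filled with $i'$, $(x_{k+1},y_{k+1}),\dots,(x_r,y_r)$ filled with $i$, and $(x_k,y_k)$ filled with $i'$ if $s_i=-$, $i$ if $s_i=+$. $\mathrm{KR}'$ is a bijection from $U_m^\pm(w)$ onto pairs (standard decomposition tableau of $w$, signed primed tableau) of the same shape. Odd operator: $\tilde f_{\bar1}^F=\mathrm{KR}'^{ -1}\circ(\mathrm{Id},\tilde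 f_{\bar1}^{\pm P})\circ\mathrm{KR}'$, where $\tilde f_{\bar1}^{\pm P}T=\mathrm{PR}\circ\tilde f_{\bar1}^P\circ\mathrm{DPR}(T)$ with $\mathrm{DPR}$ removing primes on the main diagonal and $\mathrm{PR}$ restoring them at the same diagonal positions, and $\tilde f_{\bar1}^PT=P_{HM}(\tilde f_{\bar1}\mathrm{HM}^{ -1}(T,Q_\lambda))$ for any fixed standard shifted Young tableau $Q_\lambda$ of shape $\lambda$ (independent of $Q_\lambda$; $\mathbf0$ maps to $\mathbf 0$). Here $\mathrm{HM}$ is semistandard shifted mixed insertion of a word over $\{1,\dots,m\}$: insert $x$ into the first row bumping the leftmost entry strictly greater than $x$ (or append $x$ and stop); a bumped off-diagonal unprimed entry is inserted into the next row in the same way, a bumped off-diagonal primed entry is inserted into the next column to the right bumping the topmost entry strictly greater (or appended at the bottom), a bumped diagonal entry $a$ becomes $a'$ and is inserted into the column to the right; the recording tableau stores the step number in the new box; $\mathrm{HM}(\boldsymbol b)=(P_{HM}(\boldsymbol b),Q)$ is a bijection onto pairs (primed tableau, standard shifted tableau) of equal shape, where a primed tableau is a signed primed tableau with no primes on the main diagonal. On words, $\tilde f_{\bar1}$ changes the leftmost $1$ to $2$ if no $2$ precedes it, and is $\mathbf0$ if there is no $1$ or a $2$ precedes the leftmost $1$.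
   Formalization: The "Otherwise" part of (2) is stated only for nonempty a_1: for a_1 = ∅ there is no last letter to move, so a_1', a_2' and the signs are undefined there (the operator then gives 0). -}

module Defs where

open import Data.Nat using (ℕ; zero; suc; _+_; _*_; _∸_; _≤_; _<_; _<ᵇ_; _≡ᵇ_; _≤ᵇ_)
open import Data.Integer using (ℤ; +_; ∣_∣; -_)
open import Data.List using (List; []; _∷_; _++_; length; map; foldl; upTo; concat)
open import Data.Nat.ListAction using (sum)
open import Data.List.Relation.Unary.All using (All)
open import Data.List.Relation.Binary.Permutation.Propositional using (_↭_)
open import Data.Bool using (Bool; true; false; if_then_else_; _∧_)
open import Data.Maybe using (Maybe; just; nothing) renaming (map to mapMaybe)
open import Data.Product using (_×_; _,_; proj₁; proj₂; Σ; Σ-syntax)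
open import Data.Sum using (_⊎_)
open import Relation.Binary.PropositionalEquality using (_≡_; _≢_)

-- Type B Weyl group W_B^n: signed permutations in window notation
-- w = [w(1), ..., w(n)] (a list of nonzero integers).

idW : ℕ → List ℤ
idW n = map (λ k → + suc k) (upTo n)

InWB : ℕ → List ℤ → Set
InWB n w = (length w ≡ n) × (map ∣_∣ w ↭ map suc (upTo n))

swapAt : ℕ → List ℤ → List ℤ
swapAt zero (x ∷ y ∷ r) = y ∷ x ∷ r
swapAt zero r = r
swapAt (suc k) [] = []
swapAt (suc k) (x ∷ r) = x ∷ swapAt k r

-- right multiplication by the generator s_i:
-- s_0 changes the sign of the first entry, s_i swaps positions i, i+1
applyGen : ℕ → List ℤ → List ℤ
applyGen zero [] = []
applyGen zero (x ∷ r) = (- x) ∷ r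
applyGen (suc i) w = swapAt i w

evalWord : ℕ → List ℕ → List ℤ
evalWord n a = foldl (λ w i → applyGen i w) (idW n) a

IsReduced : ℕ → List ℤ → List ℕ → Set
IsReduced n w a =
  All (_< n) a × (evalWord n a ≡ w) ×
  (∀ (b : List ℕ) → All (_< n) b → evalWord n b ≡ w → length a ≤ length b)

incB : List ℕ → Bool
incB [] = true
incB (x ∷ []) = true
incB (x ∷ y ∷ ys) = (x <ᵇ y) ∧ incB (y ∷ ys)

unimodalFrom : ℕ → List ℕ → Bool
unimodalFrom x [] = true
unimodalFrom x (y ∷ ys) = if y <ᵇ x then unimodalFrom y ys else incB (x ∷ y ∷ ys)

unimodal : List ℕ → Bool
unimodal [] = true
unimodal (x ∷ xs) = unimodalFrom x xs

-- (R_↓ , R_↑) of a unimodal word (R_↓ contains the minimum)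
splitFrom : ℕ → List ℕ → List ℕ × List ℕ
splitFrom x [] = (x ∷ [] , [])
splitFrom x (y ∷ ys) =
  if y <ᵇ x then (x ∷ proj₁ (splitFrom y ys) , proj₂ (splitFrom y ys))
  else (x ∷ [] , y ∷ ys)

splitU : List ℕ → List ℕ × List ℕ
splitU [] = ([] , [])
splitU (x ∷ xs) = splitFrom x xs

data Sign : Set where
  zeroS plusS minusS : Sign

Factor : Set
Factor = Sign × List ℕ

ValidFactor : Factor → Set
ValidFactor (s , a) = ((s ≡ zeroS) × (a ≡ [])) ⊎ ((s ≢ zeroS) × (a ≢ []))

InU : ℕ → ℕ → List ℤ → List Factor → Set
InU n m w A =
  (length A ≡ m) × All ValidFactor A ×
  All (λ f → unimodal (proj₂ f) ≡ true) A ×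
  IsReduced n w (concat (map proj₂ A))

-- Shifted tableaux: list of rows, row i (1-based) starts in column i.

Tab : Set
Tab = List (List ℕ)

appendAt : ℕ → ℕ → Tab → Tab
appendAt zero v T = T
appendAt (suc zero) v [] = (v ∷ []) ∷ []
appendAt (suc zero) v (R ∷ Rs) = (R ++ v ∷ []) ∷ Rs
appendAt (suc (suc x)) v [] = []
appendAt (suc (suc x)) v (R ∷ Rs) = R ∷ appendAt (suc x) v Rs

isSubseq : List ℕ → List ℕ → Bool
isSubseq [] _ = true
isSubseq (x ∷ xs) [] = false
isSubseq (x ∷ xs) (y ∷ ys) = if x ≡ᵇ y then isSubseq xs ys else isSubseq (x ∷ xs) ys

bumpInc : ℕ → List ℕ → Maybe (ℕ × List ℕ)
bumpInc a [] = nothing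
bumpInc a (x ∷ xs) =
  if a ≤ᵇ x then just (x , a ∷ xs)
  else mapMaybe (λ p → (proj₁ p , x ∷ proj₂ p)) (bumpInc a xs)

bumpDec : ℕ → List ℕ → Maybe (ℕ × List ℕ)
bumpDec c [] = nothing
bumpDec c (x ∷ xs) =
  if x ≤ᵇ c then just (x , c ∷ xs)
  else mapMaybe (λ p → (proj₁ p , x ∷ proj₂ p)) (bumpDec c xs)

kStep2 : List ℕ → List ℕ × ℕ → List ℕ × Maybe ℕ
kStep2 D (I′ , c) with bumpDec c D
... | nothing = (D ++ I′ , just (c ∸ 1))
... | just (d , D′) = (D′ ++ I′ , just (if d ≡ᵇ c then c ∸ 1 else d))

kStep1 : ℕ → List ℕ → List ℕ × ℕ
kStep1 a I with bumpInc a I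
... | nothing = (I , suc a)
... | just (b , I′) = (I′ , (if b ≡ᵇ a then suc a else b))

kIns : ℕ → List ℕ → List ℕ × Maybe ℕ
kIns a R =
  if unimodal (R ++ a ∷ []) then (R ++ a ∷ [] , nothing)
  else (if (a ≡ᵇ 0) ∧ isSubseq (1 ∷ 0 ∷ 1 ∷ []) R then (R , just 0)
  else kStep2 (proj₁ (splitU R)) (kStep1 a (proj₂ (splitU R))))

kInsert : ℕ → Tab → Tab × (ℕ × ℕ)
kInsert a [] = ((a ∷ []) ∷ [] , (1 , 1))
kInsert a (R ∷ Rs) with kIns a R
... | (R′ , nothing) = (R′ ∷ Rs , (1 , length R′))
... | (R′ , just a′) with kInsert a′ Rs
...   | (Rs′ , (x , y)) = (R′ ∷ Rs′ , (suc x , suc y))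

kInsertWord : List ℕ → Tab → Tab × List (ℕ × ℕ)
kInsertWord [] P = (P , [])
kInsertWord (a ∷ as) P with kInsert a P
... | (P′ , bx) with kInsertWord as P′
...   | (P″ , bxs) = (P″ , bx ∷ bxs)

-- Primed letters encoded in ℕ:  i' ↦ 2i-1,  i ↦ 2i  (so 1'<1<2'<2<…)

primedL : ℕ → ℕ
primedL i = 2 * i ∸ 1

unprimedL : ℕ → ℕ
unprimedL i = 2 * i

evenB : ℕ → Bool
evenB zero = true
evenB (suc zero) = false
evenB (suc (suc n)) = evenB n

primeOf : ℕ → ℕ
primeOf y = if evenB y then y ∸ 1 else y

incPrefixLen : List ℕ → ℕ
incPrefixLen [] = 0
incPrefixLen (x ∷ []) = 1
incPrefixLen (x ∷ y ∷ ys) = if x <ᵇ y then suc (incPrefixLen (y ∷ ys)) else 1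

labelAt : ℕ → Sign → ℕ → ℕ → ℕ
labelAt i s k j =
  if j <ᵇ k then primedL i
  else (if j ≡ᵇ k then (signLabel s) else unprimedL i)
  where
    signLabel : Sign → ℕ
    signLabel minusS = primedL i
    signLabel _ = unprimedL i

fillT : ℕ → Sign → ℕ → ℕ → List (ℕ × ℕ) → Tab → Tab
fillT i s k j [] T = T
fillT i s k j ((x , y) ∷ bs) T = fillT i s k (suc j) bs (appendAt x (labelAt i s k j) T)

KRfrom : ℕ → List Factor → Tab × Tab → Tab × Tab
KRfrom i [] PT = PT
KRfrom i ((s , a) ∷ As) (P , T) with kInsertWord a P
... | (P′ , bxs) =
  KRfrom (suc i) As (P′ , fillT i s (incPrefixLen (map proj₁ bxs)) 1 bxs T)

KR′ : List Factor → Tab × Tab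
KR′ A = KRfrom 1 A ([] , [])

getRow : ℕ → Tab → List ℕ
getRow _ [] = []
getRow zero (_ ∷ _) = []
getRow (suc zero) (R ∷ _) = R
getRow (suc (suc i)) (_ ∷ Rs) = getRow (suc i) Rs

lookupL : ℕ → List ℕ → Maybe ℕ
lookupL _ [] = nothing
lookupL zero (x ∷ _) = just x
lookupL (suc p) (_ ∷ xs) = lookupL p xs

setL : ℕ → ℕ → List ℕ → List ℕ
setL _ v [] = []
setL zero v (_ ∷ xs) = v ∷ xs
setL (suc p) v (x ∷ xs) = x ∷ setL p v xs

modRow : ℕ → (List ℕ → List ℕ) → Tab → Tab
modRow _ f [] = []
modRow zero f (R ∷ Rs) = R ∷ Rs
modRow (suc zero) f (R ∷ Rs) = f R ∷ Rs
modRow (suc (suc i)) f (R ∷ Rs) = R ∷ modRow (suc i) f Rs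

rowFind : ℕ → List ℕ → Maybe (ℕ × ℕ)
rowFind x [] = nothing
rowFind x (y ∷ ys) =
  if x <ᵇ y then just (0 , y)
  else mapMaybe (λ q → (suc (proj₁ q) , proj₂ q)) (rowFind x ys)

data ColRes : Set where
  appendRow : ℕ → ColRes
  bumpAt : ℕ → ℕ → ColRes

colFind : ℕ → ℕ → ℕ → Tab → ColRes
colFind x j i [] = appendRow i
colFind x j i (R ∷ Rs) with j <ᵇ i | lookupL (j ∸ i) R
... | true | _ = appendRow i
... | false | nothing = appendRow i
... | false | just y = if x <ᵇ y then bumpAt i y else colFind x j (suc i) Rs

data Mode : Set where
  rowM colM : ℕ → Mode

-- one insertion (with fuel bounding the length of the bumping path);
-- returns new tableau and new box (row, column)
mutual
  hmStep : ℕ → Mode → ℕ → Tab → Tab × (ℕ × ℕ)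
  hmStep zero _ x T = (T , (0 , 0))
  hmStep (suc f) (rowM i) x T with rowFind x (getRow i T)
  ... | nothing = (appendAt i x T , (i , i + length (getRow i T)))
  ... | just (p , y) = hmNext f i (i + p) y (modRow i (setL p x) T)
  hmStep (suc f) (colM j) x T with colFind x j 1 T
  ... | appendRow i = (appendAt i x T , (i , j))
  ... | bumpAt i y = hmNext f i j y (modRow i (setL (j ∸ i) x) T)

  hmNext : ℕ → ℕ → ℕ → ℕ → Tab → Tab × (ℕ × ℕ)
  hmNext f i j y T =
    if i ≡ᵇ j then hmStep f (colM (suc j)) (primeOf y) T
    else (if evenB y then hmStep f (rowM (suc i)) y T
    else hmStep f (colM (suc j)) y T)

size : Tab → ℕ
size T = sum (map length T)

hmFrom : ℕ → List ℕ → Tab × Tab → Tab × Tab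
hmFrom t [] PQ = PQ
hmFrom t (b ∷ bs) (P , Q) with hmStep (4 * (size P + 2)) (rowM 1) (unprimedL b) P
... | (P′ , (x , _)) = hmFrom (suc t) bs (P′ , appendAt x t Q)

HM : List ℕ → Tab × Tab
HM b = hmFrom 1 b ([] , [])

PHM : List ℕ → Tab
PHM b = proj₁ (HM b)

-- the fixed standard shifted tableau Q_λ of the shape of T (row reading)
qrowFrom : ℕ → List ℕ → Tab
qrowFrom t [] = []
qrowFrom t (l ∷ ls) = map (λ k → t + k) (upTo l) ∷ qrowFrom (t + l) ls

Qrow : Tab → Tab
Qrow T = qrowFrom 1 (map length T)

f1 : List ℕ → Maybe (List ℕ)
f1 [] = nothing
f1 (x ∷ xs) =
  if x ≡ᵇ 1 then just (2 ∷ xs)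
  else (if x ≡ᵇ 2 then nothing else mapMaybe (λ ys → x ∷ ys) (f1 xs))

dprRow : List ℕ → List ℕ
dprRow [] = []
dprRow (x ∷ xs) = (if evenB x then x else suc x) ∷ xs

DPR : Tab → Tab
DPR T = map dprRow T

prRow : List ℕ → List ℕ → List ℕ
prRow [] R = R
prRow (x ∷ _) [] = []
prRow (x ∷ _) (y ∷ ys) = (if evenB x then y else primeOf y) ∷ ys

PR : Tab → Tab → Tab
PR [] T″ = T″
PR (R ∷ Rs) [] = []
PR (R ∷ Rs) (R″ ∷ Rs″) = prRow R R″ ∷ PR Rs Rs″

-- f̃^P_1̄ T = P_HM (f̃_1̄ HM⁻¹(T , Q_λ)),  as the graph of the operator
-- (nothing = 𝟎)
FoddP : Tab → Maybe Tab → Set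
FoddP T r = Σ[ b ∈ List ℕ ] ((HM b ≡ (T , Qrow T)) × (mapMaybe PHM (f1 b) ≡ r))

FoddPM : Tab → Maybe Tab → Set
FoddPM T r = Σ[ r₀ ∈ Maybe Tab ] (FoddP (DPR T) r₀ × (mapMaybe (PR T) r₀ ≡ r))

-- OddF n m w A r  :⇔  f̃^F_1̄ A = r   (for A ∈ U_m^±(w); nothing = 𝟎),
-- i.e. r = KR'⁻¹ (P , f̃^{±P}_1̄ T) where KR'(A) = (P , T)
OddF : ℕ → ℕ → List ℤ → List Factor → Maybe (List Factor) → Set
OddF n m w A nothing = FoddPM (proj₂ (KR′ A)) nothing
OddF n m w A (just A′) =
  InU n m w A′ × (proj₁ (KR′ A′) ≡ proj₁ (KR′ A)) ×
  FoddPM (proj₂ (KR′ A)) (just (proj₂ (KR′ A′)))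

module Submission where

-- Both factorizations spell the same reduced word, so they have the same insertion tableau, and it
-- remains to compare the recording tableaux.  The odd operator only sees the first row of a primed
-- tableau: it changes the last 1 to 2′ (to 2 on the diagonal), unless the row has a 2′ or no 1.
-- Indeed, under mixed insertion of a word and of its image under f₁ the two tableaux differ in
-- exactly this cell from the moment the leftmost 1 is inserted.
--
-- For the operator to be defined, the recording tableau has to be a primed tableau; it then has a
-- preimage under mixed insertion, by reverse bumping.  This rests on two facts about Kraśkiewicz
-- insertion.  A row turns ascents of its input into ascents of its output, and once a descent has
-- become an ascent, all later descents of a decreasing run do; hence the rows of the new boxes
-- first rise strictly and then fall weakly.  And the shape stays strict because each row remains a
-- unimodal subword of maximum length of the row below followed by it: any unimodal subword of the
-- result of a bump can be exchanged for one at least as long before the bump.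

open import Defs
open import Data.Bool using (true; false; if_then_else_; _∧_)
open import Data.Bool.Properties using (T-≡)
open import Data.Empty using (⊥; ⊥-elim)
open import Data.Integer using (ℤ)
import Data.Integer.Properties as ℤ
open import Data.List using (List; []; _∷_; _++_; length; map; foldl; upTo; concat; replicate; initLast; _∷ʳ′_)
open import Data.List.Membership.Propositional using (_∈_)
open import Data.List.Membership.Propositional.Properties using (∈-++⁻; ∈-++⁺ˡ; ∈-++⁺ʳ; ∈-∃++)
open import Data.List.Properties using (++-assoc; ++-identityʳ; ∷-injective; ∷-injectiveˡ; ∷-injectiveʳ; ∷ʳ-injective; foldl-++; length-++; length-map; length-replicate; length-upTo; map-++; upTo-∷ʳ)
open import Data.List.Relation.Binary.Sublist.Propositional using (_⊆_; []; _∷_; _∷ʳ_; ⊆-refl) renaming (lookup to ⊆-lookup)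
open import Data.List.Relation.Binary.Sublist.Propositional.Properties using (All-resp-⊆) renaming (++⁺ to ⊆-++⁺; length-mono-≤ to ⊆-length)
open import Data.List.Relation.Unary.All as All using (All; []; _∷_)
import Data.List.Relation.Unary.All.Properties as All
open import Data.List.Relation.Unary.AllPairs as AllPairs using (AllPairs; []; _∷_)
import Data.List.Relation.Unary.AllPairs.Properties as AllPairs
open import Data.List.Relation.Unary.Any using (here; there)
open import Data.Maybe using (Maybe; just; nothing) renaming (map to mapMaybe)
open import Data.Nat using (ℕ; zero; suc; _+_; _*_; _∸_; _≤_; _<_; z≤n; s≤s; _<ᵇ_; _≡ᵇ_; _≤ᵇ_)
open import Data.Nat.ListAction using (sum)
open import Data.Nat.Properties
open import Data.Product using (_×_; _,_; proj₁; proj₂; ∃-syntax)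
open import Data.Sum using (_⊎_; inj₁; inj₂)
open import Function.Bundles using (Equivalence)
open import Relation.Binary.Definitions using (tri<; tri≈; tri>)
open import Relation.Binary.PropositionalEquality using (_≡_; _≢_; refl; sym; trans; cong; cong₂; subst; subst₂; module ≡-Reasoning)
open import Relation.Nullary using (¬_; yes; no)

-- In case (1) let `x` end the first factor and `y` begin the second. Suppose that `x a₂` is
-- unimodal. Then `y` cannot be appended to the row of the first factor; it bumps and opens the
-- second row, and no letter of the second factor gets below that row, so the turn of the second
-- hill is the box of `y`. Handing `x` over puts one box of the first row in front of this turn.
-- That box receives 2′, while the other labels merely change their index. If `x a₂` is not
-- unimodal, reducedness excludes `x = y`, and `a₂` begins with a peak above `x`: the box of its
-- first letter lies in the first row before the turn, so a 2′ is already there. In case (2) both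
-- factors stay in the first row, and the sign of a nonempty second factor is the label of its first
-- box. Which alternative `f1` takes on a preimage under mixed insertion is read off from the first
-- row, since the two outcomes leave disjoint kinds of first rows.

-- Reduced words

infix 4 _∼_

-- Braid equivalence of type B words, without cancellation of squares. The successors in `braid`
-- keep the letter 0 out of the length-three relation, as the product of the generators 0 and 1 has
-- order four.
data _∼_ : List ℕ → List ℕ → Set where
  swap   : ∀ {x y w} → suc x < y → x ∷ y ∷ w ∼ y ∷ x ∷ w
  braid  : ∀ {x w} → suc x ∷ suc (suc x) ∷ suc x ∷ w ∼ suc (suc x) ∷ suc x ∷ suc (suc x) ∷ w
  braid₀ : ∀ {w} → 0 ∷ 1 ∷ 0 ∷ 1 ∷ w ∼ 1 ∷ 0 ∷ 1 ∷ 0 ∷ w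
  prep   : ∀ x {w w′} → w ∼ w′ → x ∷ w ∼ x ∷ w′
  rfl    : ∀ {w} → w ∼ w
  symm   : ∀ {w w′} → w ∼ w′ → w′ ∼ w
  tran   : ∀ {w w′ w″} → w ∼ w′ → w′ ∼ w″ → w ∼ w″

∼-prefix : ∀ u {w w′} → w ∼ w′ → u ++ w ∼ u ++ w′
∼-prefix []      e = e
∼-prefix (x ∷ u) e = prep x (∼-prefix u e)

∼-suffix : ∀ {w w′} v → w ∼ w′ → w ++ v ∼ w′ ++ v
∼-suffix v (swap p)   = swap p
∼-suffix v braid      = braid
∼-suffix v braid₀     = braid₀
∼-suffix v (prep x e) = prep x (∼-suffix v e)
∼-suffix v rfl        = rfl
∼-suffix v (symm e)   = symm (∼-suffix v e)
∼-suffix v (tran e f) = tran (∼-suffix v e) (∼-suffix v f)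

≡⇒∼ : ∀ {w w′} → w ≡ w′ → w ∼ w′
≡⇒∼ refl = rfl

-- All that is used of reducedness.
Red : List ℕ → Set
Red w = ∀ u x v → ¬ (w ∼ u ++ x ∷ x ∷ v)

Red-resp-∼ : ∀ {w w′} → w ∼ w′ → Red w → Red w′
Red-resp-∼ e r u x v e′ = r u x v (tran e e′)

Red-prefix : ∀ w v → Red (w ++ v) → Red w
Red-prefix w v r u x v′ e =
  r u x (v′ ++ v) (tran (∼-suffix v e) (≡⇒∼ (++-assoc u (x ∷ x ∷ v′) v)))

Red-suffix : ∀ u w → Red (u ++ w) → Red w
Red-suffix u w r u′ x v e =
  r (u ++ u′) x v (tran (∼-prefix u e) (≡⇒∼ (sym (++-assoc u u′ (x ∷ x ∷ v)))))

commutes-past : ∀ {x} u {v} → All (λ y → suc x < y ⊎ suc y < x) u → u ++ x ∷ v ∼ x ∷ u ++ v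
commutes-past []      []             = rfl
commutes-past (y ∷ u) (inj₁ p ∷ ps) = tran (prep y (commutes-past u ps)) (symm (swap p))
commutes-past (y ∷ u) (inj₂ p ∷ ps) = tran (prep y (commutes-past u ps)) (swap p)

∼-length : ∀ {w w′} → w ∼ w′ → length w ≡ length w′
∼-length (swap _)   = refl
∼-length braid      = refl
∼-length braid₀     = refl
∼-length (prep x e) = cong suc (∼-length e)
∼-length rfl        = refl
∼-length (symm e)   = sym (∼-length e)
∼-length (tran e f) = trans (∼-length e) (∼-length f)

-- Both directions are proved at once because `symm` exchanges them.
∼-All : ∀ {P : ℕ → Set} {w w′} → w ∼ w′ → (All P w → All P w′) × (All P w′ → All P w)
∼-All (swap _)   = (λ { (p ∷ q ∷ r) → q ∷ p ∷ r }) , (λ { (p ∷ q ∷ r) → q ∷ p ∷ r })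
∼-All braid      = (λ { (p ∷ q ∷ _ ∷ r) → q ∷ p ∷ q ∷ r }) , (λ { (p ∷ q ∷ _ ∷ r) → q ∷ p ∷ q ∷ r })
∼-All braid₀     = (λ { (p ∷ q ∷ _ ∷ _ ∷ r) → q ∷ p ∷ q ∷ p ∷ r }) , (λ { (p ∷ q ∷ _ ∷ _ ∷ r) → q ∷ p ∷ q ∷ p ∷ r })
∼-All (prep x e) = (λ { (p ∷ r) → p ∷ proj₁ (∼-All e) r }) , (λ { (p ∷ r) → p ∷ proj₂ (∼-All e) r })
∼-All rfl        = (λ r → r) , (λ r → r)
∼-All (symm e)   = proj₂ (∼-All e) , proj₁ (∼-All e)
∼-All (tran e f) = (λ r → proj₁ (∼-All f) (proj₁ (∼-All e) r)) , (λ r → proj₂ (∼-All e) (proj₂ (∼-All f) r))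

-- Action of the generators on windows

swapAt-length : ∀ k w → length (swapAt k w) ≡ length w
swapAt-length zero    []          = refl
swapAt-length zero    (x ∷ [])    = refl
swapAt-length zero    (x ∷ y ∷ r) = refl
swapAt-length (suc k) []          = refl
swapAt-length (suc k) (x ∷ r)     = cong suc (swapAt-length k r)

swapAt-involutive : ∀ k w → swapAt k (swapAt k w) ≡ w
swapAt-involutive zero    []          = refl
swapAt-involutive zero    (x ∷ [])    = refl
swapAt-involutive zero    (x ∷ y ∷ r) = refl
swapAt-involutive (suc k) []          = refl
swapAt-involutive (suc k) (x ∷ r)     = cong (x ∷_) (swapAt-involutive k r)

swapAt-comm : ∀ i j w → suc i < j → swapAt j (swapAt i w) ≡ swapAt i (swapAt j w)
swapAt-comm zero    (suc (suc j)) []          p = refl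
swapAt-comm zero    (suc (suc j)) (x ∷ [])    p = refl
swapAt-comm zero    (suc (suc j)) (x ∷ y ∷ r) p = refl
swapAt-comm zero    (suc zero)    w           (s≤s ())
swapAt-comm (suc i) (suc j)       []          p = refl
swapAt-comm (suc i) (suc j)       (x ∷ r) (s≤s p) = cong (x ∷_) (swapAt-comm i j r p)

swapAt-braid : ∀ i w → suc (suc i) < length w →
  swapAt i (swapAt (suc i) (swapAt i w)) ≡ swapAt (suc i) (swapAt i (swapAt (suc i) w))
swapAt-braid zero    (x ∷ y ∷ z ∷ r) p       = refl
swapAt-braid zero    (x ∷ y ∷ [])    (s≤s (s≤s ()))
swapAt-braid zero    (x ∷ [])        (s≤s ())
swapAt-braid (suc i) (x ∷ r)         (s≤s p) = cong (x ∷_) (swapAt-braid i r p)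

applyGen-length : ∀ i w → length (applyGen i w) ≡ length w
applyGen-length zero    []      = refl
applyGen-length zero    (x ∷ r) = refl
applyGen-length (suc i) w       = swapAt-length i w

applyGen-involutive : ∀ i w → applyGen i (applyGen i w) ≡ w
applyGen-involutive zero    []      = refl
applyGen-involutive zero    (x ∷ r) = cong (_∷ r) (ℤ.neg-involutive x)
applyGen-involutive (suc i) w       = swapAt-involutive i w

applyGen-comm : ∀ i j w → suc i < j → applyGen j (applyGen i w) ≡ applyGen i (applyGen j w)
applyGen-comm zero    (suc (suc j)) []      p       = refl
applyGen-comm zero    (suc (suc j)) (x ∷ r) p       = refl
applyGen-comm zero    (suc zero)    w       (s≤s ())
applyGen-comm (suc i) (suc j)       w       (s≤s p) = swapAt-comm i j w p

act : List ℤ → List ℕ → List ℤ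
act = foldl (λ w i → applyGen i w)

-- The bound on the letters matters: a generator out of range acts as the identity, and `braid` then
-- fails at the end of the window.
act-resp-∼ : ∀ {a b} → a ∼ b → ∀ w → All (_< length w) a → act w a ≡ act w b
act-resp-∼ (swap {x} {y} {w} p) u _ = cong (λ t → act t w) (applyGen-comm x y u p)
act-resp-∼ (braid {x} {w}) u (_ ∷ q ∷ _) = cong (λ t → act t w) (swapAt-braid x u q)
act-resp-∼ (braid₀ {w}) (x ∷ y ∷ r) _ = refl
act-resp-∼ braid₀ (x ∷ []) (_ ∷ s≤s () ∷ _)
act-resp-∼ braid₀ [] (() ∷ _)
act-resp-∼ (prep x {w} {w′} e) u (_ ∷ ps) =
  act-resp-∼ e (applyGen x u) (subst (λ n → All (_< n) w) (sym (applyGen-length x u)) ps)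
act-resp-∼ rfl        u _  = refl
act-resp-∼ (symm e)   u ps = sym (act-resp-∼ e u (proj₂ (∼-All e) ps))
act-resp-∼ (tran e f) u ps = trans (act-resp-∼ e u ps) (act-resp-∼ f u (proj₁ (∼-All e) ps))

-- Deleting a doubled letter keeps the value, generators being involutions, and would give a word
-- shorter by two.
IsReduced⇒Red : ∀ {n w a} → IsReduced n w a → Red a
IsReduced⇒Red {n} {w} {a} (a<n , ev , minl) u x v e =
  <-irrefl refl (≤-trans (s≤s (n≤1+n _)) (≤-trans (≤-reflexive (sym len)) (minl (u ++ v) uv<n ev′)))
  where
  idn = idW n
  len-id : length idn ≡ n
  len-id = trans (length-map _ (upTo n)) (length-upTo n)
  b<n : All (_< n) (u ++ x ∷ x ∷ v)
  b<n = proj₁ (∼-All e) a<n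
  uv<n : All (_< n) (u ++ v)
  uv<n with All.++⁻ u b<n
  ... | p , (_ ∷ _ ∷ q) = All.++⁺ p q
  ev′ : evalWord n (u ++ v) ≡ w
  ev′ = begin
    act idn (u ++ v)           ≡⟨ foldl-++ _ idn u v ⟩
    act (act idn u) v          ≡⟨ cong (λ t → act t v) (sym (applyGen-involutive x (act idn u))) ⟩
    act (act idn u) (x ∷ x ∷ v) ≡⟨ sym (foldl-++ _ idn u (x ∷ x ∷ v)) ⟩
    act idn (u ++ x ∷ x ∷ v)   ≡⟨ sym (act-resp-∼ e idn (subst (λ k → All (_< k) a) (sym len-id) a<n)) ⟩
    act idn a                  ≡⟨ ev ⟩
    w ∎
    where open ≡-Reasoning
  len : length a ≡ suc (suc (length (u ++ v)))
  len = begin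
    length a ≡⟨ ∼-length e ⟩
    length (u ++ x ∷ x ∷ v) ≡⟨ length-++ u ⟩
    length u + suc (suc (length v)) ≡⟨ +-suc _ _ ⟩
    suc (length u + suc (length v)) ≡⟨ cong suc (+-suc _ _) ⟩
    suc (suc (length u + length v)) ≡⟨ cong (λ k → suc (suc k)) (sym (length-++ u)) ⟩
    suc (suc (length (u ++ v))) ∎
    where open ≡-Reasoning

-- Row insertion

<⇒<ᵇ≡ : ∀ {x y} → x < y → (x <ᵇ y) ≡ true
<⇒<ᵇ≡ p = Equivalence.to T-≡ (<⇒<ᵇ p)

<ᵇ≡⇒< : ∀ x y → (x <ᵇ y) ≡ true → x < y
<ᵇ≡⇒< x y e = <ᵇ⇒< x y (Equivalence.from T-≡ e)

≥⇒<ᵇ≡ : ∀ {x y} → y ≤ x → (x <ᵇ y) ≡ false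
≥⇒<ᵇ≡ {x} {y} p with x <ᵇ y in eq
... | false = refl
... | true  = ⊥-elim (<⇒≱ (<ᵇ≡⇒< x y eq) p)

≤⇒≤ᵇ≡ : ∀ {x y} → x ≤ y → (x ≤ᵇ y) ≡ true
≤⇒≤ᵇ≡ p = Equivalence.to T-≡ (≤⇒≤ᵇ p)

>⇒≤ᵇ≡ : ∀ {x y} → y < x → (x ≤ᵇ y) ≡ false
>⇒≤ᵇ≡ {suc x} p = ≥⇒<ᵇ≡ (≤-pred p)

≡ᵇ-refl : ∀ x → (x ≡ᵇ x) ≡ true
≡ᵇ-refl x = Equivalence.to T-≡ (≡⇒≡ᵇ x x refl)

≢⇒≡ᵇ : ∀ {x y} → x ≢ y → (x ≡ᵇ y) ≡ false
≢⇒≡ᵇ {x} {y} p with x ≡ᵇ y in eq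
... | false = refl
... | true  = ⊥-elim (p (≡ᵇ⇒≡ x y (Equivalence.from T-≡ eq)))

-- Unimodal words and their two parts

Dec Inc : List ℕ → Set
Dec = AllPairs (λ x y → y < x)
Inc = AllPairs _<_

AllPairs-++⁻ : ∀ {R : ℕ → ℕ → Set} xs {ys} → AllPairs R (xs ++ ys) →
  AllPairs R xs × AllPairs R ys × All (λ x → All (R x) ys) xs
AllPairs-++⁻ []       p        = [] , p , []
AllPairs-++⁻ (x ∷ xs) (px ∷ p) =
  let q , r , s = AllPairs-++⁻ xs p
  in All.++⁻ˡ xs px ∷ q , r , All.++⁻ʳ xs px ∷ s

-- The minimum `m` is kept apart, so that `D ++ m ∷ []` is the decreasing part returned by `splitU`
-- and `I` the increasing part. The empty word has no such form.
data Can : List ℕ → Set where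
  can : ∀ D m I → Dec D → All (m <_) D → All (m <_) I → Inc I → Can (D ++ m ∷ I)

incB-sound : ∀ x xs → incB (x ∷ xs) ≡ true → Inc (x ∷ xs)
incB-sound x []       e = [] ∷ []
incB-sound x (y ∷ ys) e with x <ᵇ y in x<y
... | true with incB-sound y ys e
...   | ps ∷ p = (x<y′ ∷ All.map (<-trans x<y′) ps) ∷ ps ∷ p
  where x<y′ = <ᵇ≡⇒< x y x<y

incB-complete : ∀ x {xs} → Inc (x ∷ xs) → incB (x ∷ xs) ≡ true
incB-complete x {[]}     p                = refl
incB-complete x {y ∷ ys} ((p ∷ _) ∷ q) rewrite <⇒<ᵇ≡ p = incB-complete y q

unimodalFrom-sound : ∀ x xs → unimodalFrom x xs ≡ true → Can (x ∷ xs)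
unimodalFrom-sound x []       e = can [] x [] [] [] [] []
unimodalFrom-sound x (y ∷ ys) e with y <ᵇ x in y<x
... | true  = extend refl (unimodalFrom-sound y ys e)
  where
  y<x′ = <ᵇ≡⇒< y x y<x
  extend : ∀ {R} → R ≡ y ∷ ys → Can R → Can (x ∷ R)
  extend eq (can [] m I p q r s) with ∷-injectiveˡ eq
  ... | refl = can (x ∷ []) m I ([] ∷ []) (y<x′ ∷ []) r s
  extend eq (can (z ∷ D) m I (p ∷ ps) (q ∷ qs) r s) with ∷-injectiveˡ eq
  ... | refl = can (x ∷ z ∷ D) m I ((y<x′ ∷ All.map (λ t → <-trans t y<x′) p) ∷ p ∷ ps)
                   (<-trans q y<x′ ∷ q ∷ qs) r s
... | false with incB-sound x (y ∷ ys) e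
...   | p ∷ q = can [] x (y ∷ ys) [] [] p q

unimodal-sound : ∀ R → unimodal R ≡ true → R ≢ [] → Can R
unimodal-sound []      e ne = ⊥-elim (ne refl)
unimodal-sound (x ∷ R) e ne = unimodalFrom-sound x R e

unimodal-dec : ∀ D {m J} → Dec D → All (m <_) D → unimodal (D ++ m ∷ J) ≡ unimodalFrom m J
unimodal-dec []          p q = refl
unimodal-dec (x ∷ [])    p (q ∷ []) rewrite <⇒<ᵇ≡ q = refl
unimodal-dec (x ∷ y ∷ D) ((p ∷ _) ∷ ps) (_ ∷ q ∷ qs) rewrite <⇒<ᵇ≡ p = unimodal-dec (y ∷ D) ps (q ∷ qs)

unimodalFrom-up : ∀ {m y J} → m < y → unimodalFrom m (y ∷ J) ≡ incB (m ∷ y ∷ J)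
unimodalFrom-up p rewrite ≥⇒<ᵇ≡ (<⇒≤ p) = refl

unimodal-complete : ∀ {R} → Can R → unimodal R ≡ true
unimodal-complete (can D m [] p q r s) = unimodal-dec D p q
unimodal-complete (can D m (y ∷ I) p q (r ∷ rs) s) =
  trans (unimodal-dec D p q) (trans (unimodalFrom-up {J = I} r) (incB-complete m ((r ∷ rs) ∷ s)))

splitU-can : ∀ D {m I} → Dec D → All (m <_) D → All (m <_) I → splitU (D ++ m ∷ I) ≡ (D ++ m ∷ [] , I)
splitU-can []          {I = []}    p q r = refl
splitU-can []          {I = y ∷ I} p q (r ∷ _) rewrite ≥⇒<ᵇ≡ (<⇒≤ r) = refl
splitU-can (x ∷ [])    {m} {I} p (q ∷ []) r rewrite <⇒<ᵇ≡ q | splitU-can [] {m} {I} [] [] r = refl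
splitU-can (x ∷ y ∷ D) {m} {I} ((p ∷ _) ∷ ps) (_ ∷ qs) r
  rewrite <⇒<ᵇ≡ p | splitU-can (y ∷ D) {m} {I} ps qs r = refl

data Split≥ (a : ℕ) : List ℕ → Set where
  all<  : ∀ {I} → All (_< a) I → Split≥ a I
  split : ∀ I₁ b I₂ → All (_< a) I₁ → a ≤ b → Split≥ a (I₁ ++ b ∷ I₂)

split≥ : ∀ a I → Split≥ a I
split≥ a []      = all< []
split≥ a (x ∷ I) with <-≤-connex x a
... | inj₂ a≤x = split [] x I [] a≤x
... | inj₁ x<a with split≥ a I
...   | all< p            = all< (x<a ∷ p)
...   | split I₁ b I₂ p q = split (x ∷ I₁) b I₂ (x<a ∷ p) q

split≤ : ∀ c D {m} → m ≤ c → ∃[ D₁ ] ∃[ d ] ∃[ D₂ ] D ++ m ∷ [] ≡ D₁ ++ d ∷ D₂ × All (c <_) D₁ × d ≤ c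
split≤ c []      {m} p = [] , m , [] , refl , [] , p
split≤ c (x ∷ D) {m} p with <-≤-connex c x
... | inj₂ x≤c = [] , x , D ++ m ∷ [] , refl , [] , x≤c
... | inj₁ c<x with split≤ c D p
...   | D₁ , d , D₂ , e , q , r = x ∷ D₁ , d , D₂ , cong (x ∷_) e , c<x ∷ q , r

bumpInc-split : ∀ {a b} I₁ {I₂} → All (_< a) I₁ → a ≤ b → bumpInc a (I₁ ++ b ∷ I₂) ≡ just (b , I₁ ++ a ∷ I₂)
bumpInc-split []       []       q rewrite ≤⇒≤ᵇ≡ q = refl
bumpInc-split {a} {b} (x ∷ I₁) {I₂} (p ∷ ps) q
  rewrite >⇒≤ᵇ≡ p | bumpInc-split {a} {b} I₁ {I₂} ps q = refl

bumpDec-split : ∀ {c d} D₁ {D₂} → All (c <_) D₁ → d ≤ c → bumpDec c (D₁ ++ d ∷ D₂) ≡ just (d , D₁ ++ c ∷ D₂)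
bumpDec-split []       []       q rewrite ≤⇒≤ᵇ≡ q = refl
bumpDec-split {c} {d} (x ∷ D₁) {D₂} (p ∷ ps) q
  rewrite >⇒≤ᵇ≡ p | bumpDec-split {c} {d} D₁ {D₂} ps q = refl

-- The case distinctions of the bump carry what reducedness forces: a + 1 follows a repeated
-- letter a in the increasing part, and c - 1 follows a repeated letter c in the decreasing part.

data IBump : (a b : ℕ) (I₂ : List ℕ) (c : ℕ) → Set where
  below : ∀ {a b I₂} → a < b → IBump a b I₂ b
  equal : ∀ {a I₃} → IBump a a (suc a ∷ I₃) (suc a)

data DBump : (c d : ℕ) (D₂ : List ℕ) (a′ : ℕ) → Set where
  below : ∀ {c d D₂} → d < c → DBump c d D₂ d
  equal : ∀ {c D₃} → 1 ≤ c → DBump (suc c) (suc c) (c ∷ D₃) c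

-- Outcome of an insertion that does not append. The equation with `D₀` and `m` locates the minimum
-- in the decreasing part, where the bumped letter `d` may be `m` itself. The form of `special` is
-- forced: in a unimodal row containing 101 these letters are adjacent.
data Bump : List ℕ → ℕ → List ℕ → ℕ → Set where
  special : ∀ D I → Dec D → All (1 <_) D → Inc I → All (1 <_) I →
            Bump (D ++ 1 ∷ 0 ∷ 1 ∷ I) 0 (D ++ 1 ∷ 0 ∷ 1 ∷ I) 0
  general : ∀ {a} D₀ m D₁ {d} D₂ I₁ {b} I₂ {c a′} → D₀ ++ m ∷ [] ≡ D₁ ++ d ∷ D₂ →
            Dec (D₁ ++ d ∷ D₂) → All (m <_) (I₁ ++ b ∷ I₂) → Inc (I₁ ++ b ∷ I₂) →
            All (_< a) I₁ → IBump a b I₂ c → All (c <_) D₁ → DBump c d D₂ a′ →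
            Bump ((D₁ ++ d ∷ D₂) ++ I₁ ++ b ∷ I₂) a ((D₁ ++ c ∷ D₂) ++ I₁ ++ a ∷ I₂) a′

IBump-a<c : ∀ {a b I₂ c} → IBump a b I₂ c → a < c
IBump-a<c (below p) = p
IBump-a<c equal     = ≤-refl

IBump-b≤c : ∀ {a b I₂ c} → IBump a b I₂ c → b ≤ c
IBump-b≤c (below p) = ≤-refl
IBump-b≤c equal     = n≤1+n _

IBump-a≤b : ∀ {a b I₂ c} → IBump a b I₂ c → a ≤ b
IBump-a≤b (below p) = <⇒≤ p
IBump-a≤b equal     = ≤-refl

DBump-d≤c : ∀ {c d D₂ a′} → DBump c d D₂ a′ → d ≤ c
DBump-d≤c (below p) = <⇒≤ p
DBump-d≤c (equal _) = ≤-refl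

far< : ∀ {x a b} → x < a → a < b → suc x < b
far< p q = ≤-trans (s≤s p) q

-- Commutations carry `a` to its place and `b` out to the left; for `a = b` the braid relation on a,
-- a+1, a does it. The side condition excludes `a = b = 0`, where no length-three relation is
-- available.
IBump-∼ : ∀ {a b I₁ I₂ c} → 1 ≤ a ⊎ a < b → Inc (I₁ ++ b ∷ I₂) → All (_< a) I₁ → IBump a b I₂ c →
  (I₁ ++ b ∷ I₂) ++ a ∷ [] ∼ c ∷ I₁ ++ a ∷ I₂
IBump-∼ {a} {b} {I₁} {I₂} _ inc I₁<a (below a<b) with AllPairs-++⁻ I₁ inc
... | _ , (b<I₂ ∷ _) , _ =
  tran (≡⇒∼ (++-assoc I₁ (b ∷ I₂) (a ∷ [])))
  (tran (∼-prefix I₁ (prep b (tran (commutes-past I₂ (All.map (λ p → inj₁ (far< a<b p)) b<I₂)) (≡⇒∼ (cong (a ∷_) (++-identityʳ I₂))))))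
        (commutes-past I₁ (All.map (λ p → inj₂ (far< p a<b)) I₁<a)))
IBump-∼ {suc a} {I₁ = I₁} (inj₁ _) inc I₁<a (equal {I₃ = I₃}) with AllPairs-++⁻ I₁ inc
... | _ , ((_ ∷ _) ∷ a+1<I₃ ∷ _) , _ =
  tran (≡⇒∼ (++-assoc I₁ _ _))
  (tran (∼-prefix I₁ (prep _ (prep _ (tran (commutes-past I₃ (All.map inj₁ a+1<I₃)) (≡⇒∼ (cong (suc a ∷_) (++-identityʳ I₃)))))))
  (tran (∼-prefix I₁ braid)
        (commutes-past I₁ (All.map (λ p → inj₂ (s≤s p)) I₁<a))))
IBump-∼ {zero} (inj₁ ()) inc I₁<a equal
IBump-∼ {zero} (inj₂ ()) inc I₁<a equal
IBump-∼ {suc a} (inj₂ p) inc I₁<a equal = ⊥-elim (<-irrefl refl p)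

-- The mirror image of `IBump-∼`. In the case `equal` the bound `1 ≤ c` is what makes the letters
-- c+1, c, c+1 subject to a length-three relation.
DBump-∼ : ∀ {c d D₁ D₂ a′} → Dec (D₁ ++ d ∷ D₂) → All (c <_) D₁ → DBump c d D₂ a′ → ∀ J →
  (D₁ ++ d ∷ D₂) ++ c ∷ J ∼ a′ ∷ (D₁ ++ c ∷ D₂) ++ J
DBump-∼ {c} {d} {D₁} {D₂} dec c<D₁ (below d<c) J with AllPairs-++⁻ D₁ dec
... | _ , (D₂<d ∷ _) , _ =
  tran (≡⇒∼ (++-assoc D₁ (d ∷ D₂) (c ∷ J)))
  (tran (∼-prefix D₁ (prep d (commutes-past D₂ (All.map (λ p → inj₂ (far< p d<c)) D₂<d))))
  (tran (commutes-past D₁ (All.map (λ p → inj₁ (far< d<c p)) c<D₁))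
        (≡⇒∼ (cong (d ∷_) (sym (++-assoc D₁ (c ∷ D₂) J))))))
DBump-∼ {D₁ = D₁} dec c<D₁ (equal {suc c} {D₃} _) J with AllPairs-++⁻ D₁ dec
... | _ , (_ ∷ D₃<c ∷ _) , _ =
  tran (≡⇒∼ (++-assoc D₁ (suc (suc c) ∷ suc c ∷ D₃) (suc (suc c) ∷ J)))
  (tran (∼-prefix D₁ (prep _ (prep _ (commutes-past D₃ (All.map (λ p → inj₂ (s≤s p)) D₃<c)))))
  (tran (∼-prefix D₁ (symm braid))
  (tran (commutes-past D₁ (All.map (λ p → inj₁ p) c<D₁))
        (≡⇒∼ (cong (suc c ∷_) (sym (++-assoc D₁ (suc (suc c) ∷ suc c ∷ D₃) J)))))))

-- If the letter after the old `a` skipped a+1, the new `a` would commute back to the old one and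
-- form a square.
bump-Red-I : ∀ X {a I₂} → Inc (a ∷ I₂) → Red (X ++ a ∷ I₂ ++ a ∷ []) → ∃[ I₃ ] I₂ ≡ suc a ∷ I₃
bump-Red-I X {a} {[]} inc red = ⊥-elim (red X a [] rfl)
bump-Red-I X {a} {y ∷ I₃} ((p ∷ _) ∷ q ∷ _) red with m≤n⇒m<n∨m≡n p
... | inj₂ refl = I₃ , refl
... | inj₁ r    = ⊥-elim (red X a ((y ∷ I₃) ++ []) (∼-prefix X (prep a
                    (commutes-past (y ∷ I₃) (inj₁ r ∷ All.map (λ s → inj₁ (<-trans r s)) q)))))

bump-Red-D : ∀ X {c D₂ J} → Dec (c ∷ D₂) → Red (X ++ c ∷ D₂ ++ c ∷ J) → ∃[ D₃ ] ∃[ c₀ ] c ≡ suc c₀ × D₂ ≡ c₀ ∷ D₃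
bump-Red-D X {c} {[]} {J} dec red = ⊥-elim (red X c J rfl)
bump-Red-D X {suc c} {y ∷ D₃} {J} ((p ∷ _) ∷ q ∷ _) red with m≤n⇒m<n∨m≡n p
... | inj₂ refl = D₃ , c , refl , refl
... | inj₁ r    = ⊥-elim (red X (suc c) (y ∷ D₃ ++ J) (∼-prefix X (prep (suc c)
                    (commutes-past (y ∷ D₃) (inj₂ r ∷ All.map (λ s → inj₂ (<-trans (s≤s s) r)) q)))))

isSubseq-sound : ∀ s R → isSubseq s R ≡ true → s ⊆ R
isSubseq-sound []      []      e = []
isSubseq-sound []      (y ∷ R) e = y ∷ʳ isSubseq-sound [] R refl
isSubseq-sound (x ∷ s) (y ∷ R) e with x ≡ᵇ y in eq
... | true  = ≡ᵇ⇒≡ x y (Equivalence.from T-≡ eq) ∷ isSubseq-sound s R e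
... | false = y ∷ʳ isSubseq-sound (x ∷ s) R e

isSubseq-101 : ∀ D I → All (1 <_) D → isSubseq (1 ∷ 0 ∷ 1 ∷ []) (D ++ 1 ∷ 0 ∷ 1 ∷ I) ≡ true
isSubseq-101 []      []      p        = refl
isSubseq-101 []      (_ ∷ I) p        = refl
isSubseq-101 (x ∷ D) I       (p ∷ ps) rewrite ≢⇒≡ᵇ (<⇒≢ p) = isSubseq-101 D I ps

⊆-++⁻ : ∀ {v : List ℕ} xs {ys} → v ⊆ xs ++ ys → ∃[ v₁ ] ∃[ v₂ ] v ≡ v₁ ++ v₂ × v₁ ⊆ xs × v₂ ⊆ ys
⊆-++⁻ []       s          = [] , _ , refl , [] , s
⊆-++⁻ (x ∷ xs) (.x ∷ʳ s)  = let v₁ , v₂ , e , s₁ , s₂ = ⊆-++⁻ xs s in v₁ , v₂ , e , x ∷ʳ s₁ , s₂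
⊆-++⁻ (x ∷ xs) (refl ∷ s) =
  let v₁ , v₂ , e , s₁ , s₂ = ⊆-++⁻ xs s in x ∷ v₁ , v₂ , cong (x ∷_) e , refl ∷ s₁ , s₂

above-0-hits-1 : ∀ {D} → Dec D → All (0 <_) D → (1 ∷ []) ⊆ D → ∃[ D′ ] D ≡ D′ ++ 1 ∷ [] × All (1 <_) D′
above-0-hits-1 {x ∷ D} (p ∷ ps) (q ∷ qs) (refl ∷ s) with D
... | []    = [] , refl , []
above-0-hits-1 {x ∷ D} ((s≤s () ∷ _) ∷ ps) (q ∷ s≤s _ ∷ qs) (refl ∷ s) | y ∷ D′
above-0-hits-1 {x ∷ D} (p ∷ ps) (q ∷ qs) (.x ∷ʳ s) with above-0-hits-1 ps qs s
... | D′ , refl , r = x ∷ D′ , refl , (All.head (All.++⁻ʳ D′ p) ∷ r)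

above-0-starts-1 : ∀ {I} → Inc I → All (0 <_) I → (1 ∷ []) ⊆ I → ∃[ I′ ] I ≡ 1 ∷ I′
above-0-starts-1 {x ∷ I} p (q ∷ qs) (refl ∷ s) = I , refl
above-0-starts-1 {x ∷ I} (p ∷ ps) (q ∷ qs) (.x ∷ʳ s) with All-resp-⊆ s p
... | r ∷ [] = ⊥-elim (<-irrefl refl (≤-trans r q))

-- A letter below 1 can only be the minimum, so the two 1's lie on its two sides, and strict
-- monotonicity puts them next to it.
contains-101 : ∀ {D m I} → Dec D → All (m <_) D → All (m <_) I → Inc I →
  isSubseq (1 ∷ 0 ∷ 1 ∷ []) (D ++ m ∷ I) ≡ true →
  ∃[ D′ ] ∃[ I′ ] (D ≡ D′ ++ 1 ∷ []) × All (1 <_) D′ × m ≡ 0 × I ≡ 1 ∷ I′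
contains-101 {D} {m} {I} p q r s e with ⊆-++⁻ D (isSubseq-sound _ (D ++ m ∷ I) e)
... | [] , _ , refl , _ , (.m ∷ʳ t) = ⊥-elim (noZero (All-resp-⊆ t r))
  where noZero : ¬ All (m <_) (1 ∷ 0 ∷ 1 ∷ [])
        noZero (_ ∷ () ∷ _)
... | [] , _ , refl , _ , (refl ∷ t) = ⊥-elim (noZero (All-resp-⊆ t r))
  where noZero : ¬ All (1 <_) (0 ∷ 1 ∷ [])
        noZero (() ∷ _)
... | x ∷ [] , _ , refl , t , (.m ∷ʳ u) = ⊥-elim (noZero (All-resp-⊆ u r))
  where noZero : ¬ All (m <_) (0 ∷ 1 ∷ [])
        noZero (() ∷ _)
... | x ∷ [] , _ , refl , t , (refl ∷ u) with above-0-hits-1 p q t | above-0-starts-1 s r u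
...   | D′ , refl , v | I′ , refl = D′ , I′ , refl , v , refl , refl
contains-101 {D} {m} {I} p q r s e | x ∷ y ∷ v , _ , eq , t , u with ∷-injective eq
... | refl , eq′ with ∷-injectiveˡ eq′ | All-resp-⊆ t q
...   | refl | _ ∷ () ∷ _

Can-append< : ∀ {D m a} → Dec D → All (m <_) D → a < m → Can (D ++ m ∷ a ∷ [])
Can-append< {D} {m} {a} p q r = subst Can (++-assoc D (m ∷ []) (a ∷ []))
  (can (D ++ m ∷ []) a [] (AllPairs.++⁺ p ([] ∷ []) (All.map (_∷ []) q))
       (All.++⁺ (All.map (<-trans r) q) (r ∷ [])) [] [])

Can-append> : ∀ {D m I a} → Dec D → All (m <_) D → All (m <_) I → Inc I → m < a → All (_< a) I →
  Can ((D ++ m ∷ I) ++ a ∷ [])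
Can-append> {D} {m} {I} {a} p q r s t u = subst Can (sym (++-assoc D (m ∷ I) (a ∷ [])))
  (can D m (I ++ a ∷ []) p q (All.++⁺ r (t ∷ [])) (AllPairs.++⁺ s ([] ∷ []) (All.map (_∷ []) u)))

false≢true : ∀ {b} → b ≡ false → b ≢ true
false≢true refl ()

unimodal-blocked : ∀ {D m} I₁ {b I₂ a} → Dec D → All (m <_) D → All (m <_) (I₁ ++ b ∷ I₂) → a ≤ b →
  unimodal ((D ++ m ∷ I₁ ++ b ∷ I₂) ++ a ∷ []) ≡ false
unimodal-blocked {D} {m} I₁ {b} {I₂} {a} p q r a≤b with unimodal ((D ++ m ∷ I₁ ++ b ∷ I₂) ++ a ∷ []) in eq
... | false = refl
... | true = ⊥-elim (blocked I₁ r (trans (sym (trans (cong unimodal (++-assoc D (m ∷ I₁ ++ b ∷ I₂) (a ∷ [])))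
                 (unimodal-dec D p q))) eq))
  where
  not-inc : ∀ x I₁ → ¬ Inc (x ∷ (I₁ ++ b ∷ I₂) ++ a ∷ [])
  not-inc x I₁ i with AllPairs-++⁻ (x ∷ I₁) (subst (λ z → Inc (x ∷ z)) (++-assoc I₁ (b ∷ I₂) (a ∷ [])) i)
  ... | _ , (s ∷ _) , _ = <⇒≱ (All.head (All.++⁻ʳ I₂ s)) a≤b
  blocked : ∀ I₁ → All (m <_) (I₁ ++ b ∷ I₂) → unimodalFrom m ((I₁ ++ b ∷ I₂) ++ a ∷ []) ≢ true
  blocked []       (s ∷ _) e = not-inc m [] (incB-sound m _ (trans (sym (unimodalFrom-up {m} {b} {I₂ ++ a ∷ []} s)) e))
  blocked (y ∷ I₁) (s ∷ _) e = not-inc m (y ∷ I₁)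
    (incB-sound m _ (trans (sym (unimodalFrom-up {m} {y} {(I₁ ++ b ∷ I₂) ++ a ∷ []} s)) e))

kStep1-IBump : ∀ {a b I₁ I₂ c} → All (_< a) I₁ → IBump a b I₂ c → kStep1 a (I₁ ++ b ∷ I₂) ≡ (I₁ ++ a ∷ I₂ , c)
kStep1-IBump {I₁ = I₁} {I₂} p (below {a} {b} q) rewrite bumpInc-split {a} {b} I₁ {I₂} p (<⇒≤ q) | ≢⇒≡ᵇ (>⇒≢ q) = refl
kStep1-IBump {I₁ = I₁} p (equal {a} {I₃}) rewrite bumpInc-split {a} {a} I₁ {suc a ∷ I₃} p ≤-refl | ≡ᵇ-refl a = refl

kStep2-DBump : ∀ {c d D₁ D₂ a′ I} → All (c <_) D₁ → DBump c d D₂ a′ →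
  kStep2 (D₁ ++ d ∷ D₂) (I , c) ≡ ((D₁ ++ c ∷ D₂) ++ I , just a′)
kStep2-DBump {D₁ = D₁} p (below {c} {d} {D₂} q)
  rewrite bumpDec-split {c} {d} D₁ {D₂} p (<⇒≤ q) | ≢⇒≡ᵇ (<⇒≢ q) = refl
kStep2-DBump {D₁ = D₁} p (equal {c} {D₃} q)
  rewrite bumpDec-split {suc c} {suc c} D₁ {c ∷ D₃} p ≤-refl | ≡ᵇ-refl c = refl

kIns-append : ∀ {a R} → unimodal (R ++ a ∷ []) ≡ true → kIns a R ≡ (R ++ a ∷ [] , nothing)
kIns-append e rewrite e = refl

kIns-special : ∀ R → unimodal (R ++ 0 ∷ []) ≡ false → isSubseq (1 ∷ 0 ∷ 1 ∷ []) R ≡ true → kIns 0 R ≡ (R , just 0)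
kIns-special R e f rewrite e | f = refl

kIns-general : ∀ a R → unimodal (R ++ a ∷ []) ≡ false → (a ≡ᵇ 0) ∧ isSubseq (1 ∷ 0 ∷ 1 ∷ []) R ≡ false →
  kIns a R ≡ kStep2 (proj₁ (splitU R)) (kStep1 a (proj₂ (splitU R)))
kIns-general a R e f rewrite e | f = refl

Appends Bumps : ℕ → List ℕ → Set
Appends a R = Can (R ++ a ∷ []) × kIns a R ≡ (R ++ a ∷ [] , nothing)
Bumps a R = ∃[ R′ ] ∃[ a′ ] kIns a R ≡ (R′ , just a′) × Bump R a R′ a′

snoc-inj : ∀ D {m : ℕ} D₁ {x y} → D ++ m ∷ [] ≡ D₁ ++ x ∷ y ∷ [] → m ≡ y × D ≡ D₁ ++ x ∷ []
snoc-inj []          []            ()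
snoc-inj (x ∷ [])    []            refl = refl , refl
snoc-inj (x ∷ _ ∷ D) []            eq with ∷-injectiveʳ (∷-injectiveʳ eq)
snoc-inj (x ∷ _ ∷ [])    []        eq | ()
snoc-inj (x ∷ _ ∷ _ ∷ D) []        eq | ()
snoc-inj []          (z ∷ [])      ()
snoc-inj []          (z ∷ w ∷ D₁)  ()
snoc-inj (x ∷ D)     (z ∷ D₁)      eq with ∷-injective eq
... | refl , eq′ with snoc-inj D D₁ eq′
...   | refl , refl = refl , refl

all<0 : ∀ {xs} → All (_< 0) xs → xs ≡ []
all<0 []       = refl
all<0 (() ∷ _)

general-bump : ∀ {D m} I₁ {b} I₂ {a c} → Dec D → All (m <_) D → All (m <_) (I₁ ++ b ∷ I₂) → Inc (I₁ ++ b ∷ I₂) →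
  All (_< a) I₁ → IBump a b I₂ c → Red ((D ++ m ∷ I₁ ++ b ∷ I₂) ++ a ∷ []) →
  (a ≡ᵇ 0) ∧ isSubseq (1 ∷ 0 ∷ 1 ∷ []) (D ++ m ∷ I₁ ++ b ∷ I₂) ≡ false → Bumps a (D ++ m ∷ I₁ ++ b ∷ I₂)
general-bump {D} {m} I₁ {b} I₂ {a} {c} p q r s t ib red no101
  with split≤ c D {m} (≤-trans (<⇒≤ (All.head (All.++⁻ʳ I₁ r))) (IBump-b≤c ib))
... | D₁ , d , D₂ , E≡ , c<D₁ , d≤c = finish (m≤n⇒m<n∨m≡n d≤c)
  where
  R≡ : D ++ m ∷ I₁ ++ b ∷ I₂ ≡ (D₁ ++ d ∷ D₂) ++ I₁ ++ b ∷ I₂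
  R≡ = trans (sym (++-assoc D (m ∷ []) (I₁ ++ b ∷ I₂))) (cong (_++ I₁ ++ b ∷ I₂) E≡)
  decE : Dec (D₁ ++ d ∷ D₂)
  decE = subst Dec E≡ (AllPairs.++⁺ p ([] ∷ []) (All.map (_∷ []) q))
  computed : ∀ {a′} → DBump c d D₂ a′ →
    kIns a (D ++ m ∷ I₁ ++ b ∷ I₂) ≡ ((D₁ ++ c ∷ D₂) ++ I₁ ++ a ∷ I₂ , just a′)
  computed db = begin
    kIns a (D ++ m ∷ I₁ ++ b ∷ I₂)
      ≡⟨ kIns-general a (D ++ m ∷ I₁ ++ b ∷ I₂) (unimodal-blocked I₁ p q r (IBump-a≤b ib)) no101 ⟩
    kStep2 (proj₁ (splitU (D ++ m ∷ I₁ ++ b ∷ I₂))) (kStep1 a (proj₂ (splitU (D ++ m ∷ I₁ ++ b ∷ I₂))))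
      ≡⟨ cong (λ z → kStep2 (proj₁ z) (kStep1 a (proj₂ z))) (splitU-can D p q r) ⟩
    kStep2 (D ++ m ∷ []) (kStep1 a (I₁ ++ b ∷ I₂))
      ≡⟨ cong₂ kStep2 E≡ (kStep1-IBump {I₁ = I₁} t ib) ⟩
    kStep2 (D₁ ++ d ∷ D₂) (I₁ ++ a ∷ I₂ , c)
      ≡⟨ kStep2-DBump {D₁ = D₁} c<D₁ db ⟩
    _ ∎
    where open ≡-Reasoning
  bumped : ∀ {a′} → DBump c d D₂ a′ → Bumps a (D ++ m ∷ I₁ ++ b ∷ I₂)
  bumped {a′} db = _ , a′ , computed db ,
    subst (λ z → Bump z a _ a′) (sym R≡) (general D m D₁ D₂ I₁ I₂ E≡ decE r s t ib c<D₁ db)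
  ib-side : ∀ {I₂ c} → All (m <_) (I₁ ++ b ∷ I₂) → IBump a b I₂ c → 1 ≤ a ⊎ a < b
  ib-side _ (below u) = inj₂ u
  ib-side r equal     = inj₁ (≤-trans (s≤s z≤n) (All.head (All.++⁻ʳ I₁ r)))
  -- The intermediate word, in which only the increasing part has been bumped. If `d = c`, its
  -- reducedness forces c-1 to follow `d`.
  half : (D ++ m ∷ I₁ ++ b ∷ I₂) ++ a ∷ [] ∼ D₁ ++ d ∷ D₂ ++ c ∷ I₁ ++ a ∷ I₂
  half = tran (≡⇒∼ (trans (cong (_++ a ∷ []) R≡) (++-assoc (D₁ ++ d ∷ D₂) _ _)))
        (tran (∼-prefix (D₁ ++ d ∷ D₂) (IBump-∼ {I₁ = I₁} (ib-side r ib) s t ib))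
              (≡⇒∼ (++-assoc D₁ (d ∷ D₂) _)))
  -- For the value 0 the letter 1 would be sent into a decreasing part ending in 1 0. Then `a = 0`
  -- and `b = 1`, so the row contains 101, against `no101`.
  not-special : ∀ {D₃ c} → D ++ m ∷ [] ≡ D₁ ++ suc c ∷ c ∷ D₃ → Dec (D₁ ++ suc c ∷ c ∷ D₃) → All (suc c <_) D₁ →
    IBump a b I₂ (suc c) → 1 ≤ c
  not-special {c = suc c} _ _ _ _ = s≤s z≤n
  not-special {D₃} {zero} eE dE c<D₁ ib with AllPairs-++⁻ D₁ dE
  not-special {x ∷ D₃} {zero} eE dE c<D₁ ib | _ , (_ ∷ (() ∷ _) ∷ _) , _
  not-special {[]} {zero} eE dE c<D₁ equal | _ = ⊥-elim (n≮0 (All.head (All.++⁻ʳ I₁ r)))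
  not-special {[]} {zero} eE dE c<D₁ (below (s≤s z≤n)) | _ = ⊥-elim (false≢true no101
    (trans (cong (isSubseq (1 ∷ 0 ∷ 1 ∷ [])) R-101) (isSubseq-101 D₁ I₂ c<D₁)))
    where
    R-101 : D ++ m ∷ I₁ ++ 1 ∷ I₂ ≡ D₁ ++ 1 ∷ 0 ∷ 1 ∷ I₂
    R-101 with snoc-inj D D₁ eE
    ... | m≡0 , D≡ = trans (cong₂ (λ x y → x ++ m ∷ y ++ 1 ∷ I₂) D≡ (all<0 t))
                    (trans (cong (λ x → (D₁ ++ 1 ∷ []) ++ x ∷ 1 ∷ I₂) m≡0) (++-assoc D₁ (1 ∷ []) _))
  finish : d < c ⊎ d ≡ c → Bumps a (D ++ m ∷ I₁ ++ b ∷ I₂)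
  finish (inj₁ d<c) = bumped (below d<c)
  finish (inj₂ refl) with bump-Red-D D₁ {J = I₁ ++ a ∷ I₂} (proj₁ (proj₂ (AllPairs-++⁻ D₁ decE))) (Red-resp-∼ half red)
  ... | D₃ , c₀ , refl , refl = bumped (equal (not-special E≡ decE c<D₁ ib))

blocked-bumps : ∀ {D m} I₁ b I₂ a flag → Dec D → All (m <_) D → All (m <_) (I₁ ++ b ∷ I₂) → Inc (I₁ ++ b ∷ I₂) →
  All (_< a) I₁ → a ≤ b → Red ((D ++ m ∷ I₁ ++ b ∷ I₂) ++ a ∷ []) →
  (a ≡ᵇ 0) ∧ isSubseq (1 ∷ 0 ∷ 1 ∷ []) (D ++ m ∷ I₁ ++ b ∷ I₂) ≡ flag → Bumps a (D ++ m ∷ I₁ ++ b ∷ I₂)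
blocked-bumps {D} {m} I₁ b I₂ a false p q r s t a≤b red eq with m≤n⇒m<n∨m≡n a≤b
... | inj₁ a<b  = general-bump I₁ I₂ p q r s t (below a<b) red eq
... | inj₂ refl with bump-Red-I (D ++ m ∷ I₁) {I₂ = I₂} (proj₁ (proj₂ (AllPairs-++⁻ I₁ s)))
          (subst Red (trans (++-assoc D (m ∷ I₁ ++ a ∷ I₂) (a ∷ []))
                     (trans (cong (λ z → D ++ m ∷ z) (++-assoc I₁ (a ∷ I₂) (a ∷ []))) (sym (++-assoc D (m ∷ I₁) _)))) red)
...   | I₃ , refl = general-bump I₁ (suc a ∷ I₃) p q r s t equal red eq
blocked-bumps {D} {m} I₁ b I₂ zero true p q r s t a≤b red eq with contains-101 {D} p q r s eq
... | D′ , I′ , refl , D′>1 , refl , I≡ = subst (Bumps 0) (sym R≡) (D′ ++ 1 ∷ 0 ∷ 1 ∷ I′ , 0 ,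
        kIns-special (D′ ++ 1 ∷ 0 ∷ 1 ∷ I′) (trans (cong (λ z → unimodal (z ++ 0 ∷ [])) (sym R≡)) (unimodal-blocked I₁ p q r a≤b))
                     (trans (cong (isSubseq (1 ∷ 0 ∷ 1 ∷ [])) (sym R≡)) eq) ,
        special D′ I′ (proj₁ (AllPairs-++⁻ D′ p)) D′>1 (proj₂ inc′) (proj₁ inc′))
  where
  R≡ : (D′ ++ 1 ∷ []) ++ 0 ∷ I₁ ++ b ∷ I₂ ≡ D′ ++ 1 ∷ 0 ∷ 1 ∷ I′
  R≡ = trans (++-assoc D′ (1 ∷ []) _) (cong (λ z → D′ ++ 1 ∷ 0 ∷ z) I≡)
  inc′ : All (1 <_) I′ × Inc I′
  inc′ with subst Inc I≡ s
  ... | u ∷ v = u , v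

kIns-view : ∀ {a R} → Can R → Red (R ++ a ∷ []) → Appends a R ⊎ Bumps a R
kIns-view {a} (can D m I p q r s) red = go I r s red (split≥ a I)
  where
  appends : ∀ {R} → Can (R ++ a ∷ []) → Appends a R ⊎ Bumps a R
  appends {R} c = inj₁ (c , kIns-append {a} {R} (unimodal-complete c))
  go : ∀ I → All (m <_) I → Inc I → Red ((D ++ m ∷ I) ++ a ∷ []) → Split≥ a I → Appends a (D ++ m ∷ I) ⊎ Bumps a (D ++ m ∷ I)
  go _ r s red (split I₁ b I₂ t a≤b) = inj₂ (blocked-bumps {D} I₁ b I₂ a _ p q r s t a≤b red refl)
  go [] r s red (all< _) with <-cmp a m
  ... | tri< a<m _ _ = appends (subst Can (sym (++-assoc D (m ∷ []) (a ∷ []))) (Can-append< p q a<m))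
  ... | tri> _ _ m<a = appends (Can-append> p q [] [] m<a [])
  ... | tri≈ _ refl _ = ⊥-elim (red D m [] (≡⇒∼ (++-assoc D (m ∷ []) (m ∷ []))))
  go (y ∷ I) (r ∷ rs) s red (all< (y<a ∷ t)) = appends (Can-append> p q (r ∷ rs) s (<-trans r y<a) (y<a ∷ t))

Bump-∼ : ∀ {R a R′ a′} → Bump R a R′ a′ → R ++ a ∷ [] ∼ a′ ∷ R′
Bump-∼ (special D I p q r s) =
  tran (≡⇒∼ (++-assoc D (1 ∷ 0 ∷ 1 ∷ I) (0 ∷ [])))
  (tran (∼-prefix D (tran (prep 1 (prep 0 (prep 1 (tran (commutes-past I (All.map inj₁ s))
                      (≡⇒∼ (cong (0 ∷_) (++-identityʳ I)))))))
                    (symm braid₀)))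
        (commutes-past D (All.map inj₁ q)))
Bump-∼ (general {a} D₀ m D₁ {d} D₂ I₁ {b} I₂ {c} {a′} E≡ dE r s t ib u db) =
  tran (≡⇒∼ (++-assoc (D₁ ++ d ∷ D₂) _ _))
  (tran (∼-prefix (D₁ ++ d ∷ D₂) (IBump-∼ {I₁ = I₁} (side r ib) s t ib))
        (DBump-∼ dE u db (I₁ ++ a ∷ I₂)))
  where
  side : ∀ {b I₂ c} → All (m <_) (I₁ ++ b ∷ I₂) → IBump a b I₂ c → 1 ≤ a ⊎ a < b
  side _ (below u) = inj₂ u
  side r equal     = inj₁ (≤-trans (s≤s z≤n) (All.head (All.++⁻ʳ I₁ r)))

-- Ascents and descents through one row

Down Up : List ℕ → List ℕ
Down R = proj₁ (splitU R)
Up R = proj₂ (splitU R)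

-- The shapes a row R can have after a has been inserted into it with output a′.  Inserting e > a
-- outputs e′ > a′ (Rises), and inserting e < a outputs e′ < a′ (Normal) or e′ > a′ (Switched);
-- once Switched, a row stays so under insertion of decreasing letters.

Rises Normal Switched : List ℕ → List ℕ → ℕ → ℕ → Set
Rises E I a a′ = ∃[ c ] c ∈ E × a′ < c × All (λ x → a < x → c < x ⊎ (x ≡ c × c ≡ suc a)) I
Normal E I a a′ = a ∈ I × (a ≤ a′ ⊎ All (λ d → a < d ⊎ d < a′) E)
Switched E I a a′ =
  (a ∈ I × (∃[ D ] ∃[ m ] E ≡ D ++ m ∷ [] × a′ < m × All (a <_) D)) ⊎
  (∃[ D ] E ≡ D ++ a ∷ [] × (∃[ c ] c ∈ D × a′ < c × All (λ x → c < x ⊎ (x ≡ c × a′ < a)) I))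

Phase : List ℕ → ℕ → ℕ → Set
Phase R a a′ = Normal (Down R) (Up R) a a′ ⊎ Switched (Down R) (Up R) a a′ ⊎ a ≡ 0

splitU-last : ∀ D m {E I} → D ++ m ∷ [] ≡ E → Dec E → All (m <_) I → splitU (E ++ I) ≡ (E , I)
splitU-last D m {I = I} refl p q with AllPairs-++⁻ D p
... | r , _ , s = trans (cong splitU (++-assoc D (m ∷ []) I)) (splitU-can D r (All.map All.head s) q)

Can-last : ∀ D m {E I} → D ++ m ∷ [] ≡ E → Dec E → All (m <_) I → Inc I → Can (E ++ I)
Can-last D m {I = I} refl p q r with AllPairs-++⁻ D p
... | s , _ , t = subst Can (sym (++-assoc D (m ∷ []) I)) (can D m I s (All.map All.head t) q r)

Dec-replace : ∀ {c d} D₁ {D₂} → Dec (D₁ ++ d ∷ D₂) → All (c <_) D₁ → d ≤ c → Dec (D₁ ++ c ∷ D₂)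
Dec-replace D₁ p q r with AllPairs-++⁻ D₁ p
... | s , (t ∷ u) , v = AllPairs.++⁺ s (All.map (λ x → <-≤-trans x r) t ∷ u)
        (All.zipWith (λ (x , y) → x ∷ All.tail y) (q , v))

Inc-replace : ∀ {a b c} I₁ {I₂} → Inc (I₁ ++ b ∷ I₂) → All (_< a) I₁ → IBump a b I₂ c → Inc (I₁ ++ a ∷ I₂)
Inc-replace I₁ p q ib with AllPairs-++⁻ I₁ p
... | s , (t ∷ u) , v = AllPairs.++⁺ s (All.map (≤-<-trans (IBump-a≤b ib)) t ∷ u)
        (All.zipWith (λ (x , y) → x ∷ All.tail y) (q , v))

-- The first letter of the increasing part changes sides when it falls below the last letter of the
-- decreasing part: it is then the new minimum.
Can-switch : ∀ E f {I e} D → E ≡ D ++ e ∷ [] → Dec E → f < e → Inc (f ∷ I) →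
  Can (E ++ f ∷ I) × splitU (E ++ f ∷ I) ≡ (E ++ f ∷ [] , I)
Can-switch _ f {I} {e} D refl p q (r ∷ s) = can _ f I p below-E r s , splitU-can _ p below-E r
  where
  below-E : All (f <_) (D ++ e ∷ [])
  below-E with AllPairs-++⁻ D p
  ... | _ , _ , t = All.++⁺ (All.map (λ u → <-trans q (All.head u)) t) (q ∷ [])

DBump-a′<c : ∀ {c d D₂ a′} → DBump c d D₂ a′ → a′ < c
DBump-a′<c (below p) = p
DBump-a′<c (equal _) = ≤-refl

RiseCond : ℕ → ℕ → ℕ → Set
RiseCond a c x = a < x → c < x ⊎ (x ≡ c × c ≡ suc a)

rises-after : ∀ {a b I₂ c} → IBump a b I₂ c → Inc (b ∷ I₂) → All (RiseCond a c) I₂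
rises-after (below _) (p ∷ _)     = All.map (λ q _ → inj₁ q) p
rises-after equal     (_ ∷ q ∷ _) = (λ _ → inj₂ (refl , refl)) ∷ All.map (λ p _ → inj₁ p) q

rises-all : ∀ {a b I₂ c} I₁ → IBump a b I₂ c → Inc (I₁ ++ b ∷ I₂) → All (_< a) I₁ → All (RiseCond a c) (I₁ ++ a ∷ I₂)
rises-all I₁ ib s t = All.++⁺ (All.map (λ p q → ⊥-elim (<-asym p q)) t)
  ((λ p → ⊥-elim (<-irrefl refl p)) ∷ rises-after ib (proj₁ (proj₂ (AllPairs-++⁻ I₁ s))))

switched-after : ∀ {a b I₂ c a′} → IBump a b I₂ c → Inc (b ∷ I₂) → (a ≡ b → a′ < a) →
  All (λ x → c < x ⊎ (x ≡ c × a′ < a)) I₂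
switched-after (below _) (p ∷ _)     h = All.map inj₁ p
switched-after equal     (_ ∷ p ∷ _) h = inj₂ (refl , h refl) ∷ All.map inj₁ p

normal-down : ∀ {a c d D₁ D₂ a′} → a < c → Dec (D₁ ++ d ∷ D₂) → All (c <_) D₁ → DBump c d D₂ a′ →
  a ≤ a′ ⊎ All (λ x → a < x ⊎ x < a′) (D₁ ++ c ∷ D₂)
normal-down a<c dE u (equal p) = inj₁ (≤-pred a<c)
normal-down {D₁ = D₁} a<c dE u (below p) with AllPairs-++⁻ D₁ dE
... | _ , (v ∷ _) , _ = inj₂ (All.++⁺ (All.map (λ x → inj₁ (<-trans a<c x)) u) (inj₁ a<c ∷ All.map inj₂ v))

-- `D₂` and `m` of the bump are recorded so that a Normal result can be excluded whenever the
-- minimum was bumped or `a` is not above it.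
Classified : List ℕ → List ℕ → ℕ → ℕ → ℕ → Set
Classified R′ D₂ m a a′ = Can R′ × Rises (Down R′) (Up R′) a a′ ×
  ((Normal (Down R′) (Up R′) a a′ × D₂ ≢ [] × m < a) ⊎ Switched (Down R′) (Up R′) a a′)

classified-normal : ∀ {E I D₂ m a a′} D → D ++ m ∷ [] ≡ E → Dec E → All (m <_) I → Inc I → Rises E I a a′ →
  Normal E I a a′ → D₂ ≢ [] → m < a → Classified (E ++ I) D₂ m a a′
classified-normal {E} {I} {m = m} {a} {a′} D e dE r inc ri nm ne m<a =
  let sp = splitU-last D m e dE r
  in Can-last D m e dE r inc ,
     subst (λ z → Rises (proj₁ z) (proj₂ z) a a′) (sym sp) ri ,
     inj₁ (subst (λ z → Normal (proj₁ z) (proj₂ z) a a′) (sym sp) nm , ne , m<a)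

classified-switched : ∀ {E f I e D₂ m a a′} D → E ≡ D ++ e ∷ [] → Dec E → f < e → Inc (f ∷ I) → Rises E I a a′ →
  Switched (E ++ f ∷ []) I a a′ → Classified (E ++ f ∷ I) D₂ m a a′
classified-switched {E} {f} {I} {a = a} {a′} D e dE f<e inc (c , c∈E , p , ri) sw =
  let cn , sp = Can-switch E f D e dE f<e inc
  in cn ,
     subst (λ z → Rises (proj₁ z) (proj₂ z) a a′) (sym sp) (c , ∈-++⁺ˡ c∈E , p , ri) ,
     inj₂ (subst (λ z → Switched (proj₁ z) (proj₂ z) a a′) (sym sp) sw)

-- The minimum `m` itself is pushed out by a larger `c`, so the first letter of the increasing part
-- becomes the minimum and moves to the decreasing part. The two forms of `Switched` arise according
-- to whether that letter is `a`.
classify-last : ∀ {a} D₁ {m} I₁ {b} I₂ {c a′} → Dec (D₁ ++ m ∷ []) → All (m <_) (I₁ ++ b ∷ I₂) → Inc (I₁ ++ b ∷ I₂) →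
  All (_< a) I₁ → IBump a b I₂ c → All (c <_) D₁ → DBump c m [] a′ →
  Classified ((D₁ ++ c ∷ []) ++ I₁ ++ a ∷ I₂) [] m a a′
classify-last {a} D₁ {m} [] {b} I₂ {c} dE r s t ib u (below m<c) =
  classified-switched D₁ refl dE′ (IBump-a<c ib) (Inc-replace [] s t ib)
    (c , c∈E′ , m<c , rises-after ib s)
    (inj₂ (D₁ ++ c ∷ [] , refl , c , c∈E′ , m<c , switched-after ib s λ { refl → All.head r }))
  where
  dE′ = Dec-replace D₁ dE u (<⇒≤ m<c)
  c∈E′ = ∈-++⁺ʳ D₁ (here refl)
classify-last {a} D₁ {m} (f ∷ I₁) {b} I₂ {c} dE (m<f ∷ r) s (f<a ∷ t) ib u (below m<c) =
  classified-switched D₁ refl dE′ (<-trans f<a a<c) (Inc-replace (f ∷ I₁) s (f<a ∷ t) ib)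
    (c , ∈-++⁺ʳ D₁ (here refl) , m<c , All.tail (rises-all (f ∷ I₁) ib s (f<a ∷ t)))
    (inj₁ (∈-++⁺ʳ I₁ (here refl) , D₁ ++ c ∷ [] , f , refl , m<f , All.++⁺ (All.map (<-trans a<c) u) (a<c ∷ [])))
  where
  a<c = IBump-a<c ib
  dE′ = Dec-replace D₁ dE u (<⇒≤ m<c)

snoc≢[] : ∀ {xs : List ℕ} {x} → xs ++ x ∷ [] ≢ []
snoc≢[] {[]}    ()
snoc≢[] {_ ∷ _} ()

-- Here `m` stays in the row, and it remains the minimum unless `a < m`; then `I₁` is empty and `a`
-- itself joins the decreasing part. Reducedness excludes `a = m`, which would put two equal letters
-- side by side.
classify-inner : ∀ {a} D₁ {d} D₂ {m} I₁ {b} I₂ {c a′} → Dec (D₁ ++ d ∷ D₂ ++ m ∷ []) →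
  All (m <_) (I₁ ++ b ∷ I₂) → Inc (I₁ ++ b ∷ I₂) →
  All (_< a) I₁ → IBump a b I₂ c → All (c <_) D₁ → DBump c d (D₂ ++ m ∷ []) a′ →
  Red ((D₁ ++ c ∷ D₂ ++ m ∷ []) ++ I₁ ++ a ∷ I₂) →
  Classified ((D₁ ++ c ∷ D₂ ++ m ∷ []) ++ I₁ ++ a ∷ I₂) (D₂ ++ m ∷ []) m a a′
classify-inner {a} D₁ D₂ {m} I₁ {b} I₂ {c} {a′} dE r s t ib u db red = go I₁ refl
  where
  E′ = D₁ ++ c ∷ D₂ ++ m ∷ []
  e : (D₁ ++ c ∷ D₂) ++ m ∷ [] ≡ E′
  e = ++-assoc D₁ (c ∷ D₂) (m ∷ [])
  dE′ : Dec E′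
  dE′ = Dec-replace D₁ dE u (DBump-d≤c db)
  c∈E′ : c ∈ E′
  c∈E′ = ∈-++⁺ʳ D₁ (here refl)
  normal : m < a → Classified (E′ ++ I₁ ++ a ∷ I₂) (D₂ ++ m ∷ []) m a a′
  normal m<a = classified-normal (D₁ ++ c ∷ D₂) e dE′ (All.++⁺ (All.++⁻ˡ I₁ r) (m<a ∷ All.tail (All.++⁻ʳ I₁ r)))
    (Inc-replace I₁ s t ib) (c , c∈E′ , DBump-a′<c db , rises-all I₁ ib s t)
    (∈-++⁺ʳ I₁ (here refl) , normal-down (IBump-a<c ib) dE u db) snoc≢[] m<a
  go : ∀ I → I ≡ I₁ → Classified (E′ ++ I₁ ++ a ∷ I₂) (D₂ ++ m ∷ []) m a a′
  go (f ∷ I) refl = normal (<-trans (All.head r) (All.head t))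
  go [] refl with <-cmp m a
  ... | tri< m<a _ _  = normal m<a
  ... | tri≈ _ refl _ = ⊥-elim (red (D₁ ++ c ∷ D₂) m I₂ (≡⇒∼ (trans (cong (_++ m ∷ I₂) (sym e)) (++-assoc (D₁ ++ c ∷ D₂) (m ∷ []) _))))
  ... | tri> _ _ a<m  = classified-switched (D₁ ++ c ∷ D₂) (sym e) dE′ a<m (Inc-replace [] s t ib)
    (c , c∈E′ , DBump-a′<c db , rises-after ib s)
    (inj₂ (E′ , refl , c , c∈E′ , DBump-a′<c db , switched-after ib s λ { refl → ⊥-elim (<-asym a<m (All.head r)) }))

classify : ∀ {a} D₀ m D₁ {d} D₂ I₁ {b} I₂ {c a′} → D₀ ++ m ∷ [] ≡ D₁ ++ d ∷ D₂ →
  Dec (D₁ ++ d ∷ D₂) → All (m <_) (I₁ ++ b ∷ I₂) → Inc (I₁ ++ b ∷ I₂) →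
  All (_< a) I₁ → IBump a b I₂ c → All (c <_) D₁ → DBump c d D₂ a′ →
  Red ((D₁ ++ c ∷ D₂) ++ I₁ ++ a ∷ I₂) → Classified ((D₁ ++ c ∷ D₂) ++ I₁ ++ a ∷ I₂) D₂ m a a′
classify D₀ m D₁ {d} D₂ I₁ I₂ E≡ dE r s t ib u db red with initLast D₂
... | [] with ∷ʳ-injective D₀ D₁ E≡
...   | refl , refl = classify-last D₁ I₁ I₂ dE r s t ib u db
classify D₀ m D₁ {d} _ I₁ I₂ E≡ dE r s t ib u db red | D₂ ∷ʳ′ m₁
  with ∷ʳ-injective D₀ (D₁ ++ d ∷ D₂) (trans E≡ (sym (++-assoc D₁ (d ∷ D₂) (m₁ ∷ []))))
... | refl , refl = classify-inner D₁ D₂ I₁ I₂ dE r s t ib u db red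

special-split : ∀ D {I} → Dec D → All (1 <_) D → Inc I → All (1 <_) I →
  Can (D ++ 1 ∷ 0 ∷ 1 ∷ I) × splitU (D ++ 1 ∷ 0 ∷ 1 ∷ I) ≡ (D ++ 1 ∷ 0 ∷ [] , 1 ∷ I)
special-split D {I} p q r s =
  subst (λ z → Can z × splitU z ≡ (E , 1 ∷ I)) (++-assoc D (1 ∷ 0 ∷ []) (1 ∷ I))
    (Can-last (D ++ 1 ∷ []) 0 e dE 0<I (s ∷ r) , splitU-last (D ++ 1 ∷ []) 0 e dE 0<I)
  where
  E = D ++ 1 ∷ 0 ∷ []
  e : (D ++ 1 ∷ []) ++ 0 ∷ [] ≡ E
  e = ++-assoc D (1 ∷ []) (0 ∷ [])
  dE : Dec E
  dE = AllPairs.++⁺ p ((s≤s z≤n ∷ []) ∷ [] ∷ []) (All.map (λ x → x ∷ <-trans (s≤s z≤n) x ∷ []) q)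
  0<I : All (0 <_) (1 ∷ I)
  0<I = s≤s z≤n ∷ All.map (<-trans (s≤s z≤n)) s

Bump-classify : ∀ {R a R′ a′} → Bump R a R′ a′ → Red (a′ ∷ R′) → Can R′ × Rises (Down R′) (Up R′) a a′ × Phase R′ a a′
Bump-classify (special D I p q r s) red with special-split D p q r s
... | cn , sp = cn ,
  subst (λ z → Rises (proj₁ z) (proj₂ z) 0 0) (sym sp)
    (1 , ∈-++⁺ʳ D (here refl) , s≤s z≤n , (λ _ → inj₂ (refl , refl)) ∷ All.map (λ x _ → inj₁ x) s) ,
  inj₂ (inj₂ refl)
Bump-classify (general D₀ m D₁ D₂ I₁ I₂ E≡ dE r s t ib u db) red
  with classify D₀ m D₁ D₂ I₁ I₂ E≡ dE r s t ib u db (Red-suffix (_ ∷ []) _ red)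
... | cn , ri , inj₁ (nm , _) = cn , ri , inj₁ nm
... | cn , ri , inj₂ sw       = cn , ri , inj₂ (inj₁ sw)

∈-tail-≥ : ∀ {x c d} D₁ D₂ → Dec (D₁ ++ d ∷ D₂) → All (c <_) D₁ → x ∈ D₁ ++ d ∷ D₂ → x ≤ c → x ≤ d
∈-tail-≥ D₁ D₂ dE u x∈ x≤c with ∈-++⁻ D₁ x∈
... | inj₁ q         = ⊥-elim (<⇒≱ (All.lookup u q) x≤c)
... | inj₂ (here refl) = ≤-refl
... | inj₂ (there q) with AllPairs-++⁻ D₁ dE
...   | _ , (v ∷ _) , _ = <⇒≤ (All.lookup v q)

DBump-≥ : ∀ {x c d D₂ a′} → x < c → x ≤ d → DBump c d D₂ a′ → x ≤ a′
DBump-≥ p q (below _) = q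
DBump-≥ p q (equal _) = ≤-pred p

DBump-a′≤d : ∀ {c d D₂ a′} → DBump c d D₂ a′ → a′ ≤ d
DBump-a′≤d (below _) = ≤-refl
DBump-a′≤d (equal _) = n≤1+n _

-- `a` left a letter `c` in the decreasing part. A letter above `a` in the increasing part exceeds
-- `c`, or equals `c = a + 1`, in which case only `e = c` can bump it. Either way `e` sends a letter
-- larger than `c` on, which meets a letter at or above `c`; hence `e′ ≥ c > a′`.
ascent-preserved : ∀ {R a a′ e R″ e′} → Rises (Down R) (Up R) a a′ → Bump R e R″ e′ → a < e → a′ < e′
ascent-preserved {a = a} {a′} {e} {e′ = e′} rises
  (general D₀ m D₁ {d} D₂ I₁ {b} I₂ {c₂} E≡ dE r s t ib u db) a<e
  with subst (λ z → Rises (proj₁ z) (proj₂ z) a a′) (splitU-last D₀ m E≡ dE r) rises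
... | c , c∈ , a′<c , ri = <-≤-trans a′<c (DBump-≥ c<c₂ (∈-tail-≥ D₁ D₂ dE u c∈ (<⇒≤ c<c₂)) db)
  where
  above : ∀ {b I₂ c₂} → IBump e b I₂ c₂ → c < b ⊎ (b ≡ c × c ≡ suc a) → c < c₂
  above ib (inj₁ p)              = <-≤-trans p (IBump-b≤c ib)
  above (below q) (inj₂ (refl , refl)) = ⊥-elim (<⇒≱ q a<e)
  above equal     (inj₂ (refl , _))    = ≤-refl
  c<c₂ : c < c₂
  c<c₂ = above ib (All.head (All.++⁻ʳ I₁ ri) (<-≤-trans a<e (IBump-a≤b ib)))

∈-upper-≥ : ∀ {a e b} I₁ I₂ → All (_< e) I₁ → Inc (I₁ ++ b ∷ I₂) → a ∈ I₁ ++ b ∷ I₂ → e < a → b ≤ a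
∈-upper-≥ I₁ I₂ t s a∈ e<a with ∈-++⁻ I₁ a∈
... | inj₁ q           = ⊥-elim (<-asym e<a (All.lookup t q))
... | inj₂ (here refl) = ≤-refl
... | inj₂ (there q) with AllPairs-++⁻ I₁ s
...   | _ , (v ∷ _) , _ = <⇒≤ (All.lookup v q)

IBump-c≤ : ∀ {e b I₂ c a} → IBump e b I₂ c → e < a → b ≤ a → c ≤ a
IBump-c≤ (below _) p q = q
IBump-c≤ equal     p q = p

-- As `a` stands in the increasing part, `e` sends on a letter not exceeding `a`. Either `a ≤ a′`,
-- and the output is smaller than the letter sent on; or the letter met in the decreasing part does
-- not exceed `a` and so lies below `a′`.
descent-preserved : ∀ {R a a′ e R″ e′} → Normal (Down R) (Up R) a a′ → Bump R e R″ e′ → e < a → e′ < a′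
descent-preserved {a = a} {a′} nm (special D I p q r s) e<a
  with subst (λ z → Normal (proj₁ z) (proj₂ z) a a′) (proj₂ (special-split D p q r s)) nm
... | _ , inj₁ a≤a′ = <-≤-trans e<a a≤a′
... | _ , inj₂ ds with All.++⁻ʳ D ds
...   | _ ∷ inj₂ x ∷ [] = x
descent-preserved {a = a} {a′} {e} nm (general D₀ m D₁ {d} D₂ I₁ {b} I₂ {c₂} E≡ dE r s t ib u db) e<a
  with subst (λ z → Normal (proj₁ z) (proj₂ z) a a′) (splitU-last D₀ m E≡ dE r) nm
... | a∈ , h = go h
  where
  c₂≤a : c₂ ≤ a
  c₂≤a = IBump-c≤ ib e<a (∈-upper-≥ I₁ I₂ t s a∈ e<a)
  go : a ≤ a′ ⊎ All (λ x → a < x ⊎ x < a′) (D₁ ++ d ∷ D₂) → _ < a′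
  go (inj₁ a≤a′) = <-≤-trans (DBump-a′<c db) (≤-trans c₂≤a a≤a′)
  go (inj₂ ds) with All.head (All.++⁻ʳ D₁ ds)
  ... | inj₁ a<d  = ⊥-elim (<⇒≱ a<d (≤-trans (DBump-d≤c db) c₂≤a))
  ... | inj₂ d<a′ = ≤-<-trans (DBump-a′≤d db) d<a′
last-≤ : ∀ D {a x} → Dec (D ++ a ∷ []) → x ∈ D ++ a ∷ [] → a ≤ x
last-≤ D dE x∈ with ∈-++⁻ D x∈ | AllPairs-++⁻ D dE
... | inj₁ p           | _ , _ , q = <⇒≤ (All.head (All.lookup q p))
... | inj₂ (here refl) | _         = ≤-refl

Classified-switched : ∀ {R′ D₂ m a a′} → Classified R′ D₂ m a a′ → D₂ ≡ [] ⊎ a ≤ m → Switched (Down R′) (Up R′) a a′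
Classified-switched (_ , _ , inj₂ sw)              _          = sw
Classified-switched (_ , _ , inj₁ (_ , ne , _))    (inj₁ eq)  = ⊥-elim (ne eq)
Classified-switched (_ , _ , inj₁ (_ , _ , m<a))   (inj₂ a≤m) = ⊥-elim (<⇒≱ m<a a≤m)

-- In the first form of `Switched` the letter sent on is at most `a`, passes over everything above
-- `a` and pushes out the minimum; in the second, `e` is smaller than the minimum `a` of the row.
-- Either situation excludes a Normal result by `Classified-switched`.
switched-persists : ∀ {R a a′ e R″ e′} → Switched (Down R) (Up R) a a′ → Bump R e R″ e′ → Red (e′ ∷ R″) → e < a →
  a′ < e′ × Switched (Down R″) (Up R″) e e′
switched-persists {a = a} {a′} sw (special D I p q r s) red e<a
  with subst (λ z → Switched (proj₁ z) (proj₂ z) a a′) (proj₂ (special-split D p q r s)) sw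
... | inj₁ (_ , D′ , m , e , a′<m , _)
  with refl ← proj₂ (∷ʳ-injective D′ (D ++ 1 ∷ []) (trans (sym e) (sym (++-assoc D (1 ∷ []) (0 ∷ []))))) = ⊥-elim (n≮0 a′<m)
... | inj₂ (D′ , e , _)
  with refl ← proj₂ (∷ʳ-injective D′ (D ++ 1 ∷ []) (trans (sym e) (sym (++-assoc D (1 ∷ []) (0 ∷ []))))) = ⊥-elim (n≮0 e<a)
switched-persists {a = a} {a′} {e} {e′ = e′} sw (general D₀ m D₁ {d} D₂ I₁ {b} I₂ {c₂} E≡ dE r s t ib u db) red e<a
  with subst (λ z → Switched (proj₁ z) (proj₂ z) a a′) (splitU-last D₀ m E≡ dE r) sw
     | classify D₀ m D₁ D₂ I₁ I₂ E≡ dE r s t ib u db (Red-suffix (_ ∷ []) _ red)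
... | inj₁ (a∈ , D , m′ , e₁ , a′<m′ , a<D) | cl = go D₂ (initLast D₂) e₁ db cl
  where
  d≤a : d ≤ a
  d≤a = ≤-trans (DBump-d≤c db) (IBump-c≤ ib e<a (∈-upper-≥ I₁ I₂ t s a∈ e<a))
  go : ∀ {R″} D₂ (_ : Data.List.InitLast D₂) → D₁ ++ d ∷ D₂ ≡ D ++ m′ ∷ [] → DBump c₂ d D₂ e′ → Classified R″ D₂ m e e′ →
       a′ < e′ × Switched (Down R″) (Up R″) e e′
  go _ []         eq db cl with ∷ʳ-injective D₁ D eq
  ... | refl , refl with below _ ← db = a′<m′ , Classified-switched cl (inj₁ refl)
  go _ (D₂ ∷ʳ′ x) eq db cl with ∷ʳ-injective (D₁ ++ d ∷ D₂) D (trans (++-assoc D₁ (d ∷ D₂) (x ∷ [])) eq)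
  ... | refl , refl = ⊥-elim (<⇒≱ (All.head (All.++⁻ʳ D₁ a<D)) d≤a)
... | inj₂ (D , e₁ , c , c∈ , a′<c , cI) | cl with ∷ʳ-injective D₀ D (trans E≡ e₁)
...   | refl , refl = go ib db (All.head (All.++⁻ʳ I₁ cI)) , Classified-switched cl (inj₂ (<⇒≤ e<a))
  where
  c∈E : c ∈ D₁ ++ d ∷ D₂
  c∈E = subst (c ∈_) (sym e₁) (∈-++⁺ˡ c∈)
  a≤ : ∀ {x} → x ∈ D₁ ++ d ∷ D₂ → a ≤ x
  a≤ x∈ = last-≤ D (subst Dec e₁ dE) (subst (_ ∈_) e₁ x∈)
  go : IBump e b I₂ c₂ → DBump c₂ d D₂ e′ → c < b ⊎ (b ≡ c × a′ < a) → a′ < e′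
  go equal _ _ = ⊥-elim (<-asym e<a (All.head (All.++⁻ʳ I₁ r)))
  go (below _) (below p) (inj₁ c<b)           = <-≤-trans a′<c (∈-tail-≥ D₁ D₂ dE u c∈E (<⇒≤ c<b))
  go (below _) (below p) (inj₂ (refl , a′<a)) = <-≤-trans a′<c (∈-tail-≥ D₁ D₂ dE u c∈E ≤-refl)
  go (below _) (equal p) (inj₁ c<b)           = <-≤-trans a′<c (≤-pred c<b)
  go (below _) (equal p) (inj₂ (refl , a′<a)) = <-≤-trans a′<a (a≤ (∈-++⁺ʳ D₁ (there (here refl))))

-- Exchange of unimodal subwords

-- Unimodality as acceptance by an automaton, so that subwords can be exchanged inside a context.

data Ctx : Set where
  st    : Ctx
  dn up : ℕ → Ctx

data _-[_]→_ : Ctx → ℕ → Ctx → Set where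
  start : ∀ {y} → st -[ y ]→ dn y
  down  : ∀ {x y} → y < x → dn x -[ y ]→ dn y
  turn  : ∀ {x y} → x < y → dn x -[ y ]→ up y
  rise  : ∀ {x y} → x < y → up x -[ y ]→ up y

data Run : Ctx → List ℕ → Ctx → Set where
  []  : ∀ {c} → Run c [] c
  _∷_ : ∀ {c y c′ u c″} → c -[ y ]→ c′ → Run c′ u c″ → Run c (y ∷ u) c″

Acc : Ctx → List ℕ → Set
Acc c u = ∃[ e ] Run c u e

infixr 5 _∷ᵃ_

_∷ᵃ_ : ∀ {c y c′ u} → c -[ y ]→ c′ → Acc c′ u → Acc c (y ∷ u)
t ∷ᵃ (e , r) = e , t ∷ r

Run-++⁻ : ∀ u {v c} → Acc c (u ++ v) → ∃[ g ] Run c u g × Acc g v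
Run-++⁻ []      r             = _ , [] , r
Run-++⁻ (x ∷ u) (e , t ∷ r) with Run-++⁻ u (e , r)
... | g , r₁ , r₂ = g , t ∷ r₁ , r₂

Run-++⁺ : ∀ {u v c g} → Run c u g → Acc g v → Acc c (u ++ v)
Run-++⁺ []      r = r
Run-++⁺ (t ∷ q) r = t ∷ᵃ Run-++⁺ q r

Acc-mono : ∀ {x y} u → y ≤ x → Acc (up x) u → Acc (up y) u
Acc-mono []      p _                  = _ , []
Acc-mono (z ∷ u) p (e , rise q ∷ r) = e , rise (≤-<-trans p q) ∷ r

Acc-up : ∀ {x} u → Acc (up x) u → All (x <_) u
Acc-up []      _                  = []
Acc-up (z ∷ u) (e , rise q ∷ r) = q ∷ All.map (<-trans q) (Acc-up u (e , r))

Inc-Acc : ∀ {x} u → Inc (x ∷ u) → Acc (up x) u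
Inc-Acc []      _               = _ , []
Inc-Acc (y ∷ u) ((p ∷ _) ∷ q) = rise p ∷ᵃ Inc-Acc u q

Dec-Run : ∀ D {m x} → Dec (D ++ m ∷ []) → All (_< x) (D ++ m ∷ []) → Run (dn x) (D ++ m ∷ []) (dn m)
Dec-Run []      _       (p ∷ _) = down p ∷ []
Dec-Run (y ∷ D) (q ∷ r) (p ∷ _) = down p ∷ Dec-Run D r q

Acc-dn : ∀ {m} I → All (m <_) I → Inc I → Acc (dn m) I
Acc-dn []      _       _ = _ , []
Acc-dn (y ∷ I) (p ∷ _) q = turn p ∷ᵃ Inc-Acc I q

Can⇒Acc : ∀ {R} → Can R → Acc st R
Can⇒Acc (can [] m I p q r s)      = start ∷ᵃ Acc-dn I r s
Can⇒Acc (can (x ∷ D) m I (p ∷ p′) (q ∷ q′) r s) =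
  subst (Acc st) (cong (x ∷_) (++-assoc D (m ∷ []) I))
    (start ∷ᵃ Run-++⁺ (Dec-Run D (AllPairs.++⁺ p′ ([] ∷ []) (All.map (_∷ []) q′)) (All.++⁺ p (q ∷ []))) (Acc-dn I r s))

-- Junk value 0 in the initial state.
letter : Ctx → ℕ
letter st     = 0
letter (dn x) = x
letter (up x) = x

step-letter : ∀ {c y g} → c -[ y ]→ g → letter g ≡ y
step-letter start    = refl
step-letter (down _) = refl
step-letter (turn _) = refl
step-letter (rise _) = refl

Run-letter : ∀ u {y c g} → Run c (u ++ y ∷ []) g → letter g ≡ y
Run-letter []      (t ∷ []) = step-letter t
Run-letter (x ∷ u) (t ∷ r)  = Run-letter u r

step-from : ∀ {c y g e} → c -[ y ]→ g → ¬ (g -[ y ]→ e)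
step-from start    (down q) = <-irrefl refl q
step-from start    (turn q) = <-irrefl refl q
step-from (down _) (down q) = <-irrefl refl q
step-from (down _) (turn q) = <-irrefl refl q
step-from (turn _) (rise q) = <-irrefl refl q
step-from (rise _) (rise q) = <-irrefl refl q

step-up : ∀ {c x g y e} → c -[ x ]→ g → g -[ y ]→ e → x < y → e ≡ up y
step-up start    (down q) p = ⊥-elim (<-asym p q)
step-up start    (turn q) p = refl
step-up (down _) (down q) p = ⊥-elim (<-asym p q)
step-up (down _) (turn q) p = refl
step-up (turn _) (rise q) p = refl
step-up (rise _) (rise q) p = refl

-- A descent after `x` shows that the state before `x` is initial or descending. Hence the last
-- component: `x` may be exchanged for a smaller letter.
step-dn : ∀ {c x g y e} → c -[ x ]→ g → g -[ y ]→ e → y < x → g ≡ dn x × e ≡ dn y × (∀ {z} → z < x → c -[ z ]→ dn z)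
step-dn start    (down q) p = refl , refl , λ _ → start
step-dn start    (turn q) p = ⊥-elim (<-asym p q)
step-dn (down r) (down q) p = refl , refl , λ s → down (<-trans s r)
step-dn (down _) (turn q) p = ⊥-elim (<-asym p q)
step-dn (turn _) (rise q) p = ⊥-elim (<-asym p q)
step-dn (rise _) (rise q) p = ⊥-elim (<-asym p q)

-- An exchange: `word`, taken from `T`, can replace `v` between a prefix leading to state `c` and
-- the continuation `s`, without loss of length.
record Sub (v T : List ℕ) (c : Ctx) (s : List ℕ) : Set where
  constructor sub
  field
    word     : List ℕ
    included : word ⊆ T
    longer   : length v ≤ length word
    accepted : Acc c (word ++ s)

⊆-[] : ∀ {w : List ℕ} → [] ⊆ w
⊆-[] {[]}    = []
⊆-[] {x ∷ w} = x ∷ʳ ⊆-[]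

⊆-left : ∀ {u v : List ℕ} w → u ⊆ v → u ⊆ v ++ w
⊆-left {u} w s = subst (_⊆ _) (++-identityʳ u) (⊆-++⁺ s ⊆-[])

⊆-right : ∀ {u v : List ℕ} w → u ⊆ v → u ⊆ w ++ v
⊆-right w s = ⊆-++⁺ (⊆-[] {w}) s

⊆-last : ∀ D {d D₂} {m : ℕ} D₀ → D₀ ++ m ∷ [] ≡ D ++ d ∷ D₂ → (m ∷ []) ⊆ d ∷ D₂
⊆-last D {d} {D₂} D₀ e with initLast D₂
... | [] with ∷ʳ-injective D₀ D e
...   | refl , refl = refl ∷ []
⊆-last D {d} D₀ e | D₂ ∷ʳ′ x with ∷ʳ-injective D₀ (D ++ d ∷ D₂) (trans e (sym (++-assoc D (d ∷ D₂) (x ∷ []))))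
... | refl , refl = ⊆-right (d ∷ D₂) ⊆-refl

Run-dn-⊆ : ∀ {c p y D₀ m} → Run c p (dn y) → p ⊆ D₀ ++ m ∷ [] → m ≢ y → p ⊆ D₀
Run-dn-⊆ {D₀ = D₀} r s ne with ⊆-++⁻ D₀ s
... | p , [] , refl , s₁ , _ = subst (_⊆ D₀) (sym (++-identityʳ p)) s₁
... | p , x ∷ [] , refl , s₁ , (refl ∷ []) = ⊥-elim (ne (sym (Run-letter p r)))
... | p , x ∷ [] , refl , s₁ , (_ ∷ʳ ())

-- The inserted letter a stands where b was; when a larger letter follows it, b serves as well, or,
-- if b has just been read in descending, the minimum m of the row.
restore : ∀ {D₀ m a b} E I₁ I₂ c p w s → D₀ ++ m ∷ [] ≡ E → All (m <_) (I₁ ++ b ∷ I₂) → Inc (I₁ ++ b ∷ I₂) →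
  All (_< a) I₁ → a ≤ b → p ⊆ E → w ⊆ I₁ ++ a ∷ I₂ → Acc c (p ++ w ++ s) →
  Sub (p ++ w) (E ++ (I₁ ++ b ∷ I₂) ++ a ∷ []) c s
restore {D₀} {m} {a} {b} E I₁ I₂ c p w s refl m<I inc I₁<a a≤b p⊆ w⊆ acc with ⊆-++⁻ I₁ w⊆
... | w₁ , w₂ , refl , s₁ , (_ ∷ʳ s₂) =
  sub (p ++ w₁ ++ w₂) (⊆-++⁺ p⊆ (⊆-left (a ∷ []) (⊆-++⁺ s₁ (b ∷ʳ s₂)))) ≤-refl
  (subst (Acc c) (sym (++-assoc p _ s)) acc)
... | w₁ , _ ∷ [] , refl , s₁ , (refl ∷ s₂) =
  sub (p ++ w₁ ++ a ∷ []) (⊆-++⁺ p⊆ (⊆-++⁺ (⊆-left (b ∷ I₂) s₁) ⊆-refl)) ≤-refl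
  (subst (Acc c) (sym (++-assoc p _ s)) acc)
... | w₁ , _ ∷ z ∷ w₂ , refl , s₁ , (refl ∷ s₂) = go (Run-++⁻ p (subst (λ x → Acc c (p ++ x)) (++-assoc w₁ _ s) acc))
  where
  T = (D₀ ++ m ∷ []) ++ (I₁ ++ b ∷ I₂) ++ a ∷ []
  b<z : b < z
  b<z with AllPairs-++⁻ I₁ inc
  ... | _ , (q ∷ _) , _ = All.head (All-resp-⊆ s₂ q)
  a<z = ≤-<-trans a≤b b<z
  same : Acc c (p ++ w₁ ++ b ∷ z ∷ w₂ ++ s) → Sub (p ++ w₁ ++ a ∷ z ∷ w₂) T c s
  same r = sub (p ++ w₁ ++ b ∷ z ∷ w₂) (⊆-++⁺ p⊆ (⊆-left (a ∷ []) (⊆-++⁺ s₁ (refl ∷ s₂))))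
    (≤-reflexive (trans (trans (length-++ p) (cong (length p +_) (trans (length-++ w₁) (sym (length-++ w₁))))) (sym (length-++ p))))
    (subst (Acc c) (sym (trans (++-assoc p _ s) (cong (p ++_) (++-assoc w₁ _ s)))) r)
  viaMin : w₁ ≡ [] → Run c p (dn b) → Acc (up z) (w₂ ++ s) → Sub (p ++ w₁ ++ a ∷ z ∷ w₂) T c s
  viaMin refl r rest = sub (p ++ m ∷ z ∷ w₂)
    (subst ((p ++ m ∷ z ∷ w₂) ⊆_) (sym (++-assoc D₀ (m ∷ []) _))
      (⊆-++⁺ (Run-dn-⊆ r p⊆ (<⇒≢ m<b)) (refl ∷ ⊆-left (a ∷ []) (⊆-right I₁ (b ∷ʳ s₂)))))
    (≤-reflexive (trans (length-++ p) (sym (length-++ p))))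
    (subst (Acc c) (sym (++-assoc p _ s)) (Run-++⁺ r (down m<b ∷ᵃ turn (<-trans m<b b<z) ∷ᵃ rest)))
    where m<b = All.head (All.++⁻ʳ I₁ m<I)
  w₁-last : ∀ {c} w₁ → All (_< a) w₁ → Run c w₁ (dn b) → w₁ ≡ []
  w₁-last w₁ q r with initLast w₁
  ... | []        = refl
  ... | w₁′ ∷ʳ′ y with refl ← Run-letter w₁′ r = ⊥-elim (<⇒≱ (All.head (All.++⁻ʳ w₁′ q)) a≤b)
  go : (∃[ g ] Run c p g × Acc g (w₁ ++ a ∷ z ∷ w₂ ++ s)) → Sub (p ++ w₁ ++ a ∷ z ∷ w₂) T c s
  go (g , r , acc₁) with Run-++⁻ w₁ acc₁
  ... | g₁ , r₁ , (e , t ∷ t′ ∷ r₂) with step-up t t′ a<z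
  ...   | refl = fin t
    where
    ok : ∀ {h} → g₁ -[ b ]→ h → h -[ z ]→ up z → Sub (p ++ w₁ ++ a ∷ z ∷ w₂) T c s
    ok t t′ = same (Run-++⁺ r (Run-++⁺ r₁ (t ∷ᵃ t′ ∷ᵃ (e , r₂))))
    onDn : ∀ {x} → g₁ ≡ dn x → Sub (p ++ w₁ ++ a ∷ z ∷ w₂) T c s
    onDn {x} refl with <-cmp b x
    ... | tri< b<x _ _ = ok (down b<x) (turn b<z)
    ... | tri> _ _ x<b = ok (turn x<b) (rise b<z)
    ... | tri≈ _ refl _ with w₁-last w₁ (All-resp-⊆ s₁ I₁<a) r₁
    ...   | w₁≡ = viaMin w₁≡ (run-p w₁≡ r₁) (e , r₂)
      where
      run-p : w₁ ≡ [] → Run g w₁ (dn b) → Run c p (dn b)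
      run-p refl [] = r
    fin : ∀ {h} → g₁ -[ a ]→ h → Sub (p ++ w₁ ++ a ∷ z ∷ w₂) T c s
    fin start    = ok start (turn b<z)
    fin (down _) = onDn refl
    fin (turn _) = onDn refl
    fin (rise q) = ok (rise (<-≤-trans q a≤b)) (rise b<z)

IBump-c∈ : ∀ {a b I₂ c} I₁ → IBump a b I₂ c → (c ∷ []) ⊆ I₁ ++ b ∷ I₂
IBump-c∈ I₁ (below _) = ⊆-right I₁ (refl ∷ ⊆-[])
IBump-c∈ I₁ equal     = ⊆-right I₁ (_ ∷ʳ refl ∷ ⊆-[])

drop-small : ∀ {c : ℕ} {w} I₁ {J} → All (_≤ c) I₁ → w ⊆ I₁ ++ J → All (c <_) w → w ⊆ J
drop-small []       p       s          q       = s
drop-small (x ∷ I₁) (_ ∷ p) (_ ∷ʳ s)   q       = drop-small I₁ p s q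
drop-small (x ∷ I₁) (p ∷ _) (refl ∷ s) (q ∷ _) = ⊥-elim (<⇒≱ q p)

AllPairs-resp-⊆ : ∀ {R : ℕ → ℕ → Set} {u v} → u ⊆ v → AllPairs R v → AllPairs R u
AllPairs-resp-⊆ []         []      = []
AllPairs-resp-⊆ (_ ∷ʳ s)   (_ ∷ p) = AllPairs-resp-⊆ s p
AllPairs-resp-⊆ (refl ∷ s) (q ∷ p) = All-resp-⊆ s q ∷ AllPairs-resp-⊆ s p

∷ˡ⁻ : ∀ {x : ℕ} {u v} → x ∷ u ⊆ v → u ⊆ v
∷ˡ⁻ (y ∷ʳ s)   = y ∷ʳ ∷ˡ⁻ s
∷ˡ⁻ (refl ∷ s) = _ ∷ʳ s

IBump-tail : ∀ {a b I₂ c w} I₁ → All (_< a) I₁ → IBump a b I₂ c → w ⊆ I₁ ++ a ∷ I₂ → All (c <_) w → c ∷ w ⊆ I₁ ++ b ∷ I₂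
IBump-tail I₁ p (below a<b) s q =
  ⊆-right I₁ (refl ∷ drop-small (_ ∷ []) (<⇒≤ a<b ∷ []) (drop-small I₁ (All.map (λ x → <⇒≤ (<-trans x a<b)) p) s q) q)
IBump-tail I₁ p (equal {a}) s q =
  ⊆-right I₁ (_ ∷ʳ refl ∷ drop-small (a ∷ suc a ∷ []) (n≤1+n a ∷ ≤-refl ∷ [])
                          (drop-small I₁ (All.map (λ x → ≤-trans (<⇒≤ x) (n≤1+n a)) p) s q) q)

length-snoc : ∀ (p : List ℕ) x → length (p ++ x ∷ []) ≡ suc (length p)
length-snoc p x = trans (length-++ p) (+-comm (length p) 1)

small-in-I : ∀ {a b I₂ c z} I₁ → Inc (I₁ ++ b ∷ I₂) → IBump a b I₂ c → z ∈ I₁ ++ a ∷ I₂ → z < c → z ∈ I₁ ⊎ z ≡ a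
small-in-I I₁ s ib z∈ z<c with ∈-++⁻ I₁ z∈
... | inj₁ p            = inj₁ p
... | inj₂ (here p)     = inj₂ p
... | inj₂ (there p) with AllPairs-++⁻ I₁ s
...   | _ , (q ∷ q′) , _ = ⊥-elim (too-big ib (All.lookup q p) z<c)
  where
  too-big : ∀ {a b I₂ c z} → IBump a b I₂ c → b < z → ¬ (z < c)
  too-big (below _) p q = <-asym p q
  too-big equal     p q = <⇒≱ p (≤-pred q)

-- With `m` read for `c`, the letter `z` may become an ascent; this is harmless unless a descent
-- follows `z`, which the last hypothesis excludes.
via-min : ∀ {g m c z u} → z < c → m < c → z ≢ m → Acc g (c ∷ z ∷ u) →
  (u ≡ [] ⊎ (∃[ y ] ∃[ u′ ] u ≡ y ∷ u′ × z < y)) → Acc g (m ∷ z ∷ u)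
via-min {m = m} {z = z} z<c m<c z≢m (e , t ∷ t′ ∷ r) h with step-dn t t′ z<c | <-cmp z m
... | refl , refl , lower | tri< z<m _ _ = lower m<c ∷ᵃ down z<m ∷ᵃ (e , r)
... | refl , refl , lower | tri≈ _ p _   = ⊥-elim (z≢m p)
... | refl , refl , lower | tri> _ _ m<z with h | r
...   | inj₁ refl                 | r          = lower m<c ∷ᵃ turn m<z ∷ᵃ (_ , [])
...   | inj₂ (y , u , refl , z<y) | turn q ∷ r = lower m<c ∷ᵃ turn m<z ∷ᵃ rise q ∷ᵃ (_ , r)
...   | inj₂ (y , u , refl , z<y) | down q ∷ r = ⊥-elim (<-asym z<y q)

lower-head : ∀ {g c d y u} → y < d → d < c → Acc g (c ∷ y ∷ u) → Acc g (d ∷ y ∷ u)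
lower-head y<d d<c (e , t ∷ t′ ∷ r) with step-dn t t′ (<-trans y<d d<c)
... | refl , refl , lower = lower d<c ∷ᵃ down y<d ∷ᵃ (e , r)

⊆-++-assoc : ∀ {w : List ℕ} u v {x} → w ⊆ u ++ v ++ x → w ⊆ (u ++ v) ++ x
⊆-++-assoc {w} u v s = subst (w ⊆_) (sym (++-assoc u v _)) s

Acc-++ˡ : ∀ {c} u v {x} → Acc c (u ++ v ++ x) → Acc c ((u ++ v) ++ x)
Acc-++ˡ {c} u v r = subst (Acc c) (sym (++-assoc u v _)) r

Acc-++ʳ : ∀ {c} u v {x} → Acc c ((u ++ v) ++ x) → Acc c (u ++ v ++ x)
Acc-++ʳ {c} u v r = subst (Acc c) (++-assoc u v _) r

Sub-length : ∀ {u v T c s} → length v ≡ length u → Sub u T c s → Sub v T c s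
Sub-length e (sub w w⊆ p acc) = sub w w⊆ (subst (_≤ length w) (sym e) p) acc

length-mid : ∀ (p : List ℕ) {x y} w → length ((p ++ x ∷ []) ++ w) ≡ length ((p ++ y ∷ []) ++ w)
length-mid p w = trans (length-++ (p ++ _ ∷ [])) (trans (cong (_+ length w) (trans (length-snoc p _) (sym (length-snoc p _)))) (sym (length-++ (p ++ _ ∷ []))))

-- c replaced d < c in the decreasing part of the row, and is the last letter taken from there.
only-c : ∀ {a} D₀ m D₁ {d} D₂ I₁ {b} I₂ {c} c₀ v₁ w x → D₀ ++ m ∷ [] ≡ D₁ ++ d ∷ D₂ →
  All (m <_) (I₁ ++ b ∷ I₂) → Inc (I₁ ++ b ∷ I₂) → All (_< a) I₁ → IBump a b I₂ c →
  v₁ ⊆ D₁ → w ⊆ I₁ ++ a ∷ I₂ → Acc c₀ ((v₁ ++ c ∷ []) ++ w ++ x) →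
  Sub ((v₁ ++ c ∷ []) ++ w) ((D₁ ++ d ∷ D₂) ++ (I₁ ++ b ∷ I₂) ++ a ∷ []) c₀ x
only-c {a} D₀ m D₁ {d} D₂ I₁ {b} I₂ {c} c₀ v₁ w x E≡ r s t ib v₁⊆ w⊆ acc =
  go w w⊆ (AllPairs-resp-⊆ w⊆ (Inc-replace I₁ s t ib)) (Run-++⁻ v₁ (Acc-++ʳ v₁ (c ∷ []) acc))
  where
  E = D₁ ++ d ∷ D₂
  T = E ++ (I₁ ++ b ∷ I₂) ++ a ∷ []
  m<c : m < c
  m<c = <-≤-trans (All.head (All.++⁻ʳ I₁ r)) (IBump-b≤c ib)
  a<c = IBump-a<c ib
  c-from-I : ∀ {g w} → w ⊆ (I₁ ++ b ∷ I₂) ++ a ∷ [] → Run c₀ v₁ g → Acc g (w ++ x) → Sub (v₁ ++ w) T c₀ x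
  c-from-I {w = w} w⊆ r₁ acc = sub (v₁ ++ w) (⊆-++⁺ (⊆-left (d ∷ D₂) v₁⊆) w⊆) ≤-refl (Acc-++ˡ v₁ w (Run-++⁺ r₁ acc))
  min : ∀ {g z w} → z ∷ w ⊆ I₁ ++ a ∷ I₂ → Run c₀ v₁ g → Acc g (m ∷ z ∷ w ++ x) → Sub ((v₁ ++ c ∷ []) ++ z ∷ w) T c₀ x
  min {z = z} {w} w⊆ r₁ acc = Sub-length (length-mid v₁ (z ∷ w))
    (restore E I₁ I₂ c₀ (v₁ ++ m ∷ []) (z ∷ w) x E≡ r s t (IBump-a≤b ib) (⊆-++⁺ v₁⊆ (⊆-last D₁ D₀ E≡)) w⊆
      (Acc-++ˡ v₁ (m ∷ []) (Run-++⁺ r₁ acc)))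
  withA : ∀ {g z} → Run c₀ v₁ g → Acc g (c ∷ a ∷ x) → Sub ((v₁ ++ c ∷ []) ++ z ∷ []) T c₀ x
  withA {z = z} r₁ acc = Sub-length (trans (cong length (++-assoc v₁ _ _)) (trans (length-++ v₁) (sym (length-++ v₁))))
    (c-from-I (⊆-++⁺ (IBump-c∈ I₁ ib) ⊆-refl) r₁ acc)
  go : ∀ w → w ⊆ I₁ ++ a ∷ I₂ → Inc w → (∃[ g ] Run c₀ v₁ g × Acc g (c ∷ w ++ x)) → Sub ((v₁ ++ c ∷ []) ++ w) T c₀ x
  go [] w⊆ _ (g , r₁ , acc) = Sub-length (cong length (++-identityʳ (v₁ ++ c ∷ [])))
    (c-from-I (⊆-left (a ∷ []) (IBump-c∈ I₁ ib)) r₁ acc)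
  go (z ∷ w) w⊆ (z<w ∷ _) (g , r₁ , acc) with <-cmp z c
  ... | tri≈ _ refl _ = ⊥-elim (twice acc)
    where
    twice : ¬ Acc g (z ∷ z ∷ w ++ x)
    twice (_ , t ∷ t′ ∷ _) = step-from t t′
  ... | tri> _ _ c<z = Sub-length (cong length (++-assoc v₁ (c ∷ []) (z ∷ w)))
    (c-from-I (⊆-left (a ∷ []) (IBump-tail I₁ t ib w⊆ (c<z ∷ All.map (<-trans c<z) z<w))) r₁ acc)
  ... | tri< z<c _ _ with small-in-I I₁ s ib (⊆-lookup w⊆ (here refl)) z<c
  ...   | inj₁ z∈I₁ = lowest w x z<w w⊆ acc refl refl
    where
    z<a = All.lookup t z∈I₁
    m<z = All.lookup (All.++⁻ˡ I₁ r) z∈I₁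
    lowest : ∀ w′ x′ → All (z <_) w′ → z ∷ w′ ⊆ I₁ ++ a ∷ I₂ → Acc g (c ∷ z ∷ w′ ++ x′) → w′ ≡ w → x′ ≡ x →
             Sub ((v₁ ++ c ∷ []) ++ z ∷ w) T c₀ x
    lowest (y ∷ w′) _ (z<y ∷ _) w⊆ acc refl refl = min w⊆ r₁ (via-min z<c m<c (>⇒≢ m<z) acc (inj₂ (y , _ , refl , z<y)))
    lowest [] [] _ w⊆ acc refl refl = min w⊆ r₁ (via-min z<c m<c (>⇒≢ m<z) acc (inj₁ refl))
    lowest [] (y ∷ x′) _ w⊆ acc refl refl with <-cmp y z | acc
    ... | tri> _ _ z<y | _ = min w⊆ r₁ (via-min z<c m<c (>⇒≢ m<z) acc (inj₂ (y , x′ , refl , z<y)))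
    ... | tri≈ _ refl _ | _ , t ∷ t′ ∷ t″ ∷ _ = ⊥-elim (step-from t′ t″)
    -- A descent follows `z`, so `m` is of no use. Instead `c` comes from the increasing part and
    -- `z` gives way to the appended `a`, with `c > a > z > y`.
    ... | tri< y<z _ _ | _ , t ∷ t′ ∷ t″ ∷ r with step-dn t t′ z<c
    ...   | refl , refl , _ with step-dn t′ t″ y<z
    ...     | _ , refl , _ = withA r₁ (t ∷ᵃ down a<c ∷ᵃ down (<-trans y<z z<a) ∷ᵃ (_ , r))
  ...   | inj₂ refl = atA w z<w w⊆ acc
    where
    atA : ∀ w → All (a <_) w → a ∷ w ⊆ I₁ ++ a ∷ I₂ → Acc g (c ∷ a ∷ w ++ x) → Sub ((v₁ ++ c ∷ []) ++ a ∷ w) T c₀ x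
    atA [] _ w⊆ acc = withA r₁ acc
    atA (y ∷ w) (a<y ∷ a<w) w⊆ acc with <-cmp a m
    ... | tri< _ a≢m _ = min w⊆ r₁ (via-min z<c m<c a≢m acc (inj₂ (y , _ , refl , a<y)))
    ... | tri> _ a≢m _ = min w⊆ r₁ (via-min z<c m<c a≢m acc (inj₂ (y , _ , refl , a<y)))
    -- Now `a` equals the minimum of the row. The letters `c a` are exchanged for `m b`, and `b`
    -- lies below `y` because `y` belongs to `I₂`.
    ... | tri≈ _ refl _ with acc
    ...   | _ , t₁ ∷ t₂ ∷ t₃ ∷ r₃ with step-dn t₁ t₂ z<c
    ...     | refl , refl , lower with step-up t₂ t₃ a<y
    ...       | refl = Sub-length {v₁ ++ a ∷ b ∷ y ∷ w} (trans (length-mid v₁ (a ∷ y ∷ w)) (length-++-swap v₁))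
                        (sub (v₁ ++ a ∷ b ∷ y ∷ w) (⊆-++-assoc D₁ (d ∷ D₂) (⊆-++⁺ v₁⊆ (⊆-++⁺ (⊆-last D₁ D₀ E≡) (⊆-left (a ∷ []) (⊆-right I₁ (refl ∷ yw⊆))))))
                         ≤-refl (Acc-++ˡ v₁ _ (Run-++⁺ r₁ (lower a<c ∷ᵃ turn a<b ∷ᵃ rise b<y ∷ᵃ (_ , r₃)))))
      where
      a<b = All.head (All.++⁻ʳ I₁ r)
      yw⊆ : y ∷ w ⊆ I₂
      yw⊆ = drop-small (a ∷ []) (≤-refl ∷ []) (drop-small I₁ (All.map <⇒≤ t) (∷ˡ⁻ w⊆) (a<y ∷ a<w)) (a<y ∷ a<w)
      b<y : b < y
      b<y with AllPairs-++⁻ I₁ s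
      ... | _ , (q ∷ _) , _ = All.head (All-resp-⊆ yw⊆ q)
      length-++-swap : ∀ v₁ → length ((v₁ ++ a ∷ []) ++ a ∷ y ∷ w) ≡ length (v₁ ++ a ∷ b ∷ y ∷ w)
      length-++-swap v₁ = trans (cong length (++-assoc v₁ _ _)) (trans (length-++ v₁) (sym (length-++ v₁)))

-- Only the letters new to the row matter, and `restore` deals with `a`. If `c` has replaced `d` and
-- a letter `y` of `D₂` follows, then `y < d < c` and `d` can be read for `c`; if none follows,
-- `only-c` applies.
swap-row : ∀ {R a R′ a′} → Bump R a R′ a′ → ∀ c₀ v x → v ⊆ R′ → Acc c₀ (v ++ x) → Sub v (R ++ a ∷ []) c₀ x
swap-row (special D I p q r s) c₀ v x v⊆ acc = sub v (⊆-left (0 ∷ []) v⊆) ≤-refl acc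
swap-row (general {a} D₀ m D₁ {d} D₂ I₁ {b} I₂ {c} {a′} E≡ dE r s t ib u db) c₀ v x v⊆ acc
  with ⊆-++⁻ (D₁ ++ c ∷ D₂) v⊆
... | _ , w , refl , q⊆ , w⊆ with ⊆-++⁻ D₁ q⊆
...   | v₁ , _ , refl , v₁⊆ , q⊆ = subst (λ T → Sub _ T c₀ x) (sym (++-assoc E I (a ∷ []))) (go q⊆ acc)
  where
  E = D₁ ++ d ∷ D₂
  I = I₁ ++ b ∷ I₂
  T = E ++ I ++ a ∷ []
  restored : ∀ p → p ⊆ E → Acc c₀ (p ++ w ++ x) → Sub (p ++ w) T c₀ x
  restored p p⊆ acc = restore E I₁ I₂ c₀ p w x E≡ r s t (IBump-a≤b ib) p⊆ w⊆ acc
  go : ∀ {q} → q ⊆ c ∷ D₂ → Acc c₀ (((v₁ ++ q) ++ w) ++ x) → Sub ((v₁ ++ q) ++ w) T c₀ x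
  go {q} (_ ∷ʳ q⊆) acc = restored (v₁ ++ q) (⊆-++⁺ v₁⊆ (d ∷ʳ q⊆)) (Acc-++ʳ (v₁ ++ q) w acc)
  go {_ ∷ q} (refl ∷ q⊆) acc with m≤n⇒m<n∨m≡n (DBump-d≤c db)
  ... | inj₂ d≡c = restored (v₁ ++ c ∷ q) (⊆-++⁺ v₁⊆ (sym d≡c ∷ q⊆)) (Acc-++ʳ (v₁ ++ c ∷ q) w acc)
  go {_ ∷ []} (refl ∷ q⊆) acc | inj₁ d<c =
    only-c D₀ m D₁ D₂ I₁ I₂ c₀ v₁ w x E≡ r s t ib v₁⊆ w⊆ (Acc-++ʳ (v₁ ++ c ∷ []) w acc)
  go {_ ∷ y ∷ q} (refl ∷ q⊆) acc | inj₁ d<c with Run-++⁻ v₁ (Acc-++ʳ v₁ (c ∷ y ∷ q) (Acc-++ʳ (v₁ ++ c ∷ y ∷ q) w acc))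
  ... | g , r₁ , acc₁ = Sub-length
          (trans (length-++ (v₁ ++ c ∷ y ∷ q)) (trans (cong (_+ length w) (trans (length-++ v₁) (sym (length-++ v₁)))) (sym (length-++ (v₁ ++ d ∷ y ∷ q)))))
          (restored (v₁ ++ d ∷ y ∷ q) (⊆-++⁺ v₁⊆ (refl ∷ q⊆)) (Acc-++ˡ v₁ (d ∷ y ∷ q) (Run-++⁺ r₁ (lower-head y<d d<c acc₁))))
    where
    y<d : y < d
    y<d with AllPairs-++⁻ D₁ dE
    ... | _ , (z ∷ _) , _ = All.head (All-resp-⊆ q⊆ z)

rising-singleton : ∀ {E e q s} → Dec E → e ∷ q ⊆ E → Acc (up e) (q ++ s) → q ≡ []
rising-singleton {q = []}    dE q⊆ _   = refl
rising-singleton {q = y ∷ q} dE q⊆ acc with AllPairs-resp-⊆ q⊆ dE | acc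
... | (y<e ∷ _) ∷ _ | _ , rise e<y ∷ _ = ⊥-elim (<-asym y<e e<y)

DBump-a′∈ : ∀ {c d D₂ a′} D₁ → DBump c d D₂ a′ → (a′ ∷ []) ⊆ D₁ ++ d ∷ D₂
DBump-a′∈ D₁ (below _) = ⊆-right D₁ (refl ∷ ⊆-[])
DBump-a′∈ D₁ (equal _) = ⊆-right D₁ (_ ∷ʳ refl ∷ ⊆-[])

DBump-cons : ∀ {c d D₂ a′ g e q} D₁ → DBump c d D₂ a′ → g -[ a′ ]→ e → q ⊆ D₂ → Acc e q → a′ ∷ q ⊆ D₁ ++ d ∷ D₂
DBump-cons D₁ (below _) t q⊆          acc          = ⊆-right D₁ (refl ∷ q⊆)
DBump-cons D₁ (equal _) t (_ ∷ʳ q⊆)   acc          = ⊆-right D₁ (_ ∷ʳ refl ∷ q⊆)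
DBump-cons D₁ (equal _) t (refl ∷ q⊆) (_ , t′ ∷ _) = ⊥-elim (step-from t t′)

Acc-prefix : ∀ {c} u {v} → Acc c (u ++ v) → Acc c u
Acc-prefix u acc = let _ , r , _ = Run-++⁻ u acc in _ , r

split-step : ∀ {c y g e v} → c -[ y ]→ g → Acc g (e ∷ v) → y < e → Acc (up e) v
split-step t (_ , t′ ∷ r) p with refl ← step-up t t′ p = _ , r

-- A letter `e ≥ c` of the decreasing part starts a rise after `a′`, so it is the only one taken
-- from there, and `a′ c` serves for `a′ e` with `c` from the increasing part of the old row.
-- Otherwise the letters taken lie behind `d`, and `a′` precedes them in the old row.
swap-letter : ∀ {R a R′ a′} → Bump R a R′ a′ → ∀ c₀ v x → v ⊆ R′ → Acc c₀ ((a′ ∷ v) ++ x) → Sub (a′ ∷ v) (R ++ a ∷ []) c₀ x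
swap-letter (special D I p q r s) c₀ v x v⊆ (_ , t ∷ acc′) =
  go v (subst (v ⊆_) (sym (++-assoc D (1 ∷ []) _)) v⊆) (_ , acc′)
  where
  T = (D ++ 1 ∷ 0 ∷ 1 ∷ I) ++ 0 ∷ []
  included : ∀ {w} → w ⊆ 0 ∷ 1 ∷ I → w ⊆ T
  included w⊆ = ⊆-left (0 ∷ []) (⊆-right D (1 ∷ʳ w⊆))
  dE : Dec (D ++ 1 ∷ [])
  dE = AllPairs.++⁺ p ([] ∷ []) (All.map (_∷ []) q)
  go : ∀ v → v ⊆ (D ++ 1 ∷ []) ++ 0 ∷ 1 ∷ I → Acc _ (v ++ x) → Sub (0 ∷ v) T c₀ x
  go v v⊆ acc with ⊆-++⁻ (D ++ 1 ∷ []) v⊆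
  go [] v⊆ acc | [] , .[] , refl , _ , _ = sub (0 ∷ []) (included (refl ∷ ⊆-[])) ≤-refl (t ∷ᵃ acc)
  go _ v⊆ acc | [] , w , refl , _ , (_ ∷ʳ w⊆) = sub (0 ∷ w) (included (refl ∷ w⊆)) ≤-refl (t ∷ᵃ acc)
  go _ v⊆ (_ , t′ ∷ _) | [] , _ ∷ w , refl , _ , (refl ∷ w⊆) = ⊥-elim (step-from t t′)
  go _ v⊆ acc | e ∷ q′ , w , refl , q⊆ , w⊆ = finish (rising-singleton dE q⊆ (subst (Acc (up e)) (++-assoc q′ w x) acc₁)) acc₁ w⊆
    where
    1≤e : 1 ≤ e
    1≤e = All.head (All-resp-⊆ q⊆ (All.++⁺ (All.map <⇒≤ q) (≤-refl ∷ [])))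
    acc₁ : Acc (up e) ((q′ ++ w) ++ x)
    acc₁ = split-step t acc 1≤e
    finish : ∀ {q′ w} → q′ ≡ [] → Acc (up e) ((q′ ++ w) ++ x) → w ⊆ 0 ∷ 1 ∷ I → Sub (0 ∷ e ∷ q′ ++ w) T c₀ x
    finish {w = w} refl acc w⊆ = sub (0 ∷ 1 ∷ w)
      (included (refl ∷ refl ∷ drop-small (0 ∷ 1 ∷ []) (z≤n ∷ ≤-refl ∷ []) w⊆ (All.map (≤-<-trans 1≤e) (All.++⁻ˡ w (Acc-up (w ++ x) acc)))))
      ≤-refl (t ∷ᵃ second t ∷ᵃ Acc-mono (w ++ x) 1≤e acc)
      where
      second : ∀ {g} → c₀ -[ 0 ]→ g → g -[ 1 ]→ up 1
      second start    = turn (s≤s z≤n)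
      second (down _) = turn (s≤s z≤n)
      second (turn ())
      second (rise ())
swap-letter (general {a} D₀ m D₁ {d} D₂ I₁ {b} I₂ {c} {a′} E≡ dE r s t ib u db) c₀ v x v⊆ (_ , t₁ ∷ acc′)
  with ⊆-++⁻ (D₁ ++ c ∷ D₂) v⊆
... | q , w , refl , q⊆ , w⊆ = subst (λ T → Sub _ T c₀ x) (sym (++-assoc E I (a ∷ []))) (go q q⊆ (_ , acc′))
  where
  E = D₁ ++ d ∷ D₂
  I = I₁ ++ b ∷ I₂
  T = E ++ I ++ a ∷ []
  dE′ = Dec-replace D₁ dE u (DBump-d≤c db)
  a′<c = DBump-a′<c db
  large : ∀ e q → c ≤ e → e ∷ q ⊆ D₁ ++ c ∷ D₂ → Acc _ (((e ∷ q) ++ w) ++ x) → Sub (a′ ∷ (e ∷ q) ++ w) T c₀ x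
  large e q c≤e eq⊆ acc = finish (rising-singleton dE′ eq⊆ (Acc-++ʳ q w acc₁)) acc₁
    where
    acc₁ : Acc (up e) ((q ++ w) ++ x)
    acc₁ = split-step t₁ acc (<-≤-trans a′<c c≤e)
    finish : ∀ {q} → q ≡ [] → Acc (up e) ((q ++ w) ++ x) → Sub (a′ ∷ (e ∷ q) ++ w) T c₀ x
    finish refl acc = sub (a′ ∷ c ∷ w)
      (⊆-++⁺ (DBump-a′∈ D₁ db) (⊆-left (a ∷ []) (IBump-tail I₁ t ib w⊆ (All.map (≤-<-trans c≤e) (All.++⁻ˡ w (Acc-up (w ++ x) acc))))))
      ≤-refl (t₁ ∷ᵃ second t₁ a′<c ∷ᵃ Acc-mono (w ++ x) c≤e acc)
      where
      second : ∀ {g y z} → c₀ -[ y ]→ g → y < z → g -[ z ]→ up z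
      second start    p = turn p
      second (down _) p = turn p
      second (turn _) p = rise p
      second (rise _) p = rise p
  restored : ∀ p → p ⊆ E → Acc c₀ (p ++ w ++ x) → Sub (p ++ w) T c₀ x
  restored p p⊆ acc = restore E I₁ I₂ c₀ p w x E≡ r s t (IBump-a≤b ib) p⊆ w⊆ acc
  go : ∀ q → q ⊆ D₁ ++ c ∷ D₂ → Acc _ ((q ++ w) ++ x) → Sub (a′ ∷ q ++ w) T c₀ x
  go q q⊆ acc with ⊆-++⁻ D₁ q⊆
  ... | e ∷ q′ , w′ , refl , q₁⊆ , _ = large e (q′ ++ w′) (<⇒≤ (All.head (All-resp-⊆ q₁⊆ u))) q⊆ acc
  ... | [] , _ ∷ q′ , refl , _ , (refl ∷ _) = large c q′ ≤-refl q⊆ acc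
  ... | [] , q , refl , _ , (_ ∷ʳ q⊆D₂) =
    restored (a′ ∷ q) (DBump-cons D₁ db t₁ q⊆D₂ (Acc-prefix q (Acc-++ʳ q w acc))) (t₁ ∷ᵃ Acc-++ʳ q w acc)

swap-bump : ∀ {R a R′ a′} → Bump R a R′ a′ → ∀ c₀ v x → v ⊆ a′ ∷ R′ → Acc c₀ (v ++ x) → Sub v (R ++ a ∷ []) c₀ x
swap-bump B c₀ v       x (_ ∷ʳ v⊆)   acc = swap-row B c₀ v x v⊆ acc
swap-bump B c₀ (_ ∷ v) x (refl ∷ v⊆) acc = swap-letter B c₀ v x v⊆ acc

-- Maximality of the rows under insertion

-- The defining condition of standard decomposition tableaux, for a unimodal row R above a row Q.
Max : List ℕ → List ℕ → Set
Max Q R = ∀ u → u ⊆ Q ++ R → Acc st u → length u ≤ length R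

Acc-after : ∀ {c b h} I → c -[ b ]→ h → Inc (b ∷ I) → Acc h I
Acc-after I start    (p ∷ q) = Acc-dn I p q
Acc-after I (down _) (p ∷ q) = Acc-dn I p q
Acc-after I (turn _) p       = Inc-Acc I p
Acc-after I (rise _) p       = Inc-Acc I p

Run-dn-step : ∀ u {y c g x} → Run c (u ++ y ∷ []) g → g -[ x ]→ dn x → x < y
Run-dn-step []      (start ∷ [])  (down q) = q
Run-dn-step []      (down _ ∷ []) (down q) = q
Run-dn-step []      (turn _ ∷ []) ()
Run-dn-step []      (rise _ ∷ []) ()
Run-dn-step (_ ∷ u) (_ ∷ r)       t        = Run-dn-step u r t

Run-join : ∀ {u v c g h} → Run c u g → Run g v h → Run c (u ++ v) h
Run-join []      q = q
Run-join (t ∷ r) q = t ∷ Run-join r q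

small-before-descent : ∀ {c g x} w → Run c w g → g -[ x ]→ dn x → All (_< x) w → w ≡ []
small-before-descent w r t p with initLast w
... | []      = refl
... | w′ ∷ʳ′ y = ⊥-elim (<-asym (Run-dn-step w′ r t) (All.head (All.++⁻ʳ w′ p)))

-- A final `a` gains nothing over the row. If no letter of `b I₂` is taken, `a` gives way to `b I₂`,
-- or to `m b I₂` when `b` has just been read in descending. If a letter `x ≥ b` is taken before
-- `a`, the word descends all the way and `x a` gives way to `m b I₂`. The exchanged word avoids
-- `a`, so maximality bounds it.
blocked-bound : ∀ Q D₀ {m} I₁ {b I₂ a} → All (m <_) (I₁ ++ b ∷ I₂) → Inc (I₁ ++ b ∷ I₂) → All (_< a) I₁ → a ≤ b →
  Max Q ((D₀ ++ m ∷ []) ++ I₁ ++ b ∷ I₂) → ∀ u → u ⊆ Q ++ ((D₀ ++ m ∷ []) ++ I₁ ++ b ∷ I₂) ++ a ∷ [] → Acc st u →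
  length u ≤ length ((D₀ ++ m ∷ []) ++ I₁ ++ b ∷ I₂)
blocked-bound Q D₀ {m} I₁ {b} {I₂} {a} m<I s t a≤b mx u u⊆ acc
  with ⊆-++⁻ Q u⊆
... | uq , u′ , refl , uq⊆ , u′⊆ with ⊆-++⁻ ((D₀ ++ m ∷ []) ++ I₁ ++ b ∷ I₂) u′⊆
...   | ur , .[] , refl , ur⊆ , (_ ∷ʳ []) = mx _ (⊆-++⁺ uq⊆ (subst (_⊆ _) (sym (++-identityʳ ur)) ur⊆)) acc
...   | ur , _ ∷ [] , refl , ur⊆ , (refl ∷ []) with ⊆-++⁻ (D₀ ++ m ∷ []) ur⊆
...     | p , w , refl , p⊆ , w⊆ with ⊆-++⁻ I₁ w⊆
...       | w₁ , r , refl , w₁⊆ , r⊆ = go (initLast r) r⊆ acc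
  where
  R = (D₀ ++ m ∷ []) ++ I₁ ++ b ∷ I₂
  m<b = All.head (All.++⁻ʳ I₁ m<I)
  inc-b : Inc (b ∷ I₂)
  inc-b = proj₁ (proj₂ (AllPairs-++⁻ I₁ s))
  len : ∀ (p : List ℕ) {x y : ℕ} {w} → length (p ++ x ∷ []) ≤ length (p ++ y ∷ w)
  len p {x} {y} {w} = subst₂ _≤_ (sym (length-++ p)) (sym (length-++ p)) (+-monoʳ-≤ (length p) (s≤s z≤n))
  len₂ : ∀ (p : List ℕ) {x₁ x₂ y₁ y₂ : ℕ} {w} → length (p ++ x₁ ∷ x₂ ∷ []) ≤ length (p ++ y₁ ∷ y₂ ∷ w)
  len₂ p = subst₂ _≤_ (sym (length-++ p)) (sym (length-++ p)) (+-monoʳ-≤ (length p) (s≤s (s≤s z≤n)))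
  p-prefix : ∀ {c g x} → Run c p g → g -[ x ]→ dn x → m < x → p ⊆ D₀
  p-prefix {c} r t m<x with ⊆-++⁻ D₀ p⊆
  ... | p₀ , [] , refl , s₁ , _ = subst (_⊆ D₀) (sym (++-identityʳ p₀)) s₁
  ... | p₀ , _ ∷ [] , refl , s₁ , (refl ∷ []) = ⊥-elim (<-asym m<x (Run-dn-step p₀ r t))
  ... | p₀ , _ ∷ [] , refl , s₁ , (_ ∷ʳ ())
  throughMin : p ⊆ D₀ → ∀ {g} → Run st (uq ++ p) g → g -[ m ]→ dn m → length ((uq ++ p) ++ m ∷ b ∷ I₂) ≤ length R
  throughMin p⊆D₀ r t = mx _ (subst₂ _⊆_ (sym (++-assoc uq p _)) (cong (Q ++_) (sym (++-assoc D₀ (m ∷ []) _)))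
                              (⊆-++⁺ uq⊆ (⊆-++⁺ p⊆D₀ (refl ∷ ⊆-right I₁ ⊆-refl))))
                        (Run-++⁺ r (t ∷ᵃ turn m<b ∷ᵃ Inc-Acc I₂ inc-b))
  w₁<b : All (_< b) w₁
  w₁<b = All.map (λ q → <-≤-trans q a≤b) (All-resp-⊆ w₁⊆ t)
  go : ∀ {r} → Data.List.InitLast r → r ⊆ b ∷ I₂ → Acc st (uq ++ (p ++ w₁ ++ r) ++ a ∷ []) →
       length (uq ++ (p ++ w₁ ++ r) ++ a ∷ []) ≤ length R
  go [] _ acc = end (Run-++⁻ uq acc)
    where
    word≡ : uq ++ (p ++ w₁ ++ []) ++ a ∷ [] ≡ (uq ++ p ++ w₁) ++ a ∷ []
    word≡ = trans (cong (λ z → uq ++ (p ++ z) ++ a ∷ []) (++-identityʳ w₁)) (sym (++-assoc uq (p ++ w₁) (a ∷ [])))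
    end : (∃[ g ] Run st uq g × Acc g ((p ++ w₁ ++ []) ++ a ∷ [])) → length (uq ++ (p ++ w₁ ++ []) ++ a ∷ []) ≤ length R
    end (g , rq , acc₁) with Run-++⁻ p (subst (Acc g) (trans (cong (λ z → (p ++ z) ++ a ∷ []) (++-identityʳ w₁)) (++-assoc p w₁ (a ∷ []))) acc₁)
    ... | g₁ , rp , acc₂ with Run-++⁻ w₁ acc₂
    ...   | g₂ , rw , (_ , t₁ ∷ []) = subst (λ z → length z ≤ length R) (sym word≡) (fin g₂ rw t₁)
      where
      run₂ : ∀ {g₂} → Run g₁ w₁ g₂ → ∀ {v} → Acc g₂ v → Acc st ((uq ++ p ++ w₁) ++ v)
      run₂ rw {v} r = Acc-++ˡ uq (p ++ w₁) (Run-++⁺ rq (Acc-++ˡ p w₁ (Run-++⁺ rp (Run-++⁺ rw r))))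
      ok : ∀ {g₂ h} → Run g₁ w₁ g₂ → g₂ -[ b ]→ h → length ((uq ++ p ++ w₁) ++ a ∷ []) ≤ length R
      ok rw t₂ = ≤-trans (len (uq ++ p ++ w₁)) (mx ((uq ++ p ++ w₁) ++ b ∷ I₂)
        (subst (_⊆ Q ++ R) (sym (trans (++-assoc uq (p ++ w₁) _) (cong (uq ++_) (++-assoc p w₁ _))))
           (⊆-++⁺ uq⊆ (⊆-++⁺ p⊆ (⊆-++⁺ w₁⊆ ⊆-refl))))
        (run₂ rw (t₂ ∷ᵃ Acc-after I₂ t₂ inc-b)))
      onDn : ∀ {x} → Run g₁ w₁ (dn x) → length ((uq ++ p ++ w₁) ++ a ∷ []) ≤ length R
      onDn {x} rw with <-cmp b x
      ... | tri< b<x _ _ = ok rw (down b<x)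
      ... | tri> _ _ x<b = ok rw (turn x<b)
      ... | tri≈ _ refl _ with initLast w₁
      ...   | w′ ∷ʳ′ y with refl ← Run-letter w′ rw = ⊥-elim (<-irrefl refl (All.head (All.++⁻ʳ w′ w₁<b)))
      onDn {x} [] | tri≈ _ refl _ | [] =
        ≤-trans (subst (λ z → length (z ++ a ∷ []) ≤ length ((uq ++ p) ++ m ∷ b ∷ I₂)) (cong (uq ++_) (sym (++-identityʳ p))) (len (uq ++ p)))
          (throughMin (Run-dn-⊆ rp p⊆ (<⇒≢ m<b)) (Run-join rq rp) (down m<b))
      fin : ∀ g₂ → Run g₁ w₁ g₂ → ∀ {h} → g₂ -[ a ]→ h → length ((uq ++ p ++ w₁) ++ a ∷ []) ≤ length R
      fin _ rw start    = ok rw start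
      fin _ rw (down _) = onDn rw
      fin _ rw (turn _) = onDn rw
      fin _ rw (rise q) = ok rw (rise (<-≤-trans q a≤b))
  go (r′ ∷ʳ′ x) r⊆ acc = end (Run-++⁻ uq acc)
    where
    b≤x : b ≤ x
    b≤x = All.head (All.++⁻ʳ r′ (All-resp-⊆ r⊆ (≤-refl ∷ All.map <⇒≤ (AllPairs.head inc-b))))
    r′<x : All (_< x) r′
    r′<x = All.map All.head (proj₂ (proj₂ (AllPairs-++⁻ r′ (AllPairs-resp-⊆ r⊆ inc-b))))
    word≡ : ∀ w r → w ≡ [] → r ≡ [] → uq ++ (p ++ w ++ r ++ x ∷ []) ++ a ∷ [] ≡ (uq ++ p) ++ x ∷ a ∷ []
    word≡ _ _ refl refl = trans (cong (uq ++_) (++-assoc p (x ∷ []) (a ∷ []))) (sym (++-assoc uq p _))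
    end : (∃[ g ] Run st uq g × Acc g ((p ++ w₁ ++ r′ ++ x ∷ []) ++ a ∷ [])) →
          length (uq ++ (p ++ w₁ ++ r′ ++ x ∷ []) ++ a ∷ []) ≤ length R
    end (g , rq , acc₁) with Run-++⁻ p (Acc-++ʳ p (w₁ ++ r′ ++ x ∷ []) acc₁)
    ... | g₁ , rp , acc₂ with Run-++⁻ w₁ (Acc-++ʳ w₁ (r′ ++ x ∷ []) acc₂)
    ...   | g₂ , rw , acc₃ with Run-++⁻ r′ (Acc-++ʳ r′ (x ∷ []) acc₃)
    ...     | g₃ , rr , (_ , t₁ ∷ t₂ ∷ []) with m≤n⇒m<n∨m≡n (≤-trans a≤b b≤x)
    ...       | inj₂ refl = ⊥-elim (step-from t₁ t₂)
    ...       | inj₁ a<x with step-dn t₁ t₂ a<x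
    ...         | refl , _ , lower with small-before-descent r′ rr t₁ r′<x
    ...           | r′≡ with small-before-descent w₁ rw (back r′≡ rr t₁) (All.map (λ q → <-≤-trans q b≤x) w₁<b)
      where
      back : ∀ {r g h} → r ≡ [] → Run g₂ r g → g -[ x ]→ h → g₂ -[ x ]→ h
      back refl [] t = t
    ...             | w₁≡ = subst (λ z → length z ≤ length R) (sym (word≡ w₁ r′ w₁≡ r′≡))
      (≤-trans (len₂ (uq ++ p)) (final w₁≡ r′≡ rw rr t₁ lower))
      where
      final : ∀ {w r g₂ g₃} → w ≡ [] → r ≡ [] → Run g₁ w g₂ → Run g₂ r g₃ → g₃ -[ x ]→ dn x →
        (∀ {z} → z < x → g₃ -[ z ]→ dn z) → length ((uq ++ p) ++ m ∷ b ∷ I₂) ≤ length R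
      final refl refl [] [] t lower = throughMin (p-prefix rp t m<x) (Run-join rq rp) (lower m<x)
        where m<x = <-≤-trans m<b b≤x

Max-bump-bound : ∀ {Q R a R′ a′} → Bump R a R′ a′ → Max Q R → ∀ u → u ⊆ Q ++ R ++ a ∷ [] → Acc st u → length u ≤ length R
Max-bump-bound {Q} (special D I p q r s) mx =
  subst (λ R → Max Q R → ∀ u → u ⊆ Q ++ R ++ 0 ∷ [] → Acc st u → length u ≤ length R) assoc
    (blocked-bound Q (D ++ 1 ∷ []) [] (s≤s z≤n ∷ All.map (<-trans (s≤s z≤n)) s) (s ∷ r) [] z≤n) mx
  where
  assoc : ((D ++ 1 ∷ []) ++ 0 ∷ []) ++ 1 ∷ I ≡ D ++ 1 ∷ 0 ∷ 1 ∷ I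
  assoc = trans (++-assoc (D ++ 1 ∷ []) _ _) (++-assoc D _ _)
Max-bump-bound {Q} (general {a} D₀ m D₁ {d} D₂ I₁ {b} I₂ E≡ dE r s t ib u db) mx =
  subst (λ E → Max Q (E ++ I₁ ++ b ∷ I₂) → ∀ u → u ⊆ Q ++ (E ++ I₁ ++ b ∷ I₂) ++ a ∷ [] → Acc st u → length u ≤ length (E ++ I₁ ++ b ∷ I₂)) E≡
    (blocked-bound Q D₀ I₁ r s t (IBump-a≤b ib)) mx

Bump-length : ∀ {R a R′ a′} → Bump R a R′ a′ → length R′ ≡ length R
Bump-length {R} {a} {R′} B = suc-injective (trans (sym (∼-length (Bump-∼ B))) (length-snoc R a))

Max-append : ∀ {Q R} a → Max Q R → Max Q (R ++ a ∷ [])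
Max-append {Q} {R} a mx u u⊆ acc with ⊆-++⁻ (Q ++ R) (subst (u ⊆_) (sym (++-assoc Q R _)) u⊆)
... | v , w , refl , v⊆ , w⊆ = subst₂ _≤_ (sym (length-++ v)) (sym (length-++ R))
  (+-mono-≤ (mx v v⊆ (Acc-prefix v acc)) (⊆-length w⊆))

Max-empty : ∀ R → Max [] R
Max-empty R u u⊆ _ = ⊆-length u⊆

-- Exchanging letters of `a′ R′` for letters of `R a` turns a subword of `Q a′ R′` into one of
-- `Q R a`, which `Max-bump-bound` measures by the row before the bump.
Max-output : ∀ {Q R a R′ a′} → Bump R a R′ a′ → Max Q R → Max (Q ++ a′ ∷ []) R′
Max-output {Q} {R} {a} {R′} {a′} B mx u u⊆ acc with ⊆-++⁻ Q (subst (u ⊆_) (++-assoc Q _ _) u⊆)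
... | v , w , refl , v⊆ , w⊆ with Run-++⁻ v acc
...   | g , r , acc₁ with swap-bump B g w [] w⊆ (subst (Acc g) (sym (++-identityʳ w)) acc₁)
...     | sub w′ w′⊆ le acc₂ = ≤-trans (subst₂ _≤_ (sym (length-++ v)) (sym (length-++ v)) (+-monoʳ-≤ (length v) le))
  (subst (length (v ++ w′) ≤_) (sym (Bump-length B))
    (Max-bump-bound B mx (v ++ w′) (⊆-++⁺ v⊆ w′⊆) (Run-++⁺ r (subst (Acc g) (++-identityʳ w′) acc₂))))

Max-input : ∀ {Q b Q′ b′ R} → Bump Q b Q′ b′ → Max (Q ++ b ∷ []) R → Max Q′ R
Max-input {Q} {b} {Q′} B mx u u⊆ acc with ⊆-++⁻ Q′ u⊆
... | v , w , refl , v⊆ , w⊆ with swap-row B st v w v⊆ acc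
...   | sub v′ v′⊆ le acc₁ = ≤-trans (subst₂ _≤_ (sym (length-++ v)) (sym (length-++ v′)) (+-monoˡ-≤ (length w) le))
  (mx (v′ ++ w) (⊆-++⁺ v′⊆ w⊆) acc₁)

Bump-ascent : ∀ {R a R′ a′} → Bump R a R′ a′ → ∃[ c ] a′ < c × a′ ∷ c ∷ [] ⊆ R
Bump-ascent (special D I p q r s) = 1 , s≤s z≤n , ⊆-right D (1 ∷ʳ refl ∷ refl ∷ ⊆-[])
Bump-ascent (general D₀ m D₁ D₂ I₁ I₂ E≡ dE r s t ib u db) =
  _ , DBump-a′<c db , ⊆-++⁺ (DBump-a′∈ D₁ db) (IBump-c∈ I₁ ib)

Run-last-rise : ∀ u {y z c e} → Run c (u ++ y ∷ []) e → y < z → Acc c (u ++ y ∷ z ∷ [])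
Run-last-rise []      (start ∷ [])  p = start ∷ᵃ turn p ∷ᵃ (_ , [])
Run-last-rise []      (down q ∷ []) p = down q ∷ᵃ turn p ∷ᵃ (_ , [])
Run-last-rise []      (turn q ∷ []) p = turn q ∷ᵃ rise p ∷ᵃ (_ , [])
Run-last-rise []      (rise q ∷ []) p = rise q ∷ᵃ rise p ∷ᵃ (_ , [])
Run-last-rise (_ ∷ u) (t ∷ r)       p = t ∷ᵃ Run-last-rise u r p

-- Q a′ followed by a larger letter of R is a unimodal subword of Q R.
Max-strict : ∀ {Q R a R′ a′} → Bump R a R′ a′ → Max Q R → Can (Q ++ a′ ∷ []) → suc (length Q) < length R
Max-strict {Q} B mx cn with Bump-ascent B
... | c , a′<c , ac⊆ = subst (_≤ _) (trans (length-++ Q) (+-comm (length Q) 2))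
        (mx (Q ++ _ ∷ c ∷ []) (⊆-++⁺ ⊆-refl ac⊆) (Run-last-rise Q (proj₂ (Can⇒Acc cn)) a′<c))

-- Tableaux

readT : Tab → List ℕ
readT []       = []
readT (R ∷ Rs) = readT Rs ++ R

top : Tab → List ℕ
top []      = []
top (R ∷ _) = R

data Good : Tab → Set where
  []   : Good []
  cons : ∀ {R Rs} → Can R → Max (top Rs) R → length (top Rs) < length R → Good Rs → Good (R ∷ Rs)

data KIns : ℕ → Tab → Tab → ℕ → Set where
  new    : ∀ {a} → KIns a [] ((a ∷ []) ∷ []) 1
  append : ∀ {a R Rs} → Can R → Can (R ++ a ∷ []) → KIns a (R ∷ Rs) ((R ++ a ∷ []) ∷ Rs) 1
  bump   : ∀ {a R Rs R′ a′ Rs′ x} → Bump R a R′ a′ → Red (a′ ∷ R′) → KIns a′ Rs Rs′ x →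
           KIns a (R ∷ Rs) (R′ ∷ Rs′) (suc x)

TopStep : ℕ → List ℕ → List ℕ → Set
TopStep a Q Q′ = (Q′ ≡ Q ++ a ∷ [] × Can (Q ++ a ∷ [])) ⊎ (∃[ a′ ] Bump Q a Q′ a′)

top-step : ∀ {a P P′ x} → KIns a P P′ x → TopStep a (top P) (top P′)
top-step new          = inj₁ (refl , can [] _ [] [] [] [] [])
top-step (append _ c) = inj₁ (refl , c)
top-step (bump b _ _) = inj₂ (_ , b)

-- Lengths change only if the lower row appends, and then maximality supplies strictness. If it
-- bumps in turn, its new content is exchanged for the old one followed by `a′`.
Good-bump : ∀ {R Rs a R′ a′ Rs′ x} → Max (top Rs) R → length (top Rs) < length R → Bump R a R′ a′ → Can R′ →
  KIns a′ Rs Rs′ x → Good Rs′ → Good (R′ ∷ Rs′)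
Good-bump {R} {Rs} {R′ = R′} {Rs′ = Rs′} mx lt B cR′ ki g with top-step ki
... | inj₁ (e , c) = cons cR′ (subst (λ Q → Max Q R′) (sym e) (Max-output B mx))
        (subst₂ _<_ (sym (trans (cong length e) (length-snoc (top Rs) _))) (sym (Bump-length B)) (Max-strict B mx c)) g
... | inj₂ (_ , B′) = cons cR′ (Max-input B′ (Max-output B mx))
        (subst₂ _<_ (sym (Bump-length B′)) (sym (Bump-length B)) lt) g

record Inserted (a : ℕ) (P : Tab) : Set where
  constructor inserted
  field
    {tab}    : Tab
    {row col} : ℕ
    computes : kInsert a P ≡ (tab , (row , col))
    related  : KIns a P tab row
    good     : Good tab
    reads    : readT tab ∼ readT P ++ a ∷ []

kInsert-append : ∀ {a R Rs R′} → kIns a R ≡ (R′ , nothing) → kInsert a (R ∷ Rs) ≡ (R′ ∷ Rs , (1 , length R′))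
kInsert-append e rewrite e = refl

kInsert-bump : ∀ {a R Rs R′ a′ Rs′ x y} → kIns a R ≡ (R′ , just a′) → kInsert a′ Rs ≡ (Rs′ , (x , y)) →
  kInsert a (R ∷ Rs) ≡ (R′ ∷ Rs′ , (suc x , suc y))
kInsert-bump e f rewrite e | f = refl

-- The reading word stays in its braid class, so the rows below followed by the letter passed on to
-- them form a prefix of a word satisfying `Red`.
insert : ∀ a P → Good P → Red (readT P ++ a ∷ []) → Inserted a P
insert a [] _ _ = inserted refl new (cons (can [] _ [] [] [] [] []) (Max-empty _) (s≤s z≤n) []) rfl
insert a (R ∷ Rs) (cons cR mx lt g) red with kIns-view cR (Red-suffix (readT Rs) _ (subst Red (++-assoc (readT Rs) R _) red))
... | inj₁ (c , e) = inserted (kInsert-append {a} {R} e) (append cR c)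
        (cons c (Max-append {top Rs} {R} a mx) (<-≤-trans lt (subst (length R ≤_) (sym (length-snoc R a)) (n≤1+n _))) g)
        (≡⇒∼ (sym (++-assoc (readT Rs) R _)))
... | inj₂ (R′ , a′ , e , B) = go (insert a′ Rs g (Red-prefix _ R′ (subst Red (sym (++-assoc (readT Rs) (a′ ∷ []) R′)) red′)))
  where
  step : (readT Rs ++ R) ++ a ∷ [] ∼ readT Rs ++ a′ ∷ R′
  step = tran (≡⇒∼ (++-assoc (readT Rs) R _)) (∼-prefix (readT Rs) (Bump-∼ B))
  red′ : Red (readT Rs ++ a′ ∷ R′)
  red′ = Red-resp-∼ step red
  redR : Red (a′ ∷ R′)
  redR = Red-suffix (readT Rs) _ red′
  go : Inserted a′ Rs → Inserted a (R ∷ Rs)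
  go (inserted f ki g′ rd) = inserted (kInsert-bump {a} {R} e f) (bump B redR ki)
    (Good-bump mx lt B (proj₁ (Bump-classify B redR)) ki g′)
    (tran (∼-suffix R′ rd) (tran (≡⇒∼ (++-assoc (readT Rs) (a′ ∷ []) R′)) (symm step)))

data KWord : List ℕ → Tab → Tab → List ℕ → Set where
  []  : ∀ {P} → KWord [] P P []
  _∷_ : ∀ {a P P′ x w P″ xs} → KIns a P P′ x × Good P′ → KWord w P′ P″ xs → KWord (a ∷ w) P P″ (x ∷ xs)

record InsertedWord (w : List ℕ) (P : Tab) : Set where
  constructor inserted
  field
    {tab}    : Tab
    {boxes}  : List (ℕ × ℕ)
    computes : kInsertWord w P ≡ (tab , boxes)
    related  : KWord w P tab (map proj₁ boxes)
    good     : Good tab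
    reads    : readT tab ∼ readT P ++ w

kInsertWord-∷ : ∀ {a w P P′ bx P″ bxs} → kInsert a P ≡ (P′ , bx) → kInsertWord w P′ ≡ (P″ , bxs) →
  kInsertWord (a ∷ w) P ≡ (P″ , bx ∷ bxs)
kInsertWord-∷ e f rewrite e | f = refl

insertWord : ∀ w P → Good P → Red (readT P ++ w) → InsertedWord w P
insertWord [] P g red = inserted refl [] g (≡⇒∼ (sym (++-identityʳ (readT P))))
insertWord (a ∷ w) P g red = go (insert a P g (Red-prefix _ w (subst Red eq red)))
  where
  eq : readT P ++ a ∷ w ≡ (readT P ++ a ∷ []) ++ w
  eq = sym (++-assoc (readT P) (a ∷ []) w)
  go : Inserted a P → InsertedWord (a ∷ w) P
  go (inserted {P′} e ki g′ rd) = go′ (insertWord w P′ g′ (Red-resp-∼ (symm (∼-suffix w rd)) (subst Red eq red)))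
    where
    go′ : InsertedWord w P′ → InsertedWord (a ∷ w) P
    go′ (inserted f kw g″ rd′) = inserted (kInsertWord-∷ {a} {w} {P} e f) ((ki , g′) ∷ kw) g″
      (tran rd′ (tran (∼-suffix w rd) (≡⇒∼ (sym eq))))

-- Rows of the boxes created by a unimodal word

-- What the last insertion left along its path: `a` at the end of the row where it stopped, and the
-- relation between input and output in each row above. This suffices to compare the next path with
-- it.
data Hist : Tab → ℕ → ℕ → Set where
  append : ∀ {R a Rs} R₀ → R ≡ R₀ ++ a ∷ [] → Hist (R ∷ Rs) a 1
  bump   : ∀ {R a Rs a′ x} → Rises (Down R) (Up R) a a′ → Phase R a a′ → Hist Rs a′ x → Hist (R ∷ Rs) a (suc x)

-- From a settled tableau on, decreasing letters no longer create boxes in lower rows.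
data Settled : Tab → ℕ → ℕ → Set where
  append   : ∀ {R a Rs} R₀ → R ≡ R₀ ++ a ∷ [] → Dec R → Settled (R ∷ Rs) a 1
  switched : ∀ {R a Rs a′ x} → Rises (Down R) (Up R) a a′ → Switched (Down R) (Up R) a a′ → Hist Rs a′ x →
             Settled (R ∷ Rs) a (suc x)
  normal   : ∀ {R a Rs a′ x} → Rises (Down R) (Up R) a a′ → Normal (Down R) (Up R) a a′ → Settled Rs a′ x →
             Settled (R ∷ Rs) a (suc x)
  zeroed   : ∀ {R Rs a′ x} → Rises (Down R) (Up R) 0 a′ → Hist Rs a′ x → Settled (R ∷ Rs) 0 (suc x)

Settled⇒Hist : ∀ {P a x} → Settled P a x → Hist P a x
Settled⇒Hist (append R₀ e _)   = append R₀ e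
Settled⇒Hist (switched r s h) = bump r (inj₂ (inj₁ s)) h
Settled⇒Hist (normal r s h)   = bump r (inj₁ s) (Settled⇒Hist h)
Settled⇒Hist (zeroed r h)     = bump r (inj₂ (inj₂ refl)) h

KIns-Hist : ∀ {a P P′ x} → KIns a P P′ x → Hist P′ a x
KIns-Hist new                        = append [] refl
KIns-Hist (append {R = R} _ _)       = append R refl
KIns-Hist (bump B red ki) with Bump-classify B red
... | _ , r , ph = bump r ph (KIns-Hist ki)

KIns-pos : ∀ {a P P′ x} → KIns a P P′ x → 1 ≤ x
KIns-pos new          = s≤s z≤n
KIns-pos (append _ _) = s≤s z≤n
KIns-pos (bump _ _ _) = s≤s z≤n

last-of-inc : ∀ {b I x} → Inc (b ∷ I) → (∃[ J ] b ∷ I ≡ J ++ x ∷ []) → b ≤ x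
last-of-inc p       ([] , refl)     = ≤-refl
last-of-inc (p ∷ _) (y ∷ J , refl) = <⇒≤ (All.head (All.++⁻ʳ J p))

snoc-suffix : ∀ u {y v R₀} {a : ℕ} → u ++ y ∷ v ≡ R₀ ++ a ∷ [] → ∃[ J ] y ∷ v ≡ J ++ a ∷ []
snoc-suffix []      {R₀ = R₀}    e = R₀ , e
snoc-suffix (x ∷ u) {R₀ = []}    e = ⊥-elim (snoc-cons u (∷-injectiveʳ e))
  where
  snoc-cons : ∀ u {y : ℕ} {v} → u ++ y ∷ v ≢ []
  snoc-cons []      ()
  snoc-cons (_ ∷ _) ()
snoc-suffix (x ∷ u) {R₀ = z ∷ R₀} e = snoc-suffix u (∷-injectiveʳ e)

Bump-last : ∀ {R e R′ e′ a} R₀ → Bump R e R′ e′ → R ≡ R₀ ++ a ∷ [] → e ≤ a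
Bump-last R₀ (special D I p q r s) _ = z≤n
Bump-last R₀ (general D₀ m D₁ {d} D₂ I₁ {b} I₂ E≡ dE r s t ib u db) eq =
  ≤-trans (IBump-a≤b ib) (last-of-inc (proj₁ (proj₂ (AllPairs-++⁻ I₁ s)))
    (snoc-suffix ((D₁ ++ d ∷ D₂) ++ I₁) (trans (++-assoc (D₁ ++ d ∷ D₂) I₁ (b ∷ I₂)) eq)))

up-blocks : ∀ {R e y} → Can R → Can (R ++ e ∷ []) → y ∈ Up R → ¬ (e ≤ y)
up-blocks {e = e} {y} (can D m I p q r s) c y∈ e≤y
  with ∈-∃++ (subst (λ z → y ∈ proj₂ z) (splitU-can D p q r) y∈)
... | I₁ , I₂ , refl = false≢true (unimodal-blocked I₁ p q r e≤y) (unimodal-complete c)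

Dec-snoc : ∀ R₀ {a e} → Dec (R₀ ++ a ∷ []) → e < a → Dec ((R₀ ++ a ∷ []) ++ e ∷ [])
Dec-snoc R₀ {a} {e} p e<a = AllPairs.++⁺ p ([] ∷ []) (All.map (_∷ []) (All.tabulate λ x∈ → <-≤-trans e<a (last-≤ R₀ p x∈)))

Can-Dec : ∀ {R} → Can R → Up R ≡ [] → R ≡ Down R × Dec (Down R)
Can-Dec (can D m I p q r s) e with splitU (D ++ m ∷ I) | splitU-can D {m} p q r
Can-Dec (can D m .[] p q r s) refl | _ | refl = refl , AllPairs.++⁺ p ([] ∷ []) (All.map (_∷ []) q)

switched-append-Dec : ∀ {R a a′ e} → Can R → Can (R ++ e ∷ []) → Switched (Down R) (Up R) a a′ → e < a → Dec (R ++ e ∷ [])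
switched-append-Dec cR c (inj₁ (a∈ , _)) e<a = ⊥-elim (up-blocks cR c a∈ (<⇒≤ e<a))
switched-append-Dec {R} {a} {e = e} cR c (inj₂ (D , eq , _)) e<a = go (Up R) refl
  where
  a<up : ∀ {R} → Can R → Down R ≡ D ++ a ∷ [] → All (a <_) (Up R)
  a<up (can D′ m I p q r s) eq with splitU (D′ ++ m ∷ I) | splitU-can D′ {m} p q r
  ... | _ | refl with refl ← proj₂ (∷ʳ-injective D′ D eq) = r
  go : ∀ U → Up R ≡ U → Dec (R ++ e ∷ [])
  go [] u with Can-Dec cR u
  ... | R≡ , d = subst (λ z → Dec (z ++ e ∷ [])) (sym (trans R≡ eq)) (Dec-snoc D (subst Dec eq d) e<a)
  go (y ∷ U) u = ⊥-elim (up-blocks cR c (subst (y ∈_) (sym u) (here refl))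
    (<⇒≤ (<-trans e<a (All.head (subst (All (a <_)) u (a<up cR eq))))))

append-Dec : ∀ R₀ {a e} → Can ((R₀ ++ a ∷ []) ++ e ∷ []) → e < a → Dec ((R₀ ++ a ∷ []) ++ e ∷ [])
append-Dec R₀ {a} {e} c e<a = go refl c
  where
  go : ∀ {X} → X ≡ (R₀ ++ a ∷ []) ++ e ∷ [] → Can X → Dec X
  go eq (can D m I p q r s) with initLast I
  ... | [] = AllPairs.++⁺ p ([] ∷ []) (All.map (_∷ []) q)
  ... | I′ ∷ʳ′ x with ∷ʳ-injective (D ++ m ∷ I′) (R₀ ++ a ∷ []) (trans (++-assoc D (m ∷ I′) _) eq)
  ...   | eq′ , refl with snoc-suffix D eq′
  ...     | J , eq″ = ⊥-elim (<-asym e<a (All.head (All.head (All.++⁻ʳ J (subst (All (λ y → All (y <_) (x ∷ []))) eq″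
                        (proj₂ (proj₂ (AllPairs-++⁻ (m ∷ I′) (r ∷ s)))))))))

Bump-not-Dec : ∀ {R e R′ e′} → Bump R e R′ e′ → ¬ Dec R
Bump-not-Dec B d with Bump-ascent B
... | c , a′<c , s⊆ with AllPairs-resp-⊆ s⊆ d
...   | (c<a′ ∷ []) ∷ _ = <-asym a′<c c<a′

-- A larger letter stays larger in every row that it passes. It is appended at the latest where the
-- earlier one was, for a letter that bumps is at most the last letter of its row.
ascending-step : ∀ {P a x e P′ x′} → Hist P a x → a < e → KIns e P P′ x′ → x′ ≤ x
ascending-step (append R₀ eq) a<e (append _ _)   = ≤-refl
ascending-step (append R₀ eq) a<e (bump B _ _)   = ⊥-elim (<⇒≱ a<e (Bump-last R₀ B eq))
ascending-step (bump r ph h)  a<e (append _ _)   = s≤s z≤n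
ascending-step (bump r ph h)  a<e (bump B _ ki)  = s≤s (ascending-step h (ascent-preserved r B a<e) ki)

-- Along rows that stay Normal `e` remains below the earlier letter. Either some row is switched, or
-- receives 0, below which there is no letter; or `e` reaches the row where the earlier path ended
-- and must be appended there, its box not being lower, so that this row descends.
settle : ∀ {P a x e P′ x′} → Hist P a x → e < a → KIns e P P′ x′ → x′ ≤ x → Settled P′ e x′
settle (append R₀ refl) e<a (append _ c) le = append (R₀ ++ _ ∷ []) refl (append-Dec R₀ c e<a)
settle (append R₀ eq) e<a (bump _ _ ki) (s≤s le) = ⊥-elim (<⇒≱ (KIns-pos ki) le)
settle (bump {R} r (inj₁ (a∈ , _)) h) e<a (append cR c) le = ⊥-elim (up-blocks cR c a∈ (<⇒≤ e<a))
settle (bump {R} r (inj₂ (inj₁ sw)) h) e<a (append cR c) le = append R refl (switched-append-Dec cR c sw e<a)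
settle (bump r (inj₂ (inj₂ refl)) h) () ki le
settle (bump r (inj₁ nm) h) e<a (bump B red ki) (s≤s le) with Bump-classify B red
... | _ , r′ , inj₁ nm′       = normal r′ nm′ (settle h (descent-preserved nm B e<a) ki le)
... | _ , r′ , inj₂ (inj₁ sw) = switched r′ sw (KIns-Hist ki)
... | _ , r′ , inj₂ (inj₂ refl) = zeroed r′ (KIns-Hist ki)
settle (bump r (inj₂ (inj₁ sw)) h) e<a (bump B red ki) le =
  switched (proj₁ (proj₂ (Bump-classify B red))) (proj₂ (switched-persists sw B red e<a)) (KIns-Hist ki)

-- Above the switched row descents remain descents; below it they have become ascents, where
-- `ascending-step` takes over. A decreasing row, once reached, just takes the letter.
settled-step : ∀ {P a x e P′ x′} → Settled P a x → e < a → KIns e P P′ x′ → x′ ≤ x × Settled P′ e x′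
settled-step (append R₀ refl d) e<a (append _ _)  = ≤-refl , append _ refl (Dec-snoc R₀ d e<a)
settled-step (append R₀ eq d)   e<a (bump B _ _)  = ⊥-elim (Bump-not-Dec B d)
settled-step (switched {R} r sw h) e<a (append cR c) = s≤s z≤n , append R refl (switched-append-Dec cR c sw e<a)
settled-step (switched r sw h) e<a (bump B red ki) with switched-persists sw B red e<a
... | a′<e′ , sw′ = s≤s (ascending-step h a′<e′ ki) , switched (proj₁ (proj₂ (Bump-classify B red))) sw′ (KIns-Hist ki)
settled-step (normal r (a∈ , _) h) e<a (append cR c) = ⊥-elim (up-blocks cR c a∈ (<⇒≤ e<a))
settled-step (normal r nm h) e<a (bump B red ki) with settled-step h (descent-preserved nm B e<a) ki | Bump-classify B red
... | le , h′ | _ , r′ , inj₁ nm′         = s≤s le , normal r′ nm′ h′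
... | le , h′ | _ , r′ , inj₂ (inj₁ sw)   = s≤s le , switched r′ sw (KIns-Hist ki)
... | le , h′ | _ , r′ , inj₂ (inj₂ refl) = s≤s le , zeroed r′ (KIns-Hist ki)
settled-step (zeroed r h) () ki

data Falling : ℕ → List ℕ → Set where
  []  : ∀ {x} → Falling x []
  _∷_ : ∀ {x y ys} → y ≤ x → Falling y ys → Falling x (y ∷ ys)

data Hill : ℕ → List ℕ → Set where
  []   : ∀ {x} → Hill x []
  rise : ∀ {x y ys} → x < y → Hill y ys → Hill x (y ∷ ys)
  fall : ∀ {x y ys} → y ≤ x → Falling y ys → Hill x (y ∷ ys)

falling-up : ∀ {P a x w P′ xs} → Hist P a x → Acc (up a) w → KWord w P P′ xs → Falling x xs
falling-up h _ [] = []
falling-up h (_ , rise p ∷ r) ((ki , _) ∷ kw) = ascending-step h p ki ∷ falling-up (KIns-Hist ki) (_ , r) kw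

falling-settled : ∀ {P a x w P′ xs} → Settled P a x → Acc (dn a) w → KWord w P P′ xs → Falling x xs
falling-settled h _ [] = []
falling-settled h (_ , turn p ∷ r) ((ki , _) ∷ kw) = ascending-step (Settled⇒Hist h) p ki ∷ falling-up (KIns-Hist ki) (_ , r) kw
falling-settled h (_ , down p ∷ r) ((ki , _) ∷ kw) with settled-step h p ki
... | le , h′ = le ∷ falling-settled h′ (_ , r) kw

hill : ∀ {P a x w P′ xs} → Hist P a x → Acc (dn a) w → KWord w P P′ xs → Hill x xs
hill h _ [] = []
hill h (_ , turn p ∷ r) ((ki , _) ∷ kw) = fall (ascending-step h p ki) (falling-up (KIns-Hist ki) (_ , r) kw)
hill {x = x} h (_ , down p ∷ r) (_∷_ {x = x′} (ki , _) kw) with <-≤-connex x x′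
... | inj₁ x<x′ = rise x<x′ (hill (KIns-Hist ki) (_ , r) kw)
... | inj₂ x′≤x = fall x′≤x (falling-settled (settle h p ki x′≤x) (_ , r) kw)

-- Mixed insertion

at : Tab → ℕ → ℕ → Maybe ℕ
at T i p = lookupL p (getRow i T)

put : ℕ → ℕ → ℕ → Tab → Tab
put i p z = modRow i (setL p z)

just-inj : ∀ {x y : ℕ} → just x ≡ just y → x ≡ y
just-inj refl = refl

nothing≢just : ∀ {y : ℕ} {m} → m ≡ nothing → m ≢ just y
nothing≢just refl ()

lookupL-setL : ∀ p {z u} R → lookupL p R ≡ just u → lookupL p (setL p z R) ≡ just z
lookupL-setL zero    (x ∷ R) e = refl
lookupL-setL (suc p) (x ∷ R) e = lookupL-setL p R e

lookupL-setL-≢ : ∀ p q {z} R → p ≢ q → lookupL q (setL p z R) ≡ lookupL q R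
lookupL-setL-≢ p       q       []      ne = refl
lookupL-setL-≢ zero    zero    (x ∷ R) ne = ⊥-elim (ne refl)
lookupL-setL-≢ zero    (suc q) (x ∷ R) ne = refl
lookupL-setL-≢ (suc p) zero    (x ∷ R) ne = refl
lookupL-setL-≢ (suc p) (suc q) (x ∷ R) ne = lookupL-setL-≢ p q R (λ e → ne (cong suc e))

setL-setL : ∀ p {z u} R → lookupL p R ≡ just u → setL p u (setL p z R) ≡ R
setL-setL zero    (x ∷ R) refl = refl
setL-setL (suc p) (x ∷ R) e    = cong (x ∷_) (setL-setL p R e)

setL-length : ∀ p {z} R → length (setL p z R) ≡ length R
setL-length p       []      = refl
setL-length zero    (x ∷ R) = refl
setL-length (suc p) (x ∷ R) = cong suc (setL-length p R)

getRow-put : ∀ i {p z u} T → at T i p ≡ just u → getRow i (put i p z T) ≡ setL p z (getRow i T)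
getRow-put (suc zero)    (R ∷ Rs) e = refl
getRow-put (suc (suc i)) (R ∷ Rs) e = getRow-put (suc i) Rs e

getRow-put-≢ : ∀ i k {p z} T → i ≢ k → getRow k (put i p z T) ≡ getRow k T
getRow-put-≢ i             k             []       ne = refl
getRow-put-≢ zero          k             (R ∷ Rs) ne = refl
getRow-put-≢ (suc zero)    zero          (R ∷ Rs) ne = refl
getRow-put-≢ (suc zero)    (suc zero)    (R ∷ Rs) ne = ⊥-elim (ne refl)
getRow-put-≢ (suc zero)    (suc (suc k)) (R ∷ Rs) ne = refl
getRow-put-≢ (suc (suc i)) zero          (R ∷ Rs) ne = refl
getRow-put-≢ (suc (suc i)) (suc zero)    (R ∷ Rs) ne = refl
getRow-put-≢ (suc (suc i)) (suc (suc k)) (R ∷ Rs) ne = getRow-put-≢ (suc i) (suc k) Rs (λ e → ne (cong suc e))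

at-put : ∀ i p {z u} T → at T i p ≡ just u → at (put i p z T) i p ≡ just z
at-put i p T e = trans (cong (lookupL p) (getRow-put i T e)) (lookupL-setL p (getRow i T) e)

at-put-≢ : ∀ i p {z u} k q T → at T i p ≡ just u → (i ≡ k → p ≡ q → ⊥) → at (put i p z T) k q ≡ at T k q
at-put-≢ i p k q T e ne with i ≟ k
... | no  i≢k  = cong (lookupL q) (getRow-put-≢ i k T i≢k)
... | yes refl = trans (cong (lookupL q) (getRow-put i T e)) (lookupL-setL-≢ p q (getRow i T) (ne refl))

put-put : ∀ i {p z u} T → at T i p ≡ just u → put i p u (put i p z T) ≡ T
put-put (suc zero)    {p} (R ∷ Rs) e = cong (_∷ Rs) (setL-setL p R e)
put-put (suc (suc i))     (R ∷ Rs) e = cong (R ∷_) (put-put (suc i) Rs e)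

put-lengths : ∀ i {p z} T → map length (put i p z T) ≡ map length T
put-lengths i             []       = refl
put-lengths zero          (R ∷ Rs) = refl
put-lengths (suc zero)    (R ∷ Rs) = cong (_∷ map length Rs) (setL-length _ R)
put-lengths (suc (suc i)) (R ∷ Rs) = cong (length R ∷_) (put-lengths (suc i) Rs)

rowFind-just : ∀ {x} R {p y} → rowFind x R ≡ just (p , y) → lookupL p R ≡ just y × x < y
rowFind-just {x} (z ∷ R) e with x <ᵇ z in x<z
rowFind-just {x} (z ∷ R) refl | true = refl , <ᵇ≡⇒< x z x<z
rowFind-just {x} (z ∷ R) e    | false with rowFind x R in eq
rowFind-just {x} (z ∷ R) refl | false | just (q , y) = rowFind-just R eq

rowFind-first : ∀ {u z} p R → lookupL p R ≡ just z → u < z → (∀ k w → k < p → lookupL k R ≡ just w → w ≤ u) →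
  rowFind u R ≡ just (p , z)
rowFind-first zero    (x ∷ R) refl u<z h rewrite <⇒<ᵇ≡ u<z = refl
rowFind-first {u} {z} (suc p) (x ∷ R) e    u<z h
  rewrite ≥⇒<ᵇ≡ (h 0 x (s≤s z≤n) refl) | rowFind-first {u} {z} p R e u<z (λ k w k<p e → h (suc k) w (s≤s k<p) e) = refl

rowFind-none : ∀ {u} R → (∀ k w → lookupL k R ≡ just w → w ≤ u) → rowFind u R ≡ nothing
rowFind-none []      h = refl
rowFind-none {u} (x ∷ R) h rewrite ≥⇒<ᵇ≡ (h 0 x refl) | rowFind-none {u} R (λ k w e → h (suc k) w e) = refl

colFind-bumpAt : ∀ {x j} T s {i y} → colFind x j s T ≡ bumpAt i y → ∃[ k ] i ≡ s + k × at T (suc k) (j ∸ i) ≡ just y × x < y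
colFind-bumpAt {x} {j} (R ∷ Rs) s e with j <ᵇ s | lookupL (j ∸ s) R in eq
... | false | just y with x <ᵇ y in x<y
colFind-bumpAt {x} {j} (R ∷ Rs) s refl | false | just y | true =
  0 , sym (+-identityʳ s) , eq , <ᵇ≡⇒< x y x<y
colFind-bumpAt {x} {j} (R ∷ Rs) s e | false | just y | false with colFind-bumpAt Rs (suc s) e
... | k , i≡ , a , x<y′ = suc k , trans i≡ (sym (+-suc s k)) , a , x<y′
colFind-bumpAt (R ∷ Rs) s () | false | nothing
colFind-bumpAt (R ∷ Rs) s () | true | _

hmStep-row-bump : ∀ f i x T {p y} → rowFind x (getRow i T) ≡ just (p , y) →
  hmStep (suc f) (rowM i) x T ≡ hmNext f i (i + p) y (put i p x T)
hmStep-row-bump f i x T e rewrite e = refl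

hmStep-row-append : ∀ f i x T → rowFind x (getRow i T) ≡ nothing →
  hmStep (suc f) (rowM i) x T ≡ (appendAt i x T , (i , i + length (getRow i T)))
hmStep-row-append f i x T e rewrite e = refl

hmStep-col-bump : ∀ f j x T {i y} → colFind x j 1 T ≡ bumpAt i y →
  hmStep (suc f) (colM j) x T ≡ hmNext f i j y (put i (j ∸ i) x T)
hmStep-col-bump f j x T e rewrite e = refl

hmStep-col-append : ∀ f j x T {i} → colFind x j 1 T ≡ appendRow i →
  hmStep (suc f) (colM j) x T ≡ (appendAt i x T , (i , j))
hmStep-col-append f j x T e rewrite e = refl

hmNext-diagonal : ∀ f i y T → hmNext f i i y T ≡ hmStep f (colM (suc i)) (primeOf y) T
hmNext-diagonal f i y T rewrite ≡ᵇ-refl i = refl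

hmNext-row : ∀ f {i j} y T → i ≢ j → evenB y ≡ true → hmNext f i j y T ≡ hmStep f (rowM (suc i)) y T
hmNext-row f y T ne e rewrite ≢⇒≡ᵇ ne | e = refl

hmNext-col : ∀ f {i j} y T → i ≢ j → evenB y ≡ false → hmNext f i j y T ≡ hmStep f (colM (suc j)) y T
hmNext-col f y T ne e rewrite ≢⇒≡ᵇ ne | e = refl

-- Length of bumping paths

-- Every bump lowers the number of entries larger than the travelling letter, which bounds the
-- length of a bumping path and makes the fuel irrelevant.

larger : ℕ → List ℕ → ℕ
larger x []      = 0
larger x (y ∷ R) = (if x <ᵇ y then 1 else 0) + larger x R

largerT : ℕ → Tab → ℕ
largerT x []       = 0
largerT x (R ∷ Rs) = larger x R + largerT x Rs

bit-mono : ∀ {x y} z → x ≤ y → (if y <ᵇ z then 1 else 0) ≤ (if x <ᵇ z then 1 else 0)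
bit-mono {x} {y} z x≤y with y <ᵇ z in e
... | false = z≤n
... | true rewrite <⇒<ᵇ≡ (≤-<-trans x≤y (<ᵇ≡⇒< y z e)) = ≤-refl

larger-mono : ∀ {x y} R → x ≤ y → larger y R ≤ larger x R
larger-mono []      p = z≤n
larger-mono (z ∷ R) p = +-mono-≤ (bit-mono z p) (larger-mono R p)

largerT-mono : ∀ {x y} T → x ≤ y → largerT y T ≤ largerT x T
largerT-mono []       p = z≤n
largerT-mono (R ∷ Rs) p = +-mono-≤ (larger-mono R p) (largerT-mono Rs p)

larger-setL : ∀ {x y y′} p R → lookupL p R ≡ just y → x < y → x ≤ y′ → larger y′ (setL p x R) < larger x R
larger-setL zero (y ∷ R) refl x<y x≤y′ rewrite <⇒<ᵇ≡ x<y | ≥⇒<ᵇ≡ x≤y′ = s≤s (larger-mono R x≤y′)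
larger-setL {x} (suc p) (z ∷ R) e x<y x≤y′ =
  ≤-trans (≤-reflexive (sym (+-suc _ _))) (+-mono-≤ (bit-mono z x≤y′) (larger-setL p R e x<y x≤y′))

largerT-put : ∀ {x y y′} i {p} T → at T i p ≡ just y → x < y → x ≤ y′ → largerT y′ (put i p x T) < largerT x T
largerT-put (suc zero)    {p} (R ∷ Rs) e x<y x≤y′ = +-mono-≤ (larger-setL p R e x<y x≤y′) (largerT-mono Rs x≤y′)
largerT-put (suc (suc i))     (R ∷ Rs) e x<y x≤y′ =
  ≤-trans (≤-reflexive (sym (+-suc _ _))) (+-mono-≤ (larger-mono R x≤y′) (largerT-put (suc i) Rs e x<y x≤y′))

-- A new prime lowers the code by one only, so it cannot undo the strict inequality of a bump by
-- more than equality.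
primeOf-≥ : ∀ {x} y → x < y → x ≤ primeOf y
primeOf-≥ y p with evenB y
primeOf-≥ (suc y) p | true  = ≤-pred p
primeOf-≥ y       p | false = <⇒≤ p

mutual
  hmStep-fuel : ∀ f g m x T → largerT x T < f → largerT x T < g → hmStep f m x T ≡ hmStep g m x T
  hmStep-fuel (suc f) (suc g) (rowM i) x T p q with rowFind x (getRow i T) in e
  ... | nothing      = refl
  ... | just (k , y) with rowFind-just (getRow i T) e
  ...   | a , x<y = hmNext-fuel f g i (i + k) x y T {k} a x<y p q
  hmStep-fuel (suc f) (suc g) (colM j) x T p q with colFind x j 1 T in e
  ... | appendRow i = refl
  ... | bumpAt i y with colFind-bumpAt T 1 e
  ...   | k , refl , a , x<y = hmNext-fuel f g i j x y T a x<y p q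

  hmNext-fuel : ∀ f g i j x y T {k} → at T i k ≡ just y → x < y → largerT x T < suc f → largerT x T < suc g →
    hmNext f i j y (put i k x T) ≡ hmNext g i j y (put i k x T)
  hmNext-fuel f g i j x y T {k} a x<y p q with i ≡ᵇ j
  ... | true = hmStep-fuel f g _ _ _ (shrink p) (shrink q)
    where
    shrink : ∀ {h} → largerT x T < suc h → largerT (primeOf y) (put i k x T) < h
    shrink r = ≤-trans (largerT-put i T a x<y (primeOf-≥ y x<y)) (≤-pred r)
  ... | false with evenB y
  ...   | true  = hmStep-fuel f g _ _ _ (shrink p) (shrink q)
    where
    shrink : ∀ {h} → largerT x T < suc h → largerT y (put i k x T) < h
    shrink r = ≤-trans (largerT-put i T a x<y (<⇒≤ x<y)) (≤-pred r)
  ...   | false = hmStep-fuel f g _ _ _ (shrink p) (shrink q)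
    where
    shrink : ∀ {h} → largerT x T < suc h → largerT y (put i k x T) < h
    shrink r = ≤-trans (largerT-put i T a x<y (<⇒≤ x<y)) (≤-pred r)

larger-length : ∀ x R → larger x R ≤ length R
larger-length x []      = z≤n
larger-length x (y ∷ R) with x <ᵇ y
... | true  = s≤s (larger-length x R)
... | false = ≤-trans (larger-length x R) (n≤1+n _)

largerT-size : ∀ x T → largerT x T ≤ size T
largerT-size x []       = z≤n
largerT-size x (R ∷ Rs) = +-mono-≤ (larger-length x R) (largerT-size x Rs)

enough-fuel : ∀ x T → largerT x T < 4 * (size T + 2)
enough-fuel x T = ≤-<-trans (largerT-size x T) (<-≤-trans (m<m+n (size T) (s≤s z≤n)) (m≤m+n (size T + 2) _))

-- Primed tableaux

-- Even codes are unprimed. Equality between unprimed letters in a row and between primed letters in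
-- a column is what "at most one `i′` per row and one `i` per column" leaves.
RowRel ColRel : ℕ → ℕ → Set
RowRel v w = v < w ⊎ (v ≡ w × evenB v ≡ true)
ColRel v w = v < w ⊎ (v ≡ w × evenB v ≡ false)

RowRel-≤ : ∀ {v w} → RowRel v w → v ≤ w
RowRel-≤ (inj₁ p)          = <⇒≤ p
RowRel-≤ (inj₂ (refl , _)) = ≤-refl

ColRel-≤ : ∀ {v w} → ColRel v w → v ≤ w
ColRel-≤ (inj₁ p)          = <⇒≤ p
ColRel-≤ (inj₂ (refl , _)) = ≤-refl

RowRel-< : ∀ {v w} → RowRel v w → evenB w ≡ false → v < w
RowRel-< (inj₁ p)          e = p
RowRel-< (inj₂ (refl , q)) e = ⊥-elim (false≢true e q)

ColRel-< : ∀ {v w} → ColRel v w → evenB w ≡ true → v < w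
ColRel-< (inj₁ p)          e = p
ColRel-< (inj₂ (refl , q)) e = ⊥-elim (false≢true q e)

≤⇒RowRel : ∀ {v w} → v ≤ w → evenB v ≡ true → RowRel v w
≤⇒RowRel p e with m≤n⇒m<n∨m≡n p
... | inj₁ q = inj₁ q
... | inj₂ q = inj₂ (q , e)

≤⇒ColRel : ∀ {v w} → v ≤ w → evenB v ≡ false → ColRel v w
≤⇒ColRel p e with m≤n⇒m<n∨m≡n p
... | inj₁ q = inj₁ q
... | inj₂ q = inj₂ (q , e)

even-suc-odd : ∀ v → evenB v ≡ false → evenB (suc v) ≡ true
even-suc-odd (suc zero)    e = refl
even-suc-odd (suc (suc v)) e = even-suc-odd v e

-- Primed tableaux: at T i p is the entry in row i and column i + p.
record SST (T : Tab) : Set where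
  field
    rows : ∀ i p {v w} → at T i p ≡ just v → at T i (suc p) ≡ just w → RowRel v w
    cols : ∀ i p {v w} → at T i (suc p) ≡ just v → at T (suc i) p ≡ just w → ColRel v w
    diag : ∀ i {v} → at T i 0 ≡ just v → evenB v ≡ true
    supp : ∀ i p {w} → at T (suc (suc i)) p ≡ just w → ∃[ v ] at T (suc i) (suc p) ≡ just v
    pos  : ∀ i p {v} → at T i p ≡ just v → 0 < v
open SST

at-put-cases : ∀ i p {z u} k q T {v} → at T i p ≡ just u → at (put i p z T) k q ≡ just v →
  (k ≡ i × q ≡ p × v ≡ z) ⊎ at T k q ≡ just v
at-put-cases i p k q T e f with i ≟ k | p ≟ q
... | yes refl | yes refl = inj₁ (refl , refl , just-inj (trans (sym f) (at-put i p T e)))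
... | no  ne   | _        = inj₂ (trans (sym (at-put-≢ i p k q T e (λ i≡k _ → ne i≡k))) f)
... | yes _    | no ne    = inj₂ (trans (sym (at-put-≢ i p k q T e (λ _ p≡q → ne p≡q))) f)

at-put-old : ∀ i p {z u} k q T {v} → at T i p ≡ just u → (i ≡ k → p ≡ q → ⊥) → at T k q ≡ just v → at (put i p z T) k q ≡ just v
at-put-old i p k q T e ne f = trans (at-put-≢ i p k q T e ne) f

at-put-exists : ∀ i p {z u} k q T {v} → at T i p ≡ just u → at T k q ≡ just v → ∃[ w ] at (put i p z T) k q ≡ just w
at-put-exists i p k q T e f with i ≟ k | p ≟ q
... | yes refl | yes refl = _ , at-put i p T e
... | no  ne   | _        = _ , at-put-old i p k q T e (λ i≡k _ → ne i≡k) f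
... | yes _    | no ne    = _ , at-put-old i p k q T e (λ _ p≡q → ne p≡q) f

SST-put : ∀ {T} i p {z u} → SST T → at T i p ≡ just u →
  (∀ q {l} → p ≡ suc q → at T i q ≡ just l → RowRel l z) →
  (∀ {w} → at T i (suc p) ≡ just w → RowRel z w) →
  (∀ k {t} → i ≡ suc k → at T k (suc p) ≡ just t → ColRel t z) →
  (∀ q {w} → p ≡ suc q → at T (suc i) q ≡ just w → ColRel z w) →
  (p ≡ 0 → evenB z ≡ true) → 0 < z → SST (put i p z T)
SST-put {T} i p {z} S e left right above beneath dg 0<z = record { rows = rows′ ; cols = cols′ ; diag = diag′ ; supp = supp′ ; pos = pos′ }
  where
  rows′ : ∀ k q {v w} → at (put i p z T) k q ≡ just v → at (put i p z T) k (suc q) ≡ just w → RowRel v w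
  rows′ k q f g with at-put-cases i p k q T e f | at-put-cases i p k (suc q) T e g
  ... | inj₁ (refl , refl , refl) | inj₁ (_ , () , _)
  ... | inj₁ (refl , refl , refl) | inj₂ g′ = right g′
  ... | inj₂ f′ | inj₁ (refl , refl , refl) = left q refl f′
  ... | inj₂ f′ | inj₂ g′                   = rows S k q f′ g′
  cols′ : ∀ k q {v w} → at (put i p z T) k (suc q) ≡ just v → at (put i p z T) (suc k) q ≡ just w → ColRel v w
  cols′ k q f g with at-put-cases i p k (suc q) T e f | at-put-cases i p (suc k) q T e g
  ... | inj₁ (refl , refl , refl) | inj₁ (() , _)
  ... | inj₁ (refl , refl , refl) | inj₂ g′ = beneath q refl g′
  ... | inj₂ f′ | inj₁ (refl , refl , refl) = above k refl f′
  ... | inj₂ f′ | inj₂ g′                   = cols S k q f′ g′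
  diag′ : ∀ k {v} → at (put i p z T) k 0 ≡ just v → evenB v ≡ true
  diag′ k f with at-put-cases i p k 0 T e f
  ... | inj₁ (refl , refl , refl) = dg refl
  ... | inj₂ f′                   = diag S k f′
  pos′ : ∀ k q {v} → at (put i p z T) k q ≡ just v → 0 < v
  pos′ k q f with at-put-cases i p k q T e f
  ... | inj₁ (refl , refl , refl) = 0<z
  ... | inj₂ f′                   = pos S k q f′
  supp′ : ∀ k q {w} → at (put i p z T) (suc (suc k)) q ≡ just w → ∃[ v ] at (put i p z T) (suc k) (suc q) ≡ just v
  supp′ k q f with at-put-cases i p (suc (suc k)) q T e f
  ... | inj₁ (refl , refl , refl) = let _ , g = supp S k q e in at-put-exists i p (suc k) (suc q) T e g
  ... | inj₂ f′                   = let _ , g = supp S k q f′ in at-put-exists i p (suc k) (suc q) T e g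

lookupL-before : ∀ p R {v : ℕ} → lookupL (suc p) R ≡ just v → ∃[ u ] lookupL p R ≡ just u
lookupL-before zero    (x ∷ R) e = x , refl
lookupL-before (suc p) (x ∷ R) e = lookupL-before p R e

row-before : ∀ {T} → SST T → ∀ i p k {u w} → at T i p ≡ just u → k < p → at T i k ≡ just w → w ≤ u
row-before {T} S i (suc p) k e k<p f with lookupL-before p (getRow i T) e | m≤n⇒m<n∨m≡n (≤-pred k<p)
... | v , g | inj₂ refl = subst (_≤ _) (just-inj (trans (sym g) f)) (RowRel-≤ (rows S i p g e))
... | v , g | inj₁ k<p′ = ≤-trans (row-before S i p k g k<p′ f) (RowRel-≤ (rows S i p g e))

col-above : ∀ {T} → SST T → ∀ k d p {v} → at T (suc (k + d)) p ≡ just v → ∃[ w ] at T (suc k) (p + d) ≡ just w × w ≤ v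
col-above {T} S k zero p {v} e = v , subst₂ (λ a b → at T (suc a) b ≡ just v) (+-identityʳ k) (sym (+-identityʳ p)) e , ≤-refl
col-above {T} S k (suc d) p {v} e with subst (λ a → at T (suc a) p ≡ just v) (+-suc k d) e
... | e′ with supp S (k + d) p e′
...   | t , g with col-above S k d (suc p) g
...     | w , h , w≤t = w , subst (λ b → at T (suc k) b ≡ just w) (sym (+-suc p d)) h ,
                        ≤-trans w≤t (ColRel-≤ (cols S (suc (k + d)) p g e′))

-- Row `suc k′` meets the column of the cell at offset `p` of row `suc k` at offset `p + suc d`,
-- since each row starts one column further right.
Passes : ℕ → ℕ → ℕ → Tab → Set
Passes x k p T = ∀ k′ d → k ≡ k′ + suc d → ∃[ w ] at T (suc k′) (p + suc d) ≡ just w × w ≤ x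

Passes-tail : ∀ {x k p R Rs} → Passes x (suc k) p (R ∷ Rs) → Passes x k p Rs
Passes-tail h k′ d e = h (suc k′) d (cong suc e)

monus-col : ∀ s k p → s + k + p ∸ s ≡ p + k
monus-col s k p = trans (cong (_∸ s) (+-assoc s k p)) (trans (m+n∸m≡n s (k + p)) (+-comm k p))

colFind-pass : ∀ {x j s R Rs w} → s ≤ j → lookupL (j ∸ s) R ≡ just w → w ≤ x → colFind x j s (R ∷ Rs) ≡ colFind x j (suc s) Rs
colFind-pass s≤j e w≤x rewrite ≥⇒<ᵇ≡ s≤j | e | ≥⇒<ᵇ≡ w≤x = refl

colFind-hit : ∀ {x j s R Rs w} → s ≤ j → lookupL (j ∸ s) R ≡ just w → x < w → colFind x j s (R ∷ Rs) ≡ bumpAt s w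
colFind-hit s≤j e x<w rewrite ≥⇒<ᵇ≡ s≤j | e | <⇒<ᵇ≡ x<w = refl

colFind-miss : ∀ {x j s R Rs} → s ≤ j → lookupL (j ∸ s) R ≡ nothing → colFind x j s (R ∷ Rs) ≡ appendRow s
colFind-miss s≤j e rewrite ≥⇒<ᵇ≡ s≤j | e = refl

s≤col : ∀ s k p → s ≤ s + k + p
s≤col s k p = ≤-trans (m≤m+n s k) (m≤m+n (s + k) p)

colFind-bump : ∀ T s k p {x y} → at T (suc k) p ≡ just y → x < y → Passes x k p T → colFind x (s + k + p) s T ≡ bumpAt (s + k) y
colFind-bump (R ∷ Rs) s zero p {y = y} e x<y h = trans
  (colFind-hit {R = R} {Rs = Rs} (s≤col s 0 p) (trans (cong (λ z → lookupL z R) (trans (monus-col s 0 p) (+-identityʳ p))) e) x<y)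
  (cong (λ z → bumpAt z y) (sym (+-identityʳ s)))
colFind-bump (R ∷ Rs) s (suc k) p {x} {y} e x<y h with h 0 k refl
... | w , g , w≤x = begin
  colFind x (s + suc k + p) s (R ∷ Rs)
    ≡⟨ colFind-pass {R = R} {Rs = Rs} (s≤col s (suc k) p) (trans (cong (λ z → lookupL z R) (monus-col s (suc k) p)) g) w≤x ⟩
  colFind x (s + suc k + p) (suc s) Rs   ≡⟨ cong (λ z → colFind x (z + p) (suc s) Rs) (+-suc s k) ⟩
  colFind x (suc s + k + p) (suc s) Rs   ≡⟨ colFind-bump Rs (suc s) k p e x<y (Passes-tail h) ⟩
  bumpAt (suc s + k) y                   ≡⟨ cong (λ z → bumpAt z y) (sym (+-suc s k)) ⟩
  bumpAt (s + suc k) y ∎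
  where open ≡-Reasoning

colFind-append : ∀ T s k p {x} → at T (suc k) p ≡ nothing → Passes x k p T → colFind x (s + k + p) s T ≡ appendRow (s + k)
colFind-append [] s zero p e h = cong appendRow (sym (+-identityʳ s))
colFind-append [] s (suc k) p e h with h 0 k refl
... | _ , () , _
colFind-append (R ∷ Rs) s zero p e h = trans
  (colFind-miss {R = R} {Rs = Rs} (s≤col s 0 p) (trans (cong (λ z → lookupL z R) (trans (monus-col s 0 p) (+-identityʳ p))) e))
  (cong appendRow (sym (+-identityʳ s)))
colFind-append (R ∷ Rs) s (suc k) p {x} e h with h 0 k refl
... | w , g , w≤x = begin
  colFind x (s + suc k + p) s (R ∷ Rs)
    ≡⟨ colFind-pass {R = R} {Rs = Rs} (s≤col s (suc k) p) (trans (cong (λ z → lookupL z R) (monus-col s (suc k) p)) g) w≤x ⟩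
  colFind x (s + suc k + p) (suc s) Rs   ≡⟨ cong (λ z → colFind x (z + p) (suc s) Rs) (+-suc s k) ⟩
  colFind x (suc s + k + p) (suc s) Rs   ≡⟨ colFind-append Rs (suc s) k p e (Passes-tail h) ⟩
  appendRow (suc s + k)                  ≡⟨ cong appendRow (sym (+-suc s k)) ⟩
  appendRow (s + suc k) ∎
  where open ≡-Reasoning

search-right₀ : ∀ x R {z} → x < z →
  ∃[ d ] ∃[ u ] lookupL d (x ∷ R) ≡ just u × u < z × (∀ {w} → lookupL (suc d) (x ∷ R) ≡ just w → z ≤ w)
search-right₀ x []      x<z = 0 , x , refl , x<z , λ ()
search-right₀ x (y ∷ R) {z} x<z with <-≤-connex y z
... | inj₂ z≤y = 0 , x , refl , x<z , λ { refl → z≤y }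
... | inj₁ y<z with search-right₀ y R y<z
...   | d , u , e , u<z , h = suc d , u , e , u<z , h

-- For reverse row bumping: the entry to leave is the last one below `z`.
search-right : ∀ R p {v z} → lookupL p R ≡ just v → v < z →
  ∃[ d ] ∃[ u ] lookupL (p + d) R ≡ just u × u < z × (∀ {w} → lookupL (suc (p + d)) R ≡ just w → z ≤ w)
search-right (x ∷ R) zero    refl v<z = search-right₀ x R v<z
search-right (x ∷ R) (suc p) e    v<z = search-right R p e v<z

-- For reverse column bumping: the entry to leave is the lowest one below `u`. A column is met one
-- offset earlier in each lower row, so the search ends on the diagonal at the latest.
search-down : ∀ {T} → SST T → ∀ r q {l u} → at T (suc q) r ≡ just l → l < u →
  (∀ {w} → at T (suc q) (suc r) ≡ just w → u < w) →
  ∃[ q′ ] ∃[ r′ ] ∃[ v ] q + r ≡ q′ + r′ × at T (suc q′) r′ ≡ just v × v < u ×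
    (∀ {w} → at T (suc q′) (suc r′) ≡ just w → u < w) × (∀ r″ {w} → r′ ≡ suc r″ → at T (suc (suc q′)) r″ ≡ just w → u ≤ w)
search-down S zero q e l<u h = q , 0 , _ , refl , e , l<u , h , λ _ ()
search-down {T} S (suc r) q {u = u} e l<u h with at T (suc (suc q)) r in eq
... | nothing = q , suc r , _ , refl , e , l<u , h , λ { _ refl f → ⊥-elim (nothing≢just eq f) }
... | just w with <-≤-connex w u
...   | inj₂ u≤w = q , suc r , _ , refl , e , l<u , h , λ { _ refl f → subst (u ≤_) (just-inj (trans (sym eq) f)) u≤w }
...   | inj₁ w<u with search-down S r (suc q) eq w<u right
  where
  right : ∀ {w} → at T (suc (suc q)) (suc r) ≡ just w → u < w
  right f with supp S q (suc r) f
  ... | t , g = <-≤-trans (h g) (ColRel-≤ (cols S (suc q) (suc r) g f))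
...     | q′ , r′ , v , e′ , rest = q′ , r′ , v , trans (+-suc q r) e′ , rest

-- Reverse mixed insertion

record Reached (L : List ℕ) (R : Tab × (ℕ × ℕ)) : Set where
  constructor reached
  field
    {initial} : Tab
    {input} : ℕ
    {enough} : ℕ
    valid    : SST initial
    shape    : map length initial ≡ L
    even     : evenB input ≡ true
    positive : 0 < input
    inserts  : ∀ g → enough ≤ g → hmStep g (rowM 1) input initial ≡ R

Inserts : ℕ → Mode → ℕ → Tab → Tab × (ℕ × ℕ) → Set
Inserts f m z T R = ∀ g → f ≤ g → hmStep g m z T ≡ R

monus-cell : ∀ i p → i + p ∸ i ≡ p
monus-cell i p = m+n∸m≡n i p

i≢i+1+p : ∀ i p → i ≢ i + suc p
i≢i+1+p i p e = <-irrefl e (subst (i <_) (sym (+-suc i p)) (s≤s (m≤m+n i p)))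

Inserts-row : ∀ {f T R i p u z} → at T i p ≡ just u → rowFind u (getRow i (put i p z T)) ≡ just (p , z) →
  (∀ g → f ≤ g → hmNext g i (i + p) z T ≡ R) → Inserts (suc f) (rowM i) u (put i p z T) R
Inserts-row {T = T} {i = i} {p} {u} {z} e found next (suc g) (s≤s le) = trans
  (hmStep-row-bump g i u (put i p z T) found)
  (trans (cong (hmNext g i (i + p) z) (put-put i T e)) (next g le))

Inserts-col : ∀ {f T R i p u z} → at T i p ≡ just u → colFind u (i + p) 1 (put i p z T) ≡ bumpAt i z →
  (∀ g → f ≤ g → hmNext g i (i + p) z T ≡ R) → Inserts (suc f) (colM (i + p)) u (put i p z T) R
Inserts-col {T = T} {i = i} {p} {u} {z} e found next (suc g) (s≤s le) = trans
  (hmStep-col-bump g (i + p) u (put i p z T) found)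
  (trans (cong (λ q → hmNext g i (i + p) z (put i q u (put i p z T))) (monus-cell i p))
  (trans (cong (hmNext g i (i + p) z) (put-put i T e)) (next g le)))

rowFind-put : ∀ {T i p u z} → SST T → at T i p ≡ just u → u < z → rowFind u (getRow i (put i p z T)) ≡ just (p , z)
rowFind-put {T} {i} {p} {u} {z} S e u<z = rowFind-first p (getRow i (put i p z T)) (at-put i p T e) u<z
  (λ k w k<p f → row-before S i p k e k<p (trans (sym (at-put-≢ i p {z} i k T e (λ _ p≡k → <⇒≢ k<p (sym p≡k)))) f))

colFind-put : ∀ {T i p u z} → SST T → at T (suc i) p ≡ just u → u < z →
  colFind u (suc i + p) 1 (put (suc i) p z T) ≡ bumpAt (suc i) z
colFind-put {T} {i} {p} {u} {z} S e u<z = colFind-bump (put (suc i) p z T) 1 i p (at-put (suc i) p T e) u<z passes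
  where
  passes : Passes u i p (put (suc i) p z T)
  passes k d refl with col-above S k (suc d) p e
  ... | w , f , w≤u = w , at-put-old (suc i) p (suc k) (p + suc d) T e (λ _ p≡ → m≢1+m+n p (trans p≡ (+-suc p d))) f , w≤u

mutual
  -- An unprimed traveller was bumped from the row above, off the diagonal. It is put back into the
  -- last cell there with an entry `u < z`, and `u` is the previous traveller: the input itself if
  -- unprimed in row 1, else bumped from the row above if unprimed and from the column to the left
  -- if primed. As `u < z`, the bound `n` falls.
  reverse-row : ∀ n {z i p v T R f} → z ≤ n → SST T → evenB z ≡ true → at T (suc i) (suc p) ≡ just v → v < z →
    (∀ {w} → at T (suc (suc i)) p ≡ just w → z < w) → Inserts f (rowM (suc (suc i))) z T R → Reached (map length T) R
  reverse-row zero z≤n S ev e () h F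
  reverse-row (suc n) {z} {i} {p} {v} {T} {R} {f} z≤N S ev e v<z h F
    with search-right (getRow (suc i) T) (suc p) e v<z
  ... | d , u , e′ , u<z , right = subst (λ L → Reached L R) (put-lengths (suc i) T) (go i (evenB u) refl e′ S′ refl)
    where
    q = p + d
    T′ = put (suc i) (suc q) z T
    beneath : ∀ d {w} → at T (suc (suc i)) (p + d) ≡ just w → z < w
    beneath zero    {w} f = h (subst (λ a → at T (suc (suc i)) a ≡ just w) (+-identityʳ p) f)
    beneath (suc d) {w} f = <-≤-trans (h (proj₂ (first p (suc d) f))) (row-before S (suc (suc i)) (p + suc d) p f p< (proj₂ (first p (suc d) f)))
      where
      p< : p < p + suc d
      p< = subst (p <_) (sym (+-suc p d)) (s≤s (m≤m+n p d))
      first : ∀ p d {w} → at T (suc (suc i)) (p + d) ≡ just w → ∃[ u ] at T (suc (suc i)) p ≡ just u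
      first p zero    {w} f = w , subst (λ a → at T (suc (suc i)) a ≡ just w) (+-identityʳ p) f
      first p (suc d) {w} f = first p d (proj₂ (lookupL-before (p + d) (getRow (suc (suc i)) T) (subst (λ a → at T (suc (suc i)) a ≡ just w) (+-suc p d) f)))
    S′ : SST T′
    S′ = SST-put (suc i) (suc q) S e′
      (λ { _ refl f → inj₁ (≤-<-trans (RowRel-≤ (rows S (suc i) q f e′)) u<z) })
      (λ f → ≤⇒RowRel (right f) ev)
      (λ { k refl f → inj₁ (≤-<-trans (ColRel-≤ (cols S k (suc q) f e′)) u<z) })
      (λ { _ refl f → inj₁ (beneath d f) })
      (λ ()) (≤-<-trans z≤n v<z)
    next : ∀ g → f ≤ g → hmNext g (suc i) (suc i + suc q) z T ≡ R
    next g le = trans (hmNext-row g z T (i≢i+1+p (suc i) q) ev) (F g le)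
    go : ∀ k b → i ≡ k → at T (suc k) (suc q) ≡ just u → SST (put (suc k) (suc q) z T) → evenB u ≡ b →
         Reached (map length T′) R
    go zero true refl e′ S′ eu = reached S′ refl eu (pos S (suc i) (suc q) e′) (Inserts-row e′ (rowFind-put S e′ u<z) next)
    go (suc k) true refl e′ S′ eu with supp S k (suc q) e′
    ... | t , ft = reverse-row n (≤-pred (≤-trans u<z z≤N)) S′ eu
          (at-put-old (suc i) (suc q) (suc k) (suc (suc q)) T e′ (λ ()) ft)
          (ColRel-< (cols S (suc k) (suc q) ft e′) eu)
          (λ f → subst (u <_) (just-inj (trans (sym (at-put (suc i) (suc q) T e′)) f)) u<z)
          (Inserts-row e′ (rowFind-put S e′ u<z) next)
    go k false refl e′ S′ eu with lookupL-before q (getRow (suc i) T) e′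
    ... | l , fl = reverse-col n (≤-pred (≤-trans u<z z≤N)) S′ eu
          (at-put-old (suc i) (suc q) (suc i) q T e′ (λ _ → 1+n≢n) fl)
          (RowRel-< (rows S (suc i) q fl e′) eu)
          (λ f → subst (u <_) (just-inj (trans (sym (at-put (suc i) (suc q) T e′)) f)) u<z)
          (Inserts-col e′ (colFind-put S e′ u<z) next)

  -- A primed traveller came from the column to the left: unchanged from an off-diagonal cell, or
  -- from the diagonal, where it obtained its prime. The entry displaced from that column is
  -- smaller, so `n` falls again.
  reverse-col : ∀ n {u q r l T R f} → u ≤ n → SST T → evenB u ≡ false → at T (suc q) r ≡ just l → l < u →
    (∀ {w} → at T (suc q) (suc r) ≡ just w → u < w) → Inserts f (colM (suc q + suc r)) u T R → Reached (map length T) R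
  reverse-col zero z≤n S ev e () h F
  reverse-col (suc n) {u} {q} {r} {l} {T} {R} {f} u≤n S ev e l<u h F with search-down S r q e l<u h
  ... | q′ , zero , v , qr , e′ , v<u , right , beneath =
    subst (λ L → Reached L R) (put-lengths (suc q′) T) (go q′ refl e′ S′)
    where
    -- `suc u` is `u` without its prime, as it stood on the diagonal before the bump.
    T′ = put (suc q′) 0 (suc u) T
    v<su = <-trans v<u ≤-refl
    S′ : SST T′
    S′ = SST-put (suc q′) 0 S e′ (λ _ ())
      (λ f → ≤⇒RowRel (right f) (even-suc-odd u ev))
      (λ { k refl f → inj₁ (≤-<-trans (ColRel-≤ (cols S k 0 f e′)) v<su) })
      (λ _ ()) (λ _ → even-suc-odd u ev) (s≤s z≤n)
    next : ∀ g → f ≤ g → hmNext g (suc q′) (suc q′ + 0) (suc u) T ≡ R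
    next g le = trans (cong (λ a → hmNext g (suc q′) a (suc u) T) (+-identityʳ (suc q′)))
      (trans (hmNext-diagonal g (suc q′) (suc u) T)
      (trans (cong₂ (λ a b → hmStep g (colM a) b T) colEq primeEq) (F g le)))
      where
      colEq : suc (suc q′) ≡ suc q + suc r
      colEq = cong suc (trans (cong suc (trans (sym (+-identityʳ q′)) (sym qr))) (sym (+-suc q r)))
      primeEq : primeOf (suc u) ≡ u
      primeEq rewrite even-suc-odd u ev = refl
    go : ∀ k → q′ ≡ k → at T (suc k) 0 ≡ just v → SST (put (suc k) 0 (suc u) T) → Reached (map length T′) R
    go zero refl e′ S′ = reached S′ refl (diag S 1 e′) (pos S 1 0 e′) (Inserts-row e′ (rowFind-put S e′ v<su) next)
    go (suc k) refl e′ S′ with supp S k 0 e′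
    ... | t , ft = reverse-row n (≤-pred (≤-trans v<u u≤n)) S′ (diag S (suc q′) e′)
          (at-put-old (suc q′) 0 (suc k) 1 T e′ (λ ()) ft)
          (ColRel-< (cols S (suc k) 0 ft e′) (diag S (suc q′) e′))
          (λ f → subst (v <_) (just-inj (trans (sym (at-put (suc q′) 0 T e′)) f)) v<su)
          (Inserts-row e′ (rowFind-put S e′ v<su) next)
  ... | q′ , suc r′ , v , qr , e′ , v<u , right , beneath =
    subst (λ L → Reached L R) (put-lengths (suc q′) T) (go q′ (evenB v) refl e′ S′ refl)
    where
    T′ = put (suc q′) (suc r′) u T
    S′ : SST T′
    S′ = SST-put (suc q′) (suc r′) S e′
      (λ { _ refl f → inj₁ (≤-<-trans (RowRel-≤ (rows S (suc q′) r′ f e′)) v<u) })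
      (λ f → inj₁ (right f))
      (λ { k refl f → inj₁ (≤-<-trans (ColRel-≤ (cols S k (suc r′) f e′)) v<u) })
      (λ { _ refl f → ≤⇒ColRel (beneath r′ refl f) ev })
      (λ ()) (≤-<-trans z≤n l<u)
    next : ∀ g → f ≤ g → hmNext g (suc q′) (suc q′ + suc r′) u T ≡ R
    next g le = trans (hmNext-col g u T (i≢i+1+p (suc q′) r′) ev)
      (trans (cong (λ a → hmStep g (colM a) u T) (cong suc (trans (cong suc (sym qr)) (sym (+-suc q r))))) (F g le))
    go : ∀ k b → q′ ≡ k → at T (suc k) (suc r′) ≡ just v → SST (put (suc k) (suc r′) u T) → evenB v ≡ b →
         Reached (map length T′) R
    go zero true refl e′ S′ ev′ = reached S′ refl ev′ (pos S 1 (suc r′) e′) (Inserts-row e′ (rowFind-put S e′ v<u) next)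
    go (suc k) true refl e′ S′ ev′ with supp S k (suc r′) e′
    ... | t , ft = reverse-row n (≤-pred (≤-trans v<u u≤n)) S′ ev′
          (at-put-old (suc q′) (suc r′) (suc k) (suc (suc r′)) T e′ (λ ()) ft)
          (ColRel-< (cols S (suc k) (suc r′) ft e′) ev′)
          (λ f → subst (v <_) (just-inj (trans (sym (at-put (suc q′) (suc r′) T e′)) f)) v<u)
          (Inserts-row e′ (rowFind-put S e′ v<u) next)
    go k false refl e′ S′ ev′ with lookupL-before r′ (getRow (suc q′) T) e′
    ... | l , fl = reverse-col n (≤-pred (≤-trans v<u u≤n)) S′ ev′
          (at-put-old (suc q′) (suc r′) (suc q′) r′ T e′ (λ _ → 1+n≢n) fl)
          (RowRel-< (rows S (suc q′) r′ fl e′) ev′)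
          (λ f → subst (v <_) (just-inj (trans (sym (at-put (suc q′) (suc r′) T e′)) f)) v<u)
          (Inserts-col e′ (colFind-put S e′ v<u) next)

-- Removal of the last box

-- The tableau without the last box of its last row, the box with the largest number in `Qrow`. A
-- row that becomes empty disappears.
shrink : Tab → List ℕ → Tab
shrink Ts []      = Ts
shrink Ts (y ∷ R) = Ts ++ (y ∷ R) ∷ []

shrink-∷ : ∀ S Ts R → shrink (S ∷ Ts) R ≡ S ∷ shrink Ts R
shrink-∷ S Ts []      = refl
shrink-∷ S Ts (y ∷ R) = refl

appendAt-shrink : ∀ Ts R x → appendAt (suc (length Ts)) x (shrink Ts R) ≡ Ts ++ (R ++ x ∷ []) ∷ []
appendAt-shrink []       []      x = refl
appendAt-shrink []       (y ∷ R) x = refl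
appendAt-shrink (S ∷ Ts) R       x =
  trans (cong (appendAt _ x) (shrink-∷ S Ts R)) (cong (S ∷_) (appendAt-shrink Ts R x))

getRow-end : ∀ (Ts : Tab) k → getRow (suc (length Ts + k)) Ts ≡ []
getRow-end []       k = refl
getRow-end (S ∷ Ts) k = getRow-end Ts k

getRow-last : ∀ Ts R → getRow (suc (length Ts)) (Ts ++ R ∷ []) ≡ R
getRow-last []       R = refl
getRow-last (S ∷ Ts) R = getRow-last Ts R

getRow-shrink : ∀ Ts R → getRow (suc (length Ts)) (shrink Ts R) ≡ R
getRow-shrink []       []      = refl
getRow-shrink []       (y ∷ R) = refl
getRow-shrink (S ∷ Ts) R       = trans (cong (getRow _) (shrink-∷ S Ts R)) (getRow-shrink Ts R)

getRow-other : ∀ Ts R R′ k → k ≢ suc (length Ts) → getRow k (shrink Ts R) ≡ getRow k (Ts ++ R′ ∷ [])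
getRow-other []       []      R′ zero          ne = refl
getRow-other []       (y ∷ R) R′ zero          ne = refl
getRow-other []       R       R′ (suc zero)    ne = ⊥-elim (ne refl)
getRow-other []       []      R′ (suc (suc k)) ne = refl
getRow-other []       (y ∷ R) R′ (suc (suc k)) ne = refl
getRow-other (S ∷ Ts) R       R′ zero          ne = cong (getRow 0) (shrink-∷ S Ts R)
getRow-other (S ∷ Ts) R       R′ (suc zero)    ne = cong (getRow 1) (shrink-∷ S Ts R)
getRow-other (S ∷ Ts) R       R′ (suc (suc k)) ne =
  trans (cong (getRow _) (shrink-∷ S Ts R)) (getRow-other Ts R R′ (suc k) (λ e → ne (cong suc e)))

lookupL-snoc-old : ∀ R {x : ℕ} p {v} → lookupL p R ≡ just v → lookupL p (R ++ x ∷ []) ≡ just v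
lookupL-snoc-old (y ∷ R) zero    e = e
lookupL-snoc-old (y ∷ R) (suc p) e = lookupL-snoc-old R p e

lookupL-snoc-new : ∀ R {x : ℕ} → lookupL (length R) (R ++ x ∷ []) ≡ just x
lookupL-snoc-new []      = refl
lookupL-snoc-new (y ∷ R) = lookupL-snoc-new R

lookupL-snoc-cases : ∀ R {x : ℕ} p {v} → lookupL p (R ++ x ∷ []) ≡ just v → lookupL p R ≡ just v ⊎ (p ≡ length R × v ≡ x)
lookupL-snoc-cases []      zero    refl = inj₂ (refl , refl)
lookupL-snoc-cases (y ∷ R) zero    e    = inj₁ e
lookupL-snoc-cases (y ∷ R) (suc p) e with lookupL-snoc-cases R p e
... | inj₁ f       = inj₁ f
... | inj₂ (f , g) = inj₂ (cong suc f , g)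

lookupL-< : ∀ R p {v : ℕ} → lookupL p R ≡ just v → p < length R
lookupL-< (y ∷ R) zero    e = s≤s z≤n
lookupL-< (y ∷ R) (suc p) e = s≤s (lookupL-< R p e)

lookupL-length : ∀ (R : List ℕ) → lookupL (length R) R ≡ nothing
lookupL-length []      = refl
lookupL-length (y ∷ R) = lookupL-length R

at-shrink : ∀ Ts R x k p {v} → at (shrink Ts R) k p ≡ just v → at (Ts ++ (R ++ x ∷ []) ∷ []) k p ≡ just v
at-shrink Ts R x k p e with k ≟ suc (length Ts)
... | yes refl = trans (cong (lookupL p) (getRow-last Ts _))
                       (lookupL-snoc-old R p (trans (cong (lookupL p) (sym (getRow-shrink Ts R))) e))
... | no ne    = trans (cong (lookupL p) (sym (getRow-other Ts R _ k ne))) e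

SST-shrink : ∀ Ts R x → SST (Ts ++ (R ++ x ∷ []) ∷ []) → SST (shrink Ts R)
SST-shrink Ts R x S = record
  { rows = λ i p e f → rows S i p (at-shrink Ts R x i p e) (at-shrink Ts R x i (suc p) f)
  ; cols = λ i p e f → cols S i p (at-shrink Ts R x i (suc p) e) (at-shrink Ts R x (suc i) p f)
  ; diag = λ i e → diag S i (at-shrink Ts R x i 0 e)
  ; supp = supp′
  ; pos  = λ i p e → pos S i p (at-shrink Ts R x i p e) }
  where
  supp′ : ∀ i p {w} → at (shrink Ts R) (suc (suc i)) p ≡ just w → ∃[ v ] at (shrink Ts R) (suc i) (suc p) ≡ just v
  supp′ i p e with supp S i p (at-shrink Ts R x (suc (suc i)) p e) | suc i ≟ suc (length Ts)
  ... | v , f | no ne    = v , trans (cong (lookupL (suc p)) (getRow-other Ts R _ (suc i) ne)) f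
  ... | v , f | yes refl = ⊥-elim (nothing≢just (cong (lookupL p) beyond) (at-shrink Ts R x (suc (suc i)) p e))
    where
    beyond : getRow (suc (suc (length Ts))) (Ts ++ (R ++ x ∷ []) ∷ []) ≡ []
    beyond = trans (cong (λ n → getRow (suc n) (Ts ++ (R ++ x ∷ []) ∷ []))
      (trans (+-comm 1 (length Ts)) (trans (sym (length-++ Ts)) (sym (+-identityʳ _))))) (getRow-end (Ts ++ (R ++ x ∷ []) ∷ []) 0)

-- The parity of the entry in the last box tells how the insertion ended: an unprimed entry was
-- appended to its row, a primed one to its column.
reverse : ∀ Ts R x → SST (Ts ++ (R ++ x ∷ []) ∷ []) →
  Reached (map length (shrink Ts R)) (Ts ++ (R ++ x ∷ []) ∷ [] , (suc (length Ts) , suc (length Ts) + length R))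
reverse Ts R x S = go (evenB x) refl
  where
  T = Ts ++ (R ++ x ∷ []) ∷ []
  T⁻ = shrink Ts R
  i = suc (length Ts)
  result = (T , (i , i + length R))
  S⁻ : SST T⁻
  S⁻ = SST-shrink Ts R x S
  at-x : at T i (length R) ≡ just x
  at-x = trans (cong (lookupL (length R)) (getRow-last Ts _)) (lookupL-snoc-new R)
  removed : at T⁻ i (length R) ≡ nothing
  removed = trans (cong (lookupL (length R)) (getRow-shrink Ts R)) (lookupL-length R)
  old : ∀ k {p v} → k ≢ i → at T k p ≡ just v → at T⁻ k p ≡ just v
  old k {p} ne e = trans (cong (lookupL p) (getRow-other Ts R _ k ne)) e
  none : rowFind x (getRow i T⁻) ≡ nothing
  none = trans (cong (rowFind x) (getRow-shrink Ts R)) (rowFind-none R λ k w e →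
    row-before S i (length R) k at-x (lookupL-< R k e) (trans (cong (lookupL k) (getRow-last Ts _)) (lookupL-snoc-old R k e)))
  byRow : Inserts 1 (rowM i) x T⁻ result
  byRow (suc g) _ = trans (hmStep-row-append g i x T⁻ none)
    (cong₂ (λ a b → a , (i , i + length b)) (appendAt-shrink Ts R x) (getRow-shrink Ts R))
  inRow : evenB x ≡ true → ∀ k → length Ts ≡ k → Reached (map length T⁻) result
  inRow ev zero    e = reached S⁻ refl ev (pos S i (length R) at-x) (subst (λ k → Inserts 1 (rowM (suc k)) x T⁻ result) e byRow)
  inRow ev (suc k) e with supp S k (length R) (subst (λ k → at T (suc k) (length R) ≡ just x) e at-x)
  ... | v , f = reverse-row x ≤-refl S⁻ ev
    (old (suc k) (λ eq → 1+n≢n (sym (trans (suc-injective eq) e))) f)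
    (ColRel-< (cols S (suc k) (length R) f (subst (λ k → at T (suc k) (length R) ≡ just x) e at-x)) ev)
    (λ g → ⊥-elim (nothing≢just (subst (λ k → at T⁻ (suc k) (length R) ≡ nothing) e removed) g))
    (subst (λ k → Inserts 1 (rowM (suc k)) x T⁻ result) e byRow)
  byCol : Inserts 1 (colM (i + length R)) x T⁻ result
  byCol (suc g) _ = trans (hmStep-col-append g (i + length R) x T⁻ (colFind-append T⁻ 1 (length Ts) (length R) removed passes))
    (cong (_, (i , i + length R)) (appendAt-shrink Ts R x))
    where
    passes : Passes x (length Ts) (length R) T⁻
    passes k d e with col-above S k (suc d) (length R) (subst (λ k → at T (suc k) (length R) ≡ just x) e at-x)
    ... | w , f , w≤x = w , old (suc k) (λ eq → m≢1+m+n k (trans (suc-injective eq) (trans e (+-suc k d)))) f , w≤x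
  inCol : evenB x ≡ false → ∀ r → length R ≡ r → Reached (map length T⁻) result
  inCol ev zero    e = ⊥-elim (false≢true ev (diag S i (subst (λ k → at T i k ≡ just x) e at-x)))
  inCol ev (suc r) e with lookupL-before r (getRow i T) (subst (λ k → at T i k ≡ just x) e at-x)
  ... | l , f = reverse-col x ≤-refl S⁻ ev before
    (RowRel-< (rows S i r f (subst (λ k → at T i k ≡ just x) e at-x)) ev)
    (λ g → ⊥-elim (nothing≢just (subst (λ k → at T⁻ i k ≡ nothing) e removed) g))
    (subst (λ k → Inserts 1 (colM (i + k)) x T⁻ result) e byCol)
    where
    before : at T⁻ i r ≡ just l
    before with lookupL-snoc-cases R r (trans (cong (lookupL r) (sym (getRow-last Ts _))) f)
    ... | inj₁ g        = trans (cong (lookupL r) (getRow-shrink Ts R)) g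
    ... | inj₂ (eq , _) = ⊥-elim (1+n≢n (sym (trans eq e)))
  go : ∀ b → evenB x ≡ b → Reached (map length T⁻) result
  go true  ev = inRow ev (length Ts) refl
  go false ev = inCol ev (length R) refl

hmFrom-snoc : ∀ t bs b {P Q P₁ Q₁ P₂ x y} → hmFrom t bs (P , Q) ≡ (P₁ , Q₁) →
  hmStep (4 * (size P₁ + 2)) (rowM 1) (unprimedL b) P₁ ≡ (P₂ , (x , y)) →
  hmFrom t (bs ++ b ∷ []) (P , Q) ≡ (P₂ , appendAt x (t + length bs) Q₁)
hmFrom-snoc t [] b {P} refl f with hmStep (4 * (size P + 2)) (rowM 1) (unprimedL b) P
hmFrom-snoc t [] b {P} {Q} {x = x} refl refl | _ = cong (λ n → _ , appendAt x n Q) (sym (+-identityʳ t))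
hmFrom-snoc t (c ∷ bs) b {P} {Q} {P₁} {Q₁} {P₂} {x} e f with hmStep (4 * (size P + 2)) (rowM 1) (unprimedL c) P
... | P′ , (x′ , _) = trans (hmFrom-snoc (suc t) bs b {P′} {appendAt x′ t Q} e f)
                            (cong (λ n → P₂ , appendAt x n Q₁) (sym (+-suc t (length bs))))

qrow-shrink : ∀ t Ts R x → qrowFrom t (map length (Ts ++ (R ++ x ∷ []) ∷ [])) ≡
  appendAt (suc (length Ts)) (t + size (shrink Ts R)) (qrowFrom t (map length (shrink Ts R)))
qrow-shrink t [] []      x = refl
qrow-shrink t [] (y ∷ R) x = cong (_∷ []) (begin
  map (t +_) (upTo (length (y ∷ R ++ x ∷ [])))  ≡⟨ cong (λ n → map (t +_) (upTo n)) (length-snoc (y ∷ R) x) ⟩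
  map (t +_) (upTo (suc l))                     ≡⟨ cong (map (t +_)) (sym (upTo-∷ʳ l)) ⟩
  map (t +_) (upTo l ++ l ∷ [])                 ≡⟨ map-++ (t +_) (upTo l) (l ∷ []) ⟩
  map (t +_) (upTo l) ++ (t + l) ∷ []           ≡⟨ cong (λ n → map (t +_) (upTo l) ++ (t + n) ∷ []) (sym (+-identityʳ l)) ⟩
  map (t +_) (upTo l) ++ (t + (l + 0)) ∷ [] ∎)
  where
  l = length (y ∷ R)
  open ≡-Reasoning
qrow-shrink t (S ∷ Ts) R x rewrite shrink-∷ S Ts R =
  cong (map (t +_) (upTo (length S)) ∷_) (trans (qrow-shrink (t + length S) Ts R x)
    (cong (λ n → appendAt (suc (length Ts)) n (qrowFrom (t + length S) (map length (shrink Ts R)))) (+-assoc t (length S) _)))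

size-shrink : ∀ Ts R x → size (Ts ++ (R ++ x ∷ []) ∷ []) ≡ suc (size (shrink Ts R))
size-shrink []       []      x = refl
size-shrink []       (y ∷ R) x = cong (λ n → suc (n + 0)) (length-snoc R x)
size-shrink (S ∷ Ts) R       x rewrite shrink-∷ S Ts R = trans (cong (length S +_) (size-shrink Ts R x)) (+-suc (length S) _)

half : ∀ x → evenB x ≡ true → ∃[ b ] 2 * b ≡ x
half zero          e = 0 , refl
half (suc (suc x)) e with half x e
... | b , refl = suc b , cong suc (+-suc b (b + 0))

half-pos : ∀ b → 0 < 2 * b → 0 < b
half-pos (suc b) _ = s≤s z≤n

Full : Tab → Set
Full T = All (0 <_) (map length T)

Full-shrink : ∀ Ts R x → Full (Ts ++ (R ++ x ∷ []) ∷ []) → Full (shrink Ts R)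
Full-shrink []       []      x p       = []
Full-shrink []       (y ∷ R) x p       = s≤s z≤n ∷ []
Full-shrink (S ∷ Ts) R       x (q ∷ p) = subst Full (sym (shrink-∷ S Ts R)) (q ∷ Full-shrink Ts R x p)

-- Boxes are removed against the order of `Qrow`. Positivity of the letters is returned because the
-- operator on words is analysed by the cases 1, 2 and larger.
HM-surjective : ∀ n T → size T ≡ n → SST T → Full T → ∃[ b ] HM b ≡ (T , Qrow T) × length b ≡ n × All (0 <_) b
HM-surjective n T sz S full with initLast T
HM-surjective zero _ sz S full | [] = [] , refl , refl , []
HM-surjective (suc n) _ () S full | []
HM-surjective n _ sz S full | Ts ∷ʳ′ R with initLast R
HM-surjective n _ sz S full | Ts ∷ʳ′ _ | [] with All.++⁻ʳ (map length Ts) (subst (All (0 <_)) (map-++ length Ts ([] ∷ [])) full)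
... | () ∷ _
HM-surjective n _ sz S full | Ts ∷ʳ′ _ | R ∷ʳ′ x with trans (sym sz) (size-shrink Ts R x)
HM-surjective (suc n) _ sz S full | Ts ∷ʳ′ _ | R ∷ʳ′ x | eq with reverse Ts R x S
... | reached {T₀} {x₀} {f₀} S₀ sh ev 0<x₀ ins with HM-surjective n T₀ (trans (cong sum sh) (sym (suc-injective eq))) S₀ (subst (All (0 <_)) (sym sh) (Full-shrink Ts R x full)) | half x₀ ev
...   | b , hm , len , 0<b | h , refl = b ++ h ∷ [] ,
  -- `reverse` speaks of every fuel from `f₀` on, `hmFrom` of a fixed one. The sum exceeds both `f₀`
  -- and the measure `largerT`, so the two computations agree.
  trans (hmFrom-snoc 1 b h hm (trans (hmStep-fuel _ (f₀ + suc (largerT x₀ T₀)) (rowM 1) x₀ T₀ (enough-fuel x₀ T₀) (m≤n+m _ f₀)) (ins _ (m≤m+n f₀ _))))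
    (cong (Ts ++ (R ++ x ∷ []) ∷ [] ,_) (sym (trans (qrow-shrink 1 Ts R x)
      (cong₂ (appendAt (suc (length Ts))) (cong suc (trans (sym (suc-injective eq)) (sym len))) (cong (qrowFrom 1) (sym sh)))))) ,
  trans (length-snoc b h) (cong suc len) , All.++⁺ 0<b (half-pos h 0<x₀ ∷ [])

-- The operator on words

≤4 : List ℕ → Set
≤4 = All (_≤ 4)

-- Travelling letters of code at least 4 never bump a code of at most 4. An initial segment of the
-- first row with such codes is therefore carried along, and the rest of the result depends on its
-- length alone.
record Uniform (k L : ℕ) (F : List ℕ → Tab × (ℕ × ℕ)) : Set where
  constructor uniform
  field
    {tail}  : List ℕ
    {lower} : Tab
    {box}   : ℕ × ℕ
    tail≥   : All (k ≤_) tail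
    lower≥  : All (All (k ≤_)) lower
    agrees  : ∀ pr → length pr ≡ L → ≤4 pr → F pr ≡ ((pr ++ tail) ∷ lower , box)

rowFind-prefix : ∀ {y} pr z → All (_≤ y) pr → rowFind y (pr ++ z) ≡ mapMaybe (λ q → length pr + proj₁ q , proj₂ q) (rowFind y z)
rowFind-prefix {y} [] z [] with rowFind y z
... | nothing = refl
... | just _  = refl
rowFind-prefix {y} (x ∷ pr) z (p ∷ ps) rewrite ≥⇒<ᵇ≡ p | rowFind-prefix pr z ps with rowFind y z
... | nothing = refl
... | just _  = refl

lookupL-prefix : ∀ pr p (z : List ℕ) → lookupL (length pr + p) (pr ++ z) ≡ lookupL p z
lookupL-prefix []       p z = refl
lookupL-prefix (x ∷ pr) p z = lookupL-prefix pr p z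

lookupL-in-prefix : ∀ {P : ℕ → Set} pr p (z : List ℕ) → p < length pr → All P pr → ∃[ w ] lookupL p (pr ++ z) ≡ just w × P w
lookupL-in-prefix (x ∷ pr) zero    z _       (q ∷ _)  = x , refl , q
lookupL-in-prefix (x ∷ pr) (suc p) z (s≤s l) (_ ∷ qs) = lookupL-in-prefix pr p z l qs

setL-prefix : ∀ pr p {y} (z : List ℕ) → setL (length pr + p) y (pr ++ z) ≡ pr ++ setL p y z
setL-prefix []       p z = refl
setL-prefix (x ∷ pr) p z = cong (x ∷_) (setL-prefix pr p z)

setL-All : ∀ {P : ℕ → Set} p {y} z → P y → All P z → All P (setL p y z)
setL-All p       []      py []       = []
setL-All zero    (x ∷ z) py (q ∷ qs) = py ∷ qs
setL-All (suc p) (x ∷ z) py (q ∷ qs) = q ∷ setL-All p z py qs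

put-All : ∀ {P : ℕ → Set} i {p y} T → P y → All (All P) T → All (All P) (put i p y T)
put-All i             []       py []       = []
put-All zero          (R ∷ Rs) py q        = q
put-All (suc zero)    (R ∷ Rs) py (q ∷ qs) = setL-All _ R py q ∷ qs
put-All (suc (suc i)) (R ∷ Rs) py (q ∷ qs) = q ∷ put-All (suc i) Rs py qs

appendAt-All : ∀ {P : ℕ → Set} i {y} T → P y → All (All P) T → All (All P) (appendAt i y T)
appendAt-All zero          T        py q        = q
appendAt-All (suc zero)    []       py []       = (py ∷ []) ∷ []
appendAt-All (suc zero)    (R ∷ Rs) py (q ∷ qs) = All.++⁺ q (py ∷ []) ∷ qs
appendAt-All (suc (suc i)) []       py []       = []
appendAt-All (suc (suc i)) (R ∷ Rs) py (q ∷ qs) = q ∷ appendAt-All (suc i) Rs py qs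

-- A sample prefix, from which facts that do not mention the prefix are read off. The code 0 stands
-- for no letter.
ones-list : ∀ L → ∃[ pr ] length pr ≡ L × ≤4 pr
ones-list L = replicate L 0 , length-replicate L , All.replicate⁺ L z≤n

uniform-append : ∀ {k L z rs} i y → k ≤ y → All (k ≤_) z → All (All (k ≤_)) rs → (bx : ℕ × ℕ) →
  Uniform k L (λ pr → appendAt i y ((pr ++ z) ∷ rs) , bx)
uniform-append zero          y k≤y q qs bx = uniform q qs (λ _ _ _ → refl)
uniform-append {z = z} {rs} (suc zero) y k≤y q qs bx =
  uniform (All.++⁺ q (k≤y ∷ [])) qs (λ pr _ _ → cong (λ R → R ∷ rs , bx) (++-assoc pr z (y ∷ [])))
uniform-append {rs = rs} (suc (suc i)) y k≤y q qs bx = uniform q (appendAt-All (suc i) rs k≤y qs) (λ _ _ _ → refl)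

Uniform-≡ : ∀ {k L F G} → (∀ pr → length pr ≡ L → ≤4 pr → F pr ≡ G pr) → Uniform k L G → Uniform k L F
Uniform-≡ h (uniform a b g) = uniform a b (λ pr l s → trans (h pr l s) (g pr l s))

record UniformPut (k L i p y : ℕ) (z : List ℕ) (rs : Tab) : Set where
  constructor uniform
  field
    {tail}  : List ℕ
    {lower} : Tab
    tail≥   : All (k ≤_) tail
    lower≥  : All (All (k ≤_)) lower
    agrees  : ∀ pr → length pr ≡ L → ≤4 pr → put i p y ((pr ++ z) ∷ rs) ≡ (pr ++ tail) ∷ lower

uniform-put : ∀ {k L z rs} i p {y w} → 4 ≤ y → k ≤ y → y < w → All (k ≤_) z → All (All (k ≤_)) rs →
  (∀ pr → length pr ≡ L → ≤4 pr → at ((pr ++ z) ∷ rs) i p ≡ just w) → UniformPut k L i p y z rs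
uniform-put {L = L} zero p 4≤y k≤y y<w q qs h = uniform q qs (λ _ _ _ → refl)
uniform-put {L = L} {z} {rs} (suc zero) p {y} 4≤y k≤y y<w q qs h with <-≤-connex p L | ones-list L
... | inj₁ p<L | pr , refl , s with lookupL-in-prefix pr p z p<L s
...   | w′ , e , w′≤4 with refl ← just-inj (trans (sym e) (h pr refl s)) = ⊥-elim (<⇒≱ y<w (≤-trans w′≤4 4≤y))
uniform-put {L = L} {z} {rs} (suc zero) p {y} 4≤y k≤y y<w q qs h | inj₂ L≤p | _ =
  uniform (setL-All (p ∸ L) z k≤y q) qs λ { pr refl s → cong (_∷ rs)
    (trans (cong (λ a → setL a y (pr ++ z)) (sym (m+[n∸m]≡n L≤p))) (setL-prefix pr (p ∸ L) z)) }
uniform-put {rs = rs} (suc (suc i)) p 4≤y k≤y y<w q qs h = uniform q (put-All (suc i) rs k≤y qs) (λ _ _ _ → refl)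

uniform-rowFind : ∀ {L} z rs i {y} → 4 ≤ y →
  ∃[ r ] (∀ pr → length pr ≡ L → ≤4 pr → rowFind y (getRow i ((pr ++ z) ∷ rs)) ≡ r)
uniform-rowFind z rs zero          4≤y = nothing , λ _ _ _ → refl
uniform-rowFind {L} z rs (suc zero) {y} 4≤y = mapMaybe (λ q → L + proj₁ q , proj₂ q) (rowFind y z) , λ { pr refl s → rowFind-prefix pr z (All.map (λ q → ≤-trans q 4≤y) s) }
uniform-rowFind z rs (suc (suc i)) 4≤y = _ , λ _ _ _ → refl

uniform-colFind : ∀ {L} z rs j {y} → 4 ≤ y →
  ∃[ r ] (∀ pr → length pr ≡ L → ≤4 pr → colFind y j 1 ((pr ++ z) ∷ rs) ≡ r)
uniform-colFind z rs zero 4≤y = appendRow 1 , λ _ _ _ → refl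
uniform-colFind {L} z rs (suc j) {y} 4≤y with <-≤-connex j L
... | inj₁ j<L = colFind y (suc j) 2 rs , λ pr l s → passed pr (subst (j <_) (sym l) j<L) s
  where
  passed : ∀ pr → j < length pr → ≤4 pr → colFind y (suc j) 1 ((pr ++ z) ∷ rs) ≡ colFind y (suc j) 2 rs
  passed pr j<L s with lookupL-in-prefix pr j z j<L s
  ... | w , e , w≤4 = colFind-pass {R = pr ++ z} {rs} (s≤s z≤n) e (≤-trans w≤4 4≤y)
... | inj₂ L≤j with ones-list L
...   | pr₀ , refl , _ = colFind y (suc j) 1 ((pr₀ ++ z) ∷ rs) , λ pr l s → colFind-cong (pr ++ z) (pr₀ ++ z) (trans
          (lookup-same pr (subst (_≤ j) (sym l) L≤j)) (trans (cong (λ n → lookupL (j ∸ n) z) l) (sym (lookup-same pr₀ L≤j))))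
  where
  lookup-same : ∀ pr → length pr ≤ j → lookupL j (pr ++ z) ≡ lookupL (j ∸ length pr) z
  lookup-same pr l = trans (cong (λ a → lookupL a (pr ++ z)) (sym (m+[n∸m]≡n l))) (lookupL-prefix pr _ z)
  colFind-cong : ∀ R R′ → lookupL j R ≡ lookupL j R′ → colFind y (suc j) 1 (R ∷ rs) ≡ colFind y (suc j) 1 (R′ ∷ rs)
  colFind-cong R R′ e rewrite e = refl

uniform-length : ∀ {L} z rs i → ∃[ n ] (∀ (pr : List ℕ) → length pr ≡ L → i + length (getRow i ((pr ++ z) ∷ rs)) ≡ n)
uniform-length z rs zero          = _ , λ _ _ → refl
uniform-length {L} z rs (suc zero)    = suc (L + length z) , λ { pr refl → cong suc (length-++ pr) }
uniform-length z rs (suc (suc i)) = _ , λ _ _ → refl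

mutual
  -- A bumped entry exceeds the letter that bumps it, so even with a new prime it is at least that
  -- letter. Hence the travelling letter never drops below 4 or `k`.
  hmStep-uniform : ∀ f {k L} m y z rs → 4 ≤ y → k ≤ y → All (k ≤_) z → All (All (k ≤_)) rs →
    Uniform k L (λ pr → hmStep f m y ((pr ++ z) ∷ rs))
  hmStep-uniform zero m y z rs 4≤y k≤y q qs = uniform q qs (λ _ _ _ → refl)
  hmStep-uniform (suc f) {k} {L} (rowM i) y z rs 4≤y k≤y q qs with uniform-rowFind {L} z rs i 4≤y | uniform-length {L} z rs i
  ... | nothing , h | n , len = Uniform-≡
    (λ pr l s → trans (hmStep-row-append f i y ((pr ++ z) ∷ rs) (h pr l s)) (cong (λ n → _ , (i , n)) (len pr l)))
    (uniform-append i y k≤y q qs (i , n))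
  ... | just (p , w) , h | _ = hmNext-uniform f i (i + p) y w z rs 4≤y k≤y (proj₂ (found {proj₁ (ones-list L)} (proj₂ (ones-list L)))) q qs
        (λ pr l s → proj₁ (found {pr} (l , s))) (λ pr l s → hmStep-row-bump f i y ((pr ++ z) ∷ rs) (h pr l s))
    where
    found : ∀ {pr} → length pr ≡ L × ≤4 pr → lookupL p (getRow i ((pr ++ z) ∷ rs)) ≡ just w × y < w
    found {pr} (l , s) = rowFind-just (getRow i ((pr ++ z) ∷ rs)) (h pr l s)
  hmStep-uniform (suc f) {k} {L} (colM j) y z rs 4≤y k≤y q qs with uniform-colFind {L} z rs j 4≤y
  ... | appendRow i , h = Uniform-≡ (λ pr l s → hmStep-col-append f j y ((pr ++ z) ∷ rs) (h pr l s)) (uniform-append i y k≤y q qs (i , j))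
  ... | bumpAt i w , h = hmNext-uniform f i j y w z rs 4≤y k≤y (proj₂ (found {proj₁ (ones-list L)} (proj₂ (ones-list L)))) q qs
        (λ pr l s → proj₁ (found {pr} (l , s))) (λ pr l s → hmStep-col-bump f j y ((pr ++ z) ∷ rs) (h pr l s))
    where
    found : ∀ {pr} → length pr ≡ L × ≤4 pr → at ((pr ++ z) ∷ rs) i (j ∸ i) ≡ just w × y < w
    found {pr} (l , s) with colFind-bumpAt {y} {j} ((pr ++ z) ∷ rs) 1 (h pr l s)
    ... | _ , refl , e , y<w = e , y<w

  hmNext-uniform : ∀ f {k L p F} i j y w z rs → 4 ≤ y → k ≤ y → y < w → All (k ≤_) z → All (All (k ≤_)) rs →
    (∀ pr → length pr ≡ L → ≤4 pr → at ((pr ++ z) ∷ rs) i p ≡ just w) →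
    (∀ pr → length pr ≡ L → ≤4 pr → F pr ≡ hmNext f i j w (put i p y ((pr ++ z) ∷ rs))) → Uniform k L F
  hmNext-uniform f {k} {L} {p} i j y w z rs 4≤y k≤y y<w q qs h step with uniform-put i p 4≤y k≤y y<w q qs h
  ... | uniform {z′} {rs′} q′ qs′ put≡ = Uniform-≡
    (λ pr l s → trans (step pr l s) (cong (hmNext f i j w) (put≡ pr l s)))
    (hmNext-uniform′ f i j w z′ rs′ (≤-trans 4≤y (primeOf-≥ w y<w)) (≤-trans k≤y (primeOf-≥ w y<w)) (≤-trans 4≤y (<⇒≤ y<w)) (≤-trans k≤y (<⇒≤ y<w)) q′ qs′)

  hmNext-uniform′ : ∀ f {k L} i j w z rs → 4 ≤ primeOf w → k ≤ primeOf w → 4 ≤ w → k ≤ w →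
    All (k ≤_) z → All (All (k ≤_)) rs → Uniform k L (λ pr → hmNext f i j w ((pr ++ z) ∷ rs))
  hmNext-uniform′ f i j w z rs 4≤w′ k≤w′ 4≤w k≤w q qs with i ≡ᵇ j
  ... | true = hmStep-uniform f (colM (suc j)) (primeOf w) z rs 4≤w′ k≤w′ q qs
  ... | false with evenB w
  ...   | true  = hmStep-uniform f (rowM (suc i)) w z rs 4≤w k≤w q qs
  ...   | false = hmStep-uniform f (colM (suc j)) w z rs 4≤w k≤w q qs

-- Parallel insertion of a word and its image

-- Codes 2, 3, 4 stand for 1, 2′, 2; the odd operator turns ones (suc k) into modif k.
ones modif : ℕ → List ℕ
ones n = replicate n 2
modif zero    = 4 ∷ []
modif (suc k) = ones (suc k) ++ 3 ∷ []

Big : List ℕ → Set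
Big = All (4 ≤_)

ones-≤ : ∀ n y → 2 ≤ y → All (_≤ y) (ones n)
ones-≤ n y p = All.replicate⁺ n p

ones-snoc : ∀ n z → ones n ++ 2 ∷ z ≡ ones (suc n) ++ z
ones-snoc zero    z = refl
ones-snoc (suc n) z = cong (2 ∷_) (ones-snoc n z)

modif-≤4 : ∀ k → ≤4 (modif k)
modif-≤4 zero    = ≤-refl ∷ []
modif-≤4 (suc k) = All.++⁺ (ones-≤ (suc k) 4 (s≤s (s≤s z≤n))) (s≤s (s≤s (s≤s z≤n)) ∷ [])

modif-length : ∀ k → length (modif k) ≡ suc k
modif-length zero    = refl
modif-length (suc k) = trans (length-snoc (ones (suc k)) 3) (cong suc (length-replicate (suc k)))

modif-suc : ∀ k z → ones (suc k) ++ 3 ∷ z ≡ modif (suc k) ++ z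
modif-suc k z = sym (++-assoc (ones (suc k)) (3 ∷ []) z)

rowFind-ones : ∀ n {w} z → 2 < w → rowFind 2 (ones n ++ w ∷ z) ≡ just (n + 0 , w)
rowFind-ones n {w} z p = trans (rowFind-prefix (ones n) (w ∷ z) (ones-≤ n 2 ≤-refl))
  (trans (cong (mapMaybe _) (head w p)) (cong (λ m → just (m + 0 , w)) (length-replicate n)))
  where
  head : ∀ w → 2 < w → rowFind 2 (w ∷ z) ≡ just (0 , w)
  head w p rewrite <⇒<ᵇ≡ p = refl

rowFind-ones-none : ∀ n → rowFind 2 (ones n ++ []) ≡ nothing
rowFind-ones-none zero    = refl
rowFind-ones-none (suc n) rewrite rowFind-ones-none n = refl

setL-ones : ∀ n y {w z} → setL (n + 0) y (ones n ++ w ∷ z) ≡ ones n ++ y ∷ z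
setL-ones zero    y = refl
setL-ones (suc n) y = cong (2 ∷_) (setL-ones n y)

-- Off the diagonal no prime is added, so `w = 4` goes on as 4; on the diagonal it would become 3
-- and be able to bump a prefix entry 4.
hmNext-uniform-off : ∀ f {L} k w z rs → 4 ≤ w → Big z → All Big rs →
  Uniform 4 L (λ pr → hmNext f 1 (suc (suc k)) w ((pr ++ z) ∷ rs))
hmNext-uniform-off f k w z rs p q qs with evenB w
... | true  = hmStep-uniform f (rowM 2) w z rs p p q qs
... | false = hmStep-uniform f (colM (suc (suc (suc k)))) w z rs p p q qs

ones-bump : ∀ f k {w} z rs → 4 ≤ w → hmStep (suc f) (rowM 1) 2 ((ones (suc k) ++ w ∷ z) ∷ rs) ≡
  hmNext f 1 (suc (suc k)) w ((ones (suc (suc k)) ++ z) ∷ rs)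
ones-bump f k {w} z rs p = trans
  (hmStep-row-bump f 1 2 ((ones (suc k) ++ w ∷ z) ∷ rs) (rowFind-ones (suc k) z (≤-trans (s≤s (s≤s (s≤s z≤n))) p)))
  (cong₂ (λ j R → hmNext f 1 (suc (suc j)) w (R ∷ rs)) (+-identityʳ k) (trans (setL-ones (suc k) 2 {w}) (ones-snoc (suc k) z)))

ones-append : ∀ f k rs → proj₁ (hmStep (suc f) (rowM 1) 2 ((ones (suc k) ++ []) ∷ rs)) ≡ (ones (suc (suc k)) ++ []) ∷ rs
ones-append f k rs = trans (cong proj₁ (hmStep-row-append f 1 2 ((ones (suc k) ++ []) ∷ rs) (rowFind-ones-none (suc k))))
  (cong (_∷ rs) (trans (++-assoc (ones (suc k)) [] (2 ∷ [])) (ones-snoc (suc k) [])))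

-- A 1 bumps the 2′, or on the diagonal the 2, which leaves as 2′. Both forms thus send 2′ into the
-- next column and leave only ones behind.
modif-row : ∀ f k z rs → hmStep (suc f) (rowM 1) 2 ((modif k ++ z) ∷ rs) ≡ hmStep f (colM (suc (suc k))) 3 ((ones (suc k) ++ z) ∷ rs)
modif-row f zero    z rs = refl
modif-row f (suc k) z rs = trans
  (cong (λ R → hmStep (suc f) (rowM 1) 2 (R ∷ rs)) (++-assoc (ones (suc k)) (3 ∷ []) z))
  (trans (hmStep-row-bump f 1 2 ((ones (suc k) ++ 3 ∷ z) ∷ rs) (rowFind-ones (suc k) z ≤-refl))
  (trans (cong₂ (λ j R → hmNext f 1 (suc (suc j)) 3 (R ∷ rs)) (+-identityʳ k) (trans (setL-ones (suc k) 2 {3}) (ones-snoc (suc k) z))) refl))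

lookupL-ones : ∀ n z → lookupL n (ones n ++ z) ≡ lookupL 0 z
lookupL-ones zero    z = refl
lookupL-ones (suc n) z = lookupL-ones n z

col-bump : ∀ f k {w} z rs → 4 ≤ w → hmStep (suc f) (colM (suc (suc k))) 3 ((ones (suc k) ++ w ∷ z) ∷ rs) ≡
  hmNext f 1 (suc (suc k)) w ((modif (suc k) ++ z) ∷ rs)
col-bump f k {w} z rs p = trans
  (hmStep-col-bump f (suc (suc k)) 3 ((ones (suc k) ++ w ∷ z) ∷ rs) (colFind-hit {3} {suc (suc k)} {1} {R = ones (suc k) ++ w ∷ z} {Rs = rs} (s≤s z≤n) (lookupL-ones (suc k) (w ∷ z)) p))
  (cong (λ R → hmNext f 1 (suc (suc k)) w (R ∷ rs)) (trans (cong (λ n → setL n 3 (ones (suc k) ++ w ∷ z)) (sym (+-identityʳ (suc k))))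
    (trans (setL-ones (suc k) 3 {w}) (modif-suc k z))))

col-append : ∀ f k rs → proj₁ (hmStep (suc f) (colM (suc (suc k))) 3 ((ones (suc k) ++ []) ∷ rs)) ≡ (modif (suc k) ++ []) ∷ rs
col-append f k rs = trans
  (cong proj₁ (hmStep-col-append f (suc (suc k)) 3 ((ones (suc k) ++ []) ∷ rs) (colFind-miss {3} {suc (suc k)} {1} {R = ones (suc k) ++ []} {Rs = rs} (s≤s z≤n) (lookupL-ones (suc k) []))))
  (cong (_∷ rs) (trans (++-assoc (ones (suc k)) [] (3 ∷ [])) (modif-suc k [])))

stepT : ℕ → Tab → Tab
stepT b P = proj₁ (hmStep (4 * (size P + 2)) (rowM 1) (unprimedL b) P)

stepT-fuel : ∀ b P f → size P < f → stepT b P ≡ proj₁ (hmStep f (rowM 1) (unprimedL b) P)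
stepT-fuel b P f p = cong proj₁ (hmStep-fuel (4 * (size P + 2)) f (rowM 1) (unprimedL b) P (enough-fuel _ P) (≤-<-trans (largerT-size _ P) p))

record Parallel (k : ℕ) (T T′ : Tab) : Set where
  constructor parallel
  field
    {tail}  : List ℕ
    {lower} : Tab
    tail≥   : Big tail
    lower≥  : All Big lower
    left    : T ≡ (ones (suc k) ++ tail) ∷ lower
    right   : T′ ≡ (modif k ++ tail) ∷ lower

ones-≤4 : ∀ n → ≤4 (ones n)
ones-≤4 n = ones-≤ n 4 (s≤s (s≤s z≤n))

-- In the first tableau the new 1 bumps `w` directly. In the second it displaces 2′, which bumps the
-- same `w` from the same cell by a column insertion. From there on both insertions move the same
-- letter past prefixes of equal length.
parallel-1 : ∀ k z rs → Big z → All Big rs → Parallel (suc k) (stepT 1 ((ones (suc k) ++ z) ∷ rs)) (stepT 1 ((modif k ++ z) ∷ rs))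
parallel-1 k z rs q qs = go z q
  where
  enough : ∀ m n → m < suc (m + n)
  enough m n = s≤s (m≤m+n m n)
  go : ∀ z → Big z → Parallel (suc k) (stepT 1 ((ones (suc k) ++ z) ∷ rs)) (stepT 1 ((modif k ++ z) ∷ rs))
  go [] _ = parallel [] qs
    (trans (stepT-fuel 1 ((ones (suc k) ++ []) ∷ rs) _ ≤-refl) (ones-append _ k rs))
    (trans (stepT-fuel 1 ((modif k ++ []) ∷ rs) (suc (suc (size ((modif k ++ []) ∷ rs)))) (n≤1+n _))
      (trans (cong proj₁ (modif-row _ k [] rs)) (col-append _ k rs)))
  go (w ∷ z) (p ∷ q) with hmNext-uniform-off f {suc (suc k)} k w z rs p q qs
    where f = size ((ones (suc k) ++ w ∷ z) ∷ rs) + size ((modif k ++ w ∷ z) ∷ rs)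
  ... | uniform {z′} {rs′} q′ qs′ same = parallel q′ qs′
    (trans (stepT-fuel 1 ((ones (suc k) ++ w ∷ z) ∷ rs) (suc (s₁ + s₂)) (enough s₁ s₂))
      (cong proj₁ (trans (ones-bump (s₁ + s₂) k z rs p) (same (ones (suc (suc k))) (length-replicate (suc (suc k))) (ones-≤4 (suc (suc k)))))))
    (trans (stepT-fuel 1 ((modif k ++ w ∷ z) ∷ rs) (suc (suc (s₁ + s₂))) (s≤s (≤-trans (m≤n+m s₂ s₁) (n≤1+n _))))
      (cong proj₁ (trans (modif-row _ k (w ∷ z) rs) (trans (col-bump (s₁ + s₂) k z rs p) (same (modif (suc k)) (modif-length (suc k)) (modif-≤4 (suc k)))))))
    where
    s₁ = size ((ones (suc k) ++ w ∷ z) ∷ rs)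
    s₂ = size ((modif k ++ w ∷ z) ∷ rs)

2*-mono : ∀ {m n} → m ≤ n → 2 * m ≤ 2 * n
2*-mono = *-monoʳ-≤ 2

parallel-big : ∀ b k z rs → Big z → All Big rs →
  Parallel k (stepT (suc (suc b)) ((ones (suc k) ++ z) ∷ rs)) (stepT (suc (suc b)) ((modif k ++ z) ∷ rs))
parallel-big b k z rs q qs with hmStep-uniform f {4} {suc k} (rowM 1) (unprimedL (suc (suc b))) z rs 4≤ 4≤ q qs
  where
  f = suc (size ((ones (suc k) ++ z) ∷ rs) + size ((modif k ++ z) ∷ rs))
  4≤ = 2*-mono {2} {suc (suc b)} (s≤s (s≤s z≤n))
... | uniform q′ qs′ same = parallel q′ qs′
  (trans (stepT-fuel (suc (suc b)) ((ones (suc k) ++ z) ∷ rs) _ (s≤s (m≤m+n s₁ s₂))) (cong proj₁ (same (ones (suc k)) (length-replicate (suc k)) (ones-≤4 (suc k)))))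
  (trans (stepT-fuel (suc (suc b)) ((modif k ++ z) ∷ rs) _ (s≤s (m≤n+m s₂ s₁))) (cong proj₁ (same (modif k) (modif-length k) (modif-≤4 k))))
  where
  s₁ = size ((ones (suc k) ++ z) ∷ rs)
  s₂ = size ((modif k ++ z) ∷ rs)

run : List ℕ → Tab → Tab
run []       P = P
run (b ∷ bs) P = run bs (stepT b P)

hmFrom-run : ∀ t bs P Q → proj₁ (hmFrom t bs (P , Q)) ≡ run bs P
hmFrom-run t []       P Q = refl
hmFrom-run t (b ∷ bs) P Q with hmStep (4 * (size P + 2)) (rowM 1) (unprimedL b) P
... | P′ , (x , _) = hmFrom-run (suc t) bs P′ (appendAt x t Q)

run-parallel : ∀ bs k {T T′} → All (0 <_) bs → Parallel k T T′ → ∃[ k′ ] Parallel k′ (run bs T) (run bs T′)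
run-parallel []                 k _        pr = k , pr
run-parallel (1 ∷ bs)           k (_ ∷ ps) (parallel {z} {rs} q qs refl refl) = run-parallel bs (suc k) ps (parallel-1 k z rs q qs)
run-parallel (suc (suc b) ∷ bs) k (_ ∷ ps) (parallel {z} {rs} q qs refl refl) = run-parallel bs k ps (parallel-big b k z rs q qs)

-- The forms of the first row on which the operator vanishes.
data Fixed : Tab → Set where
  empty  : Fixed []
  no-1   : ∀ {R Rs} → Big R → Fixed (R ∷ Rs)
  has-2′ : ∀ k {z Rs} → Fixed ((modif (suc k) ++ z) ∷ Rs)

-- A tableau reached after a 2 that precedes every 1 is the modified member of a parallel pair, the
-- other member coming from the word with that 2 replaced by a 1. A modified first row either
-- contains no 1 or has a 2′ behind its ones.
fixed-run : ∀ bs k z rs → All (0 <_) bs → Big z → All Big rs → Fixed (run bs ((modif k ++ z) ∷ rs))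
fixed-run bs k z rs ps q qs with run-parallel bs k ps (parallel q qs refl refl)
... | zero   , parallel q′ qs′ _ e = subst Fixed (sym e) (no-1 (≤-refl ∷ q′))
... | suc k′ , parallel q′ qs′ _ e = subst Fixed (sym e) (has-2′ k′)

Effect : List ℕ → Tab → Set
Effect bs P = (f1 bs ≡ nothing × Fixed (run bs P)) ⊎
  (∃[ bs′ ] ∃[ k ] f1 bs ≡ just bs′ × Parallel k (run bs P) (run bs′ P))

5⇒4 : ∀ {R} → All (5 ≤_) R → Big R
5⇒4 = All.map (≤-trans (n≤1+n 4))

-- Entries of code at least 5 exceed both 1 and 2, so both letters displace the same diagonal entry,
-- whose primed code is still at least 4.
first-12 : ∀ P → All (All (5 ≤_)) P → Parallel 0 (stepT 1 P) (stepT 2 P)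
first-12 []             _              = parallel [] [] refl refl
first-12 ([] ∷ Rs)      (_ ∷ q)        =
  parallel [] (All.map 5⇒4 q) (stepT-fuel 1 ([] ∷ Rs) _ ≤-refl) (stepT-fuel 2 ([] ∷ Rs) _ ≤-refl)
first-12 ((w ∷ R) ∷ Rs) ((p ∷ ps) ∷ q) with hmStep-uniform f {4} {1} (colM 2) (primeOf w) R Rs 4≤ 4≤ (5⇒4 ps) (All.map 5⇒4 q)
  where
  f = size ((w ∷ R) ∷ Rs)
  4≤ = primeOf-≥ w p
... | uniform q′ qs′ same = parallel q′ qs′
  (trans (stepT-fuel 1 ((w ∷ R) ∷ Rs) _ ≤-refl) (trans (cong proj₁ (entry 2 (≤-trans (s≤s (s≤s (s≤s z≤n))) p))) (cong proj₁ (same (2 ∷ []) refl (s≤s (s≤s z≤n) ∷ [])))))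
  (trans (stepT-fuel 2 ((w ∷ R) ∷ Rs) _ ≤-refl) (trans (cong proj₁ (entry 4 p)) (cong proj₁ (same (4 ∷ []) refl (≤-refl ∷ [])))))
  where
  f = size ((w ∷ R) ∷ Rs)
  entry : ∀ x → x < w → hmStep (suc f) (rowM 1) x ((w ∷ R) ∷ Rs) ≡ hmStep f (colM 2) (primeOf w) ((x ∷ R) ∷ Rs)
  entry x x<w = hmStep-row-bump f 1 x ((w ∷ R) ∷ Rs) (rowFind-first 0 (w ∷ R) refl x<w (λ _ _ ()))

stepT-large : ∀ b P → All (All (5 ≤_)) P → All (All (5 ≤_)) (stepT (suc (suc (suc b))) P)
stepT-large b []       _        = (5≤ ∷ []) ∷ []
  where 5≤ = ≤-trans (n≤1+n 5) (2*-mono {3} {suc (suc (suc b))} (s≤s (s≤s (s≤s z≤n))))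
stepT-large b (R ∷ Rs) (q ∷ qs) with hmStep-uniform (suc (size (R ∷ Rs))) {5} {0} (rowM 1) (unprimedL (suc (suc (suc b)))) R Rs (≤-trans (n≤1+n 4) 5≤) 5≤ q qs
  where 5≤ = ≤-trans (n≤1+n 5) (2*-mono {3} {suc (suc (suc b))} (s≤s (s≤s (s≤s z≤n))))
... | uniform q′ qs′ same = subst (All (All (5 ≤_)))
        (sym (trans (stepT-fuel (suc (suc (suc b))) (R ∷ Rs) _ ≤-refl) (cong proj₁ (same [] refl [])))) (q′ ∷ qs′)

effect : ∀ bs P → All (0 <_) bs → All (All (5 ≤_)) P → Effect bs P
effect []       []       _ _       = inj₁ (refl , empty)
effect []       (R ∷ Rs) _ (q ∷ _) = inj₁ (refl , no-1 (5⇒4 q))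
effect (1 ∷ bs) P (_ ∷ ps) q with run-parallel bs 0 ps (first-12 P q)
... | k , pr = inj₂ (2 ∷ bs , k , refl , pr)
effect (2 ∷ bs) P (_ ∷ ps) q with first-12 P q
... | parallel q′ qs′ _ e = inj₁ (refl , subst (λ T → Fixed (run bs T)) (sym e) (fixed-run bs 0 _ _ ps q′ qs′))
effect (suc (suc (suc b)) ∷ bs) P (_ ∷ ps) q with effect bs (stepT (suc (suc (suc b))) P) ps (stepT-large b P q)
... | inj₁ (e , F)           = inj₁ (cong (mapMaybe _) e , F)
... | inj₂ (bs′ , k , e , pr) = inj₂ (suc (suc (suc b)) ∷ bs′ , k , cong (mapMaybe _) e , pr)

HM-effect : ∀ b {T Q} → All (0 <_) b → HM b ≡ (T , Q) →
  (f1 b ≡ nothing × Fixed T) ⊎ (∃[ b′ ] ∃[ k ] f1 b ≡ just b′ × Parallel k T (PHM b′))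
HM-effect b p e with effect b [] p []
... | inj₁ (e₁ , F)            = inj₁ (e₁ , subst Fixed (trans (sym (hmFrom-run 1 b [] [])) (cong proj₁ e)) F)
... | inj₂ (b′ , k , e₁ , pr) = inj₂ (b′ , k , e₁ ,
        subst₂ (Parallel k) (trans (sym (hmFrom-run 1 b [] [])) (cong proj₁ e)) (sym (hmFrom-run 1 b′ [] [])) pr)

ones-unique : ∀ k k′ {z z′} → Big z → Big z′ → ones k ++ z ≡ ones k′ ++ z′ → k ≡ k′ × z ≡ z′
ones-unique zero    zero     q q′ e    = refl , e
ones-unique (suc k) (suc k′) q q′ e with ones-unique k k′ q q′ (∷-injectiveʳ e)
... | refl , e′ = refl , e′
ones-unique zero (suc k′) (s≤s (s≤s ()) ∷ _) q′ refl
ones-unique (suc k) zero  q (s≤s (s≤s ()) ∷ _) refl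

ones≢modif : ∀ k k′ {z z′} → Big z → ones k ++ z ≢ modif (suc k′) ++ z′
ones≢modif zero    k′ (s≤s (s≤s ()) ∷ _) refl
ones≢modif (suc zero) zero (s≤s (s≤s (s≤s ())) ∷ _) refl
ones≢modif (suc (suc k)) zero    q ()
ones≢modif (suc k) (suc k′) q e = ones≢modif k k′ q (∷-injectiveʳ e)

Parallel-not-Fixed : ∀ {k T T′} → Parallel k T T′ → ¬ Fixed T
Parallel-not-Fixed {k} (parallel {z} {rs} q qs refl _) F = go refl F
  where
  Big-ones : ¬ Big (ones (suc k) ++ z)
  Big-ones (s≤s (s≤s ()) ∷ _)
  go : ∀ {T} → T ≡ (ones (suc k) ++ z) ∷ rs → ¬ Fixed T
  go () empty
  go e  (no-1 b)    = Big-ones (subst Big (∷-injectiveˡ e) b)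
  go e  (has-2′ k′) = ones≢modif (suc k) k′ q (sym (∷-injectiveˡ e))

-- The first row excludes that `f1` vanishes, and it determines the number of ones, so the `k` found
-- by running the word is the given one.
f1-defined : ∀ b {k z rs Q} → All (0 <_) b → Big z → All Big rs → HM b ≡ ((ones (suc k) ++ z) ∷ rs , Q) →
  mapMaybe PHM (f1 b) ≡ just ((modif k ++ z) ∷ rs)
f1-defined b {k} p q qs e with HM-effect b p e
... | inj₁ (_ , F) = ⊥-elim (Parallel-not-Fixed {k} (parallel q qs refl refl) F)
... | inj₂ (b′ , k′ , e₁ , parallel q′ qs′ l r) with ∷-injective l
...   | l₁ , refl with ones-unique (suc k) (suc k′) q q′ l₁
...     | refl , refl = trans (cong (mapMaybe PHM) e₁) (cong just r)

f1-undefined : ∀ b {T Q} → All (0 <_) b → Fixed T → HM b ≡ (T , Q) → mapMaybe PHM (f1 b) ≡ nothing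
f1-undefined b p F e with HM-effect b p e
... | inj₁ (e₁ , _)            = cong (mapMaybe PHM) e₁
... | inj₂ (b′ , k , e₁ , pr) = ⊥-elim (Parallel-not-Fixed pr F)

-- The recording tableau

record Semi (T : Tab) : Set where
  field
    rows : ∀ i p {v w} → at T i p ≡ just v → at T i (suc p) ≡ just w → RowRel v w
    cols : ∀ i p {v w} → at T i (suc p) ≡ just v → at T (suc i) p ≡ just w → ColRel v w
    supp : ∀ i p {w} → at T (suc (suc i)) p ≡ just w → ∃[ v ] at T (suc i) (suc p) ≡ just v
    pos  : ∀ i p {v} → at T i p ≡ just v → 0 < v

evenUp : ℕ → ℕ
evenUp x = if evenB x then x else suc x

evenUp-of-even : ∀ v → evenB v ≡ true → evenUp v ≡ v
evenUp-of-even v e rewrite e = refl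

evenUp-of-odd : ∀ v → evenB v ≡ false → evenUp v ≡ suc v
evenUp-of-odd v e rewrite e = refl

evenUp-even : ∀ v → evenB (evenUp v) ≡ true
evenUp-even v with evenB v in e
... | true  = e
... | false = even-suc-odd v e

evenUp-≥ : ∀ v → v ≤ evenUp v
evenUp-≥ v with evenB v
... | true  = ≤-refl
... | false = n≤1+n v

RowRel-evenUp : ∀ {v w} → RowRel v w → RowRel (evenUp v) w
RowRel-evenUp {v} {w} r = go (evenB v) refl r
  where
  go : ∀ b → evenB v ≡ b → RowRel v w → RowRel (evenUp v) w
  go true  e r              = subst (λ u → RowRel u w) (sym (evenUp-of-even v e)) r
  go false e (inj₁ p)       = ≤⇒RowRel (subst (_≤ w) (sym (evenUp-of-odd v e)) p) (evenUp-even v)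
  go false e (inj₂ (_ , q)) = ⊥-elim (false≢true e q)

ColRel-evenUp : ∀ {v w} → ColRel v w → ColRel v (evenUp w)
ColRel-evenUp {v} {w} r with evenB w
... | true  = r
... | false = inj₁ (s≤s (ColRel-≤ r))

getRow-DPR : ∀ i T → getRow i (DPR T) ≡ dprRow (getRow i T)
getRow-DPR i             []       = refl
getRow-DPR zero          (R ∷ Rs) = refl
getRow-DPR (suc zero)    (R ∷ Rs) = refl
getRow-DPR (suc (suc i)) (R ∷ Rs) = getRow-DPR (suc i) Rs

at-DPR-suc : ∀ i p T → at (DPR T) i (suc p) ≡ at T i (suc p)
at-DPR-suc i p T rewrite getRow-DPR i T with getRow i T
... | []    = refl
... | x ∷ R = refl

at-DPR-0 : ∀ i T {v} → at (DPR T) i 0 ≡ just v → ∃[ u ] at T i 0 ≡ just u × v ≡ evenUp u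
at-DPR-0 i T e rewrite getRow-DPR i T with getRow i T
at-DPR-0 i T refl | x ∷ R = x , refl , refl

-- Removing a prime raises a diagonal entry by one. Its right neighbour is strictly larger, a primed
-- letter not being repeated in a row, and a diagonal cell is the lowest of its column.
Semi⇒SST : ∀ {T} → Semi T → SST (DPR T)
Semi⇒SST {T} S = record { rows = rows′ ; cols = cols′ ; diag = diag′ ; supp = supp′ ; pos = pos′ }
  where
  old : ∀ {i p v} → at (DPR T) i (suc p) ≡ just v → at T i (suc p) ≡ just v
  old {i} {p} e = trans (sym (at-DPR-suc i p T)) e
  rows′ : ∀ i p {v w} → at (DPR T) i p ≡ just v → at (DPR T) i (suc p) ≡ just w → RowRel v w
  rows′ i zero e f with at-DPR-0 i T e
  ... | u , g , refl = RowRel-evenUp (Semi.rows S i 0 g (old f))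
  rows′ i (suc p) e f = Semi.rows S i (suc p) (old e) (old f)
  cols′ : ∀ i p {v w} → at (DPR T) i (suc p) ≡ just v → at (DPR T) (suc i) p ≡ just w → ColRel v w
  cols′ i zero e f with at-DPR-0 (suc i) T f
  ... | u , g , refl = ColRel-evenUp (Semi.cols S i 0 (old e) g)
  cols′ i (suc p) e f = Semi.cols S i (suc p) (old e) (old f)
  diag′ : ∀ i {v} → at (DPR T) i 0 ≡ just v → evenB v ≡ true
  diag′ i e with at-DPR-0 i T e
  ... | u , g , refl = evenUp-even u
  supp′ : ∀ i p {w} → at (DPR T) (suc (suc i)) p ≡ just w → ∃[ v ] at (DPR T) (suc i) (suc p) ≡ just v
  supp′ i zero e with at-DPR-0 (suc (suc i)) T e
  ... | u , g , _ = let v , h = Semi.supp S i 0 g in v , trans (at-DPR-suc (suc i) 0 T) h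
  supp′ i (suc p) e = let v , h = Semi.supp S i (suc p) (old e) in v , trans (at-DPR-suc (suc i) (suc p) T) h
  pos′ : ∀ i p {v} → at (DPR T) i p ≡ just v → 0 < v
  pos′ i zero e with at-DPR-0 i T e
  ... | u , g , refl = <-≤-trans (Semi.pos S i 0 g) (evenUp-≥ u)
  pos′ i (suc p) e = Semi.pos S i (suc p) (old e)

getRow-appendAt : ∀ i v T → 1 ≤ i → i ≤ suc (length T) → getRow i (appendAt i v T) ≡ getRow i T ++ v ∷ []
getRow-appendAt (suc zero)    v []       _ _       = refl
getRow-appendAt (suc zero)    v (R ∷ Rs) _ _       = refl
getRow-appendAt (suc (suc i)) v []       _ (s≤s ())
getRow-appendAt (suc (suc i)) v (R ∷ Rs) _ (s≤s p) = getRow-appendAt (suc i) v Rs (s≤s z≤n) p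

getRow-appendAt-≢ : ∀ i k v T → k ≢ i → getRow k (appendAt i v T) ≡ getRow k T
getRow-appendAt-≢ zero          k             v T        ne = refl
getRow-appendAt-≢ (suc zero)    zero          v []       ne = refl
getRow-appendAt-≢ (suc zero)    (suc zero)    v []       ne = ⊥-elim (ne refl)
getRow-appendAt-≢ (suc zero)    (suc (suc k)) v []       ne = refl
getRow-appendAt-≢ (suc zero)    zero          v (R ∷ Rs) ne = refl
getRow-appendAt-≢ (suc zero)    (suc zero)    v (R ∷ Rs) ne = ⊥-elim (ne refl)
getRow-appendAt-≢ (suc zero)    (suc (suc k)) v (R ∷ Rs) ne = refl
getRow-appendAt-≢ (suc (suc i)) k             v []       ne = refl
getRow-appendAt-≢ (suc (suc i)) zero          v (R ∷ Rs) ne = refl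
getRow-appendAt-≢ (suc (suc i)) (suc zero)    v (R ∷ Rs) ne = refl
getRow-appendAt-≢ (suc (suc i)) (suc (suc k)) v (R ∷ Rs) ne = getRow-appendAt-≢ (suc i) (suc k) v Rs (λ e → ne (cong suc e))

-- Boxes that keep the shape shifted

rowLen : ℕ → Tab → ℕ
rowLen i T = length (getRow i T)

record Addable (i : ℕ) (T : Tab) : Set where
  constructor addable
  field
    1≤i     : 1 ≤ i
    i≤      : i ≤ suc (length T)
    support : ∀ k → i ≡ suc (suc k) → ∃[ t ] at T (suc k) (suc (rowLen i T)) ≡ just t

at-append-cases : ∀ i v T k p {w} → 1 ≤ i → i ≤ suc (length T) → at (appendAt i v T) k p ≡ just w →
  at T k p ≡ just w ⊎ (k ≡ i × p ≡ rowLen i T × w ≡ v)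
at-append-cases i v T k p l u e with k ≟ i
... | no ne = inj₁ (trans (cong (lookupL p) (sym (getRow-appendAt-≢ i k v T ne))) e)
... | yes refl with lookupL-snoc-cases (getRow i T) p (trans (cong (lookupL p) (sym (getRow-appendAt i v T l u))) e)
...   | inj₁ f       = inj₁ f
...   | inj₂ (f , g) = inj₂ (refl , f , g)

at-append-old : ∀ i v T k p {w} → 1 ≤ i → i ≤ suc (length T) → at T k p ≡ just w → at (appendAt i v T) k p ≡ just w
at-append-old i v T k p l u e with k ≟ i
... | no ne    = trans (cong (lookupL p) (getRow-appendAt-≢ i k v T ne)) e
... | yes refl = trans (cong (lookupL p) (getRow-appendAt i v T l u)) (lookupL-snoc-old (getRow i T) p e)

Semi-append : ∀ {T} i v → Semi T → Addable i T → 0 < v →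
  (∀ q {w} → at T i q ≡ just w → RowRel w v) →
  (∀ k q {t} → i ≡ suc k → at T k q ≡ just t → ColRel t v) → Semi (appendAt i v T)
Semi-append {T} i v S (addable l u sup) 0<v left above = record { rows = rows′ ; cols = cols′ ; supp = supp′ ; pos = pos′ }
  where
  cases : ∀ k p {w} → at (appendAt i v T) k p ≡ just w → at T k p ≡ just w ⊎ (k ≡ i × p ≡ rowLen i T × w ≡ v)
  cases k p = at-append-cases i v T k p l u
  beyond : ∀ {w p} → p ≡ rowLen i T → ¬ (at T i p ≡ just w)
  beyond refl e = nothing≢just (lookupL-length (getRow i T)) e
  rows′ : ∀ k p {x y} → at (appendAt i v T) k p ≡ just x → at (appendAt i v T) k (suc p) ≡ just y → RowRel x y
  rows′ k p e f with cases k p e | cases k (suc p) f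
  ... | inj₁ e′ | inj₁ f′ = Semi.rows S k p e′ f′
  ... | inj₁ e′ | inj₂ (refl , _ , refl) = left p e′
  ... | inj₂ (refl , eq , _) | inj₁ f′ = ⊥-elim (<-irrefl refl (<-trans (lookupL-< (getRow i T) (suc p) f′) (subst (_< suc p) eq ≤-refl)))
  ... | inj₂ (refl , eq , _) | inj₂ (_ , eq′ , _) = ⊥-elim (1+n≢n (trans eq′ (sym eq)))
  cols′ : ∀ k p {x y} → at (appendAt i v T) k (suc p) ≡ just x → at (appendAt i v T) (suc k) p ≡ just y → ColRel x y
  cols′ k p e f with cases k (suc p) e | cases (suc k) p f
  ... | inj₁ e′ | inj₁ f′ = Semi.cols S k p e′ f′
  ... | inj₁ e′ | inj₂ (eq , _ , refl) = above k (suc p) (sym eq) e′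
  ... | inj₂ (refl , _ , _) | inj₂ (eq , _ , _) = ⊥-elim (1+n≢n eq)
  cols′ (suc k) p e f | inj₂ (refl , eq , _) | inj₁ f′ = ⊥-elim (beyond eq (proj₂ (Semi.supp S k p f′)))
  cols′ zero    p e f | inj₂ (refl , eq , _) | inj₁ f′ = ⊥-elim (n≮0 l)
  supp′ : ∀ k p {w} → at (appendAt i v T) (suc (suc k)) p ≡ just w → ∃[ t ] at (appendAt i v T) (suc k) (suc p) ≡ just t
  supp′ k p e with cases (suc (suc k)) p e
  ... | inj₁ e′ = let t , g = Semi.supp S k p e′ in t , at-append-old i v T (suc k) (suc p) l u g
  ... | inj₂ (refl , refl , _) = let t , g = sup k refl in t , at-append-old i v T (suc k) (suc (rowLen i T)) l u g
  pos′ : ∀ k p {w} → at (appendAt i v T) k p ≡ just w → 0 < w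
  pos′ k p e with cases k p e
  ... | inj₁ e′ = Semi.pos S k p e′
  ... | inj₂ (_ , _ , refl) = 0<v

-- Quantified over the labels, since whether a box can be added depends only on the shape.
data Adds : List ℕ → Tab → Set where
  []  : ∀ {T} → Adds [] T
  _∷_ : ∀ {x xs T} → Addable x T → (∀ v → Adds xs (appendAt x v T)) → Adds (x ∷ xs) T

rowLen-cong : ∀ i T P → map length T ≡ map length P → rowLen i T ≡ rowLen i P
rowLen-cong i             []       []       e = refl
rowLen-cong zero          (R ∷ Rs) (S ∷ Ss) e = refl
rowLen-cong (suc zero)    (R ∷ Rs) (S ∷ Ss) e = ∷-injectiveˡ e
rowLen-cong (suc (suc i)) (R ∷ Rs) (S ∷ Ss) e = rowLen-cong (suc i) Rs Ss (∷-injectiveʳ e)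

KIns-row : ∀ {a P P′ x} → KIns a P P′ x → 1 ≤ x × x ≤ suc (length P)
KIns-row new           = s≤s z≤n , s≤s z≤n
KIns-row (append _ _)  = s≤s z≤n , s≤s z≤n
KIns-row (bump _ _ ki) = s≤s z≤n , s≤s (proj₂ (KIns-row ki))

KIns-lengths : ∀ {a P P′ x} T v → KIns a P P′ x → map length T ≡ map length P → map length (appendAt x v T) ≡ map length P′
KIns-lengths [] v new e = refl
KIns-lengths (S ∷ T) v (append {a} {R} _ _) e = cong₂ _∷_
  (trans (length-snoc S v) (trans (cong suc (∷-injectiveˡ e)) (sym (length-snoc R a)))) (∷-injectiveʳ e)
KIns-lengths (S ∷ T) v (bump B _ ki) e with KIns-row ki
KIns-lengths (S ∷ T) v (bump {x = suc x} B _ ki) e | _ =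
  cong₂ _∷_ (trans (∷-injectiveˡ e) (sym (Bump-length B))) (KIns-lengths T v ki (∷-injectiveʳ e))
KIns-lengths (S ∷ T) v (bump {x = zero} B _ ki) e | () , _

Good-strict : ∀ {P} → Good P → ∀ k → 0 < rowLen (suc (suc k)) P → rowLen (suc (suc k)) P < rowLen (suc k) P
Good-strict (cons {R} {[]} cR _ lt g) zero p = ⊥-elim (n≮0 p)
Good-strict (cons {R} {Q ∷ Rs} cR _ lt g) zero p = lt
Good-strict (cons cR _ lt g) (suc k) p = Good-strict g k p

lookupL-exists : ∀ p (R : List ℕ) → p < length R → ∃[ v ] lookupL p R ≡ just v
lookupL-exists zero    (x ∷ R) _       = x , refl
lookupL-exists (suc p) (x ∷ R) (s≤s l) = lookupL-exists p R l

-- Read off after the insertion: the row above is strictly longer than the row that has grown, and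
-- it has not grown itself.
KIns-Addable : ∀ {a P P′ x T} → KIns a P P′ x → Good P′ → map length T ≡ map length P → Addable x T
KIns-Addable {P = P} {P′} {x} {T} ki g e = addable (proj₁ r) i≤ sup
  where
  r = KIns-row ki
  i≤ : x ≤ suc (length T)
  i≤ = subst (λ n → x ≤ suc n) (trans (sym (length-map length P)) (trans (cong length (sym e)) (length-map length T))) (proj₂ r)
  sup : ∀ k → x ≡ suc (suc k) → ∃[ t ] at T (suc k) (suc (rowLen x T)) ≡ just t
  sup k refl = lookupL-exists _ (getRow (suc k) T) (subst₂ _<_ len-x len-k (Good-strict g k (subst (0 <_) (sym len-x) (s≤s z≤n))))
    where
    len-x : rowLen x P′ ≡ suc (rowLen x T)
    len-x = trans (sym (rowLen-cong x (appendAt x 0 T) P′ (KIns-lengths T 0 ki e)))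
      (trans (cong length (getRow-appendAt x 0 T (proj₁ r) i≤)) (length-snoc (getRow x T) 0))
    len-k : rowLen (suc k) P′ ≡ rowLen (suc k) T
    len-k = trans (sym (rowLen-cong (suc k) (appendAt x 0 T) P′ (KIns-lengths T 0 ki e)))
      (cong length (getRow-appendAt-≢ x (suc k) 0 T (λ ())))

KWord-Adds : ∀ {w P P′ xs T} → KWord w P P′ xs → map length T ≡ map length P → Adds xs T
KWord-Adds [] e = []
KWord-Adds {T = T} ((ki , g) ∷ kw) e = KIns-Addable ki g e ∷ λ v → KWord-Adds kw (KIns-lengths T v ki e)

fillT-lengths : ∀ i s k j bs {w P P′ T} → KWord w P P′ (map proj₁ bs) → map length T ≡ map length P →
  map length (fillT i s k j bs T) ≡ map length P′
fillT-lengths i s k j [] [] e = e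
fillT-lengths i s k j ((x , y) ∷ bs) {T = T} ((ki , _) ∷ kw) e = fillT-lengths i s k (suc j) bs kw (KIns-lengths T _ ki e)

-- Labels along a hill

-- Before (After) the turn of the hill formed by the rows of the boxes.
Rising Sinking : ℕ → ℕ → Tab → Set
Rising i x T = ∀ k p {v} → at T k p ≡ just v → v ≤ suc (2 * i) × (x < k → v ≤ 2 * i)
Sinking i x T = ∀ k p {v} → at T k p ≡ just v → v ≤ suc (suc (2 * i)) × (k < x → v ≤ suc (2 * i))

Below : ℕ → Tab → Set
Below n T = ∀ k p {v} → at T k p ≡ just v → v ≤ n

even-2* : ∀ i → evenB (2 * i) ≡ true
even-2* zero    = refl
even-2* (suc i) = trans (cong (λ n → evenB (suc n)) (+-suc i (i + 0))) (even-2* i)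

odd-2* : ∀ i → evenB (suc (2 * i)) ≡ false
odd-2* zero    = refl
odd-2* (suc i) = trans (cong (λ n → evenB (suc (suc n))) (+-suc i (i + 0))) (odd-2* i)

unprimed-suc : ∀ i → unprimedL (suc i) ≡ suc (suc (2 * i))
unprimed-suc i = cong suc (+-suc i (i + 0))

primed-suc : ∀ i → primedL (suc i) ≡ suc (2 * i)
primed-suc i = +-suc i (i + 0)

≤⇒RowRelʳ : ∀ {v w} → v ≤ w → evenB w ≡ true → RowRel v w
≤⇒RowRelʳ p e with m≤n⇒m<n∨m≡n p
... | inj₁ q    = inj₁ q
... | inj₂ refl = inj₂ (refl , e)

≤⇒ColRelʳ : ∀ {v w} → v ≤ w → evenB w ≡ false → ColRel v w
≤⇒ColRelʳ p e with m≤n⇒m<n∨m≡n p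
... | inj₁ q    = inj₁ q
... | inj₂ refl = inj₂ (refl , e)

-- The new box lies in a lower row than all earlier boxes of this factor, so its row holds no primed
-- copy yet; in columns primed copies may repeat.
rise-primed : ∀ {i x y T} → Semi T → Rising i x T → x < y → Addable y T →
  Semi (appendAt y (suc (2 * i)) T) × Rising i y (appendAt y (suc (2 * i)) T)
rise-primed {i} {x} {y} {T} S h x<y ad@(addable l u _) =
  Semi-append y (suc (2 * i)) S ad (s≤s z≤n) (λ q e → inj₁ (s≤s (proj₂ (h y q e) x<y)))
    (λ k q _ e → ≤⇒ColRelʳ (proj₁ (h k q e)) (odd-2* i)) , h′
  where
  h′ : Rising i y (appendAt y (suc (2 * i)) T)
  h′ k p e with at-append-cases y _ T k p l u e
  ... | inj₁ e′              = proj₁ (h k p e′) , λ y<k → proj₂ (h k p e′) (<-trans x<y y<k)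
  ... | inj₂ (refl , _ , refl) = ≤-refl , λ y<y → ⊥-elim (<-irrefl refl y<y)

turn-unprimed : ∀ {i x y T} → Semi T → Rising i x T → x < y → Addable y T →
  Semi (appendAt y (suc (suc (2 * i))) T) × Sinking i y (appendAt y (suc (suc (2 * i))) T)
turn-unprimed {i} {x} {y} {T} S h x<y ad@(addable l u _) =
  Semi-append y (suc (suc (2 * i))) S ad (s≤s z≤n) (λ q e → inj₁ (s≤s (≤-trans (proj₂ (h y q e) x<y) (n≤1+n _))))
    (λ k q _ e → inj₁ (s≤s (proj₁ (h k q e)))) , h′
  where
  h′ : Sinking i y (appendAt y (suc (suc (2 * i))) T)
  h′ k p e with at-append-cases y _ T k p l u e
  ... | inj₁ e′              = ≤-trans (proj₁ (h k p e′)) (n≤1+n _) , λ _ → proj₁ (h k p e′)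
  ... | inj₂ (refl , _ , refl) = ≤-refl , λ y<y → ⊥-elim (<-irrefl refl y<y)

Rising⇒Sinking : ∀ {i x T} → Rising i x T → Sinking i x T
Rising⇒Sinking h k p e = ≤-trans (proj₁ (h k p e)) (n≤1+n _) , λ _ → proj₁ (h k p e)

-- Rows above `x` hold no unprimed copy, so none stands above the new box in its column; in rows
-- unprimed copies may repeat.
sink-unprimed : ∀ {i x y T} → Semi T → Sinking i x T → y ≤ x → Addable y T →
  Semi (appendAt y (suc (suc (2 * i))) T) × Sinking i y (appendAt y (suc (suc (2 * i))) T)
sink-unprimed {i} {x} {y} {T} S h y≤x ad@(addable l u _) =
  Semi-append y (suc (suc (2 * i))) S ad (s≤s z≤n) (λ q e → ≤⇒RowRelʳ (proj₁ (h y q e)) (even-2* i))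
    (λ { k q refl e → inj₁ (s≤s (proj₂ (h k q e) y≤x)) }) , h′
  where
  h′ : Sinking i y (appendAt y (suc (suc (2 * i))) T)
  h′ k p e with at-append-cases y _ T k p l u e
  ... | inj₁ e′              = proj₁ (h k p e′) , λ k<y → proj₂ (h k p e′) (<-≤-trans k<y y≤x)
  ... | inj₂ (refl , _ , refl) = ≤-refl , λ y<y → ⊥-elim (<-irrefl refl y<y)

labelAt-before : ∀ i s {k j} → j < k → labelAt (suc i) s k j ≡ suc (2 * i)
labelAt-before i s p rewrite <⇒<ᵇ≡ p = primed-suc i

labelAt-after : ∀ i s {k j} → k < j → labelAt (suc i) s k j ≡ suc (suc (2 * i))
labelAt-after i s p rewrite ≥⇒<ᵇ≡ (<⇒≤ p) | ≢⇒≡ᵇ (>⇒≢ p) = unprimed-suc i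

labelAt-turn : ∀ i s k → labelAt (suc i) s k k ≡ suc (2 * i) ⊎ labelAt (suc i) s k k ≡ suc (suc (2 * i))
labelAt-turn i s      k rewrite ≥⇒<ᵇ≡ (≤-refl {k}) | ≡ᵇ-refl k with s
... | zeroS  = inj₂ (unprimed-suc i)
... | plusS  = inj₂ (unprimed-suc i)
... | minusS = inj₁ (primed-suc i)

fill-falling : ∀ i s {k j x} bs {T} → Semi T → Sinking i x T → Falling x (map proj₁ bs) → Adds (map proj₁ bs) T → k < j →
  Semi (fillT (suc i) s k j bs T) × Below (2 * suc i) (fillT (suc i) s k j bs T)
fill-falling i s [] S h [] [] k<j = S , λ k p {v} e → subst (v ≤_) (sym (unprimed-suc i)) (proj₁ (h k p e))
fill-falling i s ((y , _) ∷ bs) {T} S h (y≤x ∷ f) (ad ∷ ads) k<j rewrite labelAt-after i s k<j =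
  let S′ , h′ = sink-unprimed {i} S h y≤x ad in fill-falling i s bs S′ h′ f (ads _) (<-trans k<j ≤-refl)

turn-fill : ∀ i s {k x y c} bs {T} → Semi T → Rising i x T → x < y → Falling y (map proj₁ bs) → Adds (y ∷ map proj₁ bs) T →
  Semi (fillT (suc i) s k k ((y , c) ∷ bs) T) × Below (2 * suc i) (fillT (suc i) s k k ((y , c) ∷ bs) T)
turn-fill i s {k} {y = y} bs {T} S h x<y f (ad ∷ ads) with labelAt (suc i) s k k | labelAt-turn i s k
... | _ | inj₁ refl = let S′ , h′ = rise-primed {i} S h x<y ad in fill-falling i s bs S′ (Rising⇒Sinking {i} {y} {appendAt y (suc (2 * i)) T} h′) f (ads _) ≤-refl
... | _ | inj₂ refl = let S′ , h′ = turn-unprimed {i} S h x<y ad in fill-falling i s bs S′ h′ f (ads _) ≤-refl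

incPrefixLen-rise : ∀ {x y} ys → x < y → incPrefixLen (x ∷ y ∷ ys) ≡ suc (incPrefixLen (y ∷ ys))
incPrefixLen-rise ys p rewrite <⇒<ᵇ≡ p = refl

incPrefixLen-fall : ∀ {x y} ys → y ≤ x → incPrefixLen (x ∷ y ∷ ys) ≡ 1
incPrefixLen-fall ys p rewrite ≥⇒<ᵇ≡ p = refl

incPrefixLen-pos : ∀ x xs → 0 < incPrefixLen (x ∷ xs)
incPrefixLen-pos x []       = s≤s z≤n
incPrefixLen-pos x (y ∷ ys) with x <ᵇ y
... | true  = s≤s z≤n
... | false = s≤s z≤n

turn-index : ∀ {k j} → suc k ≡ j + 1 → k ≡ j
turn-index {k} {j} e = suc-injective (trans e (+-comm j 1))

rise-index : ∀ {k j y y′} ys → y < y′ → suc k ≡ j + incPrefixLen (y ∷ y′ ∷ ys) → suc k ≡ suc j + incPrefixLen (y′ ∷ ys)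
rise-index {j = j} ys p e = trans e (trans (cong (j +_) (incPrefixLen-rise ys p)) (+-suc j _))

rise-before : ∀ {k j y} ys → suc k ≡ suc j + incPrefixLen (y ∷ ys) → j < k
rise-before {j = j} {y} ys e = ≤-pred (subst (suc (suc j) ≤_) (sym e) (s≤s (m<m+n j (incPrefixLen-pos y ys))))

-- The equation fixes the turn `k`, while `j`, the index of the current box, moves towards it.
fill-hill : ∀ i s {k j x y c} bs {T} → Semi T → Rising i x T → x < y → Hill y (map proj₁ bs) → Adds (y ∷ map proj₁ bs) T →
  suc k ≡ j + incPrefixLen (y ∷ map proj₁ bs) →
  Semi (fillT (suc i) s k j ((y , c) ∷ bs) T) × Below (2 * suc i) (fillT (suc i) s k j ((y , c) ∷ bs) T)
fill-hill i s {k} {j} {x} {y} {c} [] S h x<y [] ads e with turn-index {k} {j} e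
... | refl = turn-fill i s {k} {x} {y} {c} [] S h x<y [] ads
fill-hill i s {k} {j} {x} {y} {c} ((y′ , c′) ∷ bs) S h x<y (fall p f) ads e
  with turn-index {k} {j} (trans e (cong (j +_) (incPrefixLen-fall (map proj₁ bs) p)))
... | refl = turn-fill i s {k} {x} {y} {c} ((y′ , c′) ∷ bs) S h x<y (p ∷ f) ads
fill-hill i s {k} {j} {x} {y} {c} ((y′ , c′) ∷ bs) {T} S h x<y (rise p hl) (ad ∷ ads) e
  with labelAt (suc i) s k j | labelAt-before i s (rise-before {j = j} {y′} (map proj₁ bs) (rise-index {j = j} (map proj₁ bs) p e))
... | _ | refl = let S′ , h′ = rise-primed {i} S h x<y ad in fill-hill i s {x = y} {c = c′} bs S′ h′ p hl (ads _) (rise-index {j = j} (map proj₁ bs) p e)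

Below⇒Rising : ∀ {i T} → Below (2 * i) T → Rising i 0 T
Below⇒Rising h k p e = ≤-trans (h k p e) (n≤1+n _) , λ _ → h k p e

fill-factor : ∀ i s {w P P′ T} bs → Acc st w → KWord w P P′ (map proj₁ bs) → map length T ≡ map length P →
  Semi T → Below (2 * i) T →
  Semi (fillT (suc i) s (incPrefixLen (map proj₁ bs)) 1 bs T) × Below (2 * suc i) (fillT (suc i) s (incPrefixLen (map proj₁ bs)) 1 bs T)
fill-factor i s [] acc [] e S h = S , λ k p e → ≤-trans (h k p e) (*-monoʳ-≤ 2 (n≤1+n i))
fill-factor i s {T = T} ((x , y) ∷ bs) (_ , start ∷ acc) kw@((ki , _) ∷ kw′) e S h =
  -- A fictitious previous box in row 0 makes the first box a rise.
  fill-hill i s {x = 0} {c = y} bs S (Below⇒Rising {i} {T} h) (proj₁ (KIns-row ki)) (hill (KIns-Hist ki) (_ , acc) kw′) (KWord-Adds kw e) refl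

-- Recording tableaux of factorizations

record Recorded (PT : Tab × Tab) : Set where
  constructor recorded
  field
    good  : Good (proj₁ PT)
    shape : map length (proj₂ PT) ≡ map length (proj₁ PT)
    semi  : Semi (proj₂ PT)

unimodal-Acc : ∀ w → unimodal w ≡ true → Acc st w
unimodal-Acc []      e = st , []
unimodal-Acc (x ∷ w) e = Can⇒Acc (unimodal-sound (x ∷ w) e λ ())

KRfrom-step : ∀ i s a As {P T P′ bs} → kInsertWord a P ≡ (P′ , bs) →
  KRfrom i ((s , a) ∷ As) (P , T) ≡ KRfrom (suc i) As (P′ , fillT i s (incPrefixLen (map proj₁ bs)) 1 bs T)
KRfrom-step i s a As e rewrite e = refl

KRfrom-recorded : ∀ i As {P T} → Good P → map length T ≡ map length P → Semi T → Below (2 * i) T →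
  Red (readT P ++ concat (map proj₂ As)) → All (λ f → unimodal (proj₂ f) ≡ true) As → Recorded (KRfrom (suc i) As (P , T))
KRfrom-recorded i [] g e S h red [] = recorded g e S
KRfrom-recorded i ((s , a) ∷ As) {P} {T} g e S h red (u ∷ us) = go (insertWord a P g (Red-prefix _ _ red′))
  where
  red′ : Red ((readT P ++ a) ++ concat (map proj₂ As))
  red′ = subst Red (sym (++-assoc (readT P) a _)) red
  go : InsertedWord a P → Recorded (KRfrom (suc i) ((s , a) ∷ As) (P , T))
  go (inserted {P′} {bs} f kw g′ rd) =
    let S′ , h′ = fill-factor i s bs (unimodal-Acc a u) kw e S h
    in subst Recorded (sym (KRfrom-step (suc i) s a As {P} {T} f))
         (KRfrom-recorded (suc i) As g′ (fillT-lengths (suc i) s _ 1 bs kw e) S′ h′ (Red-resp-∼ (symm (∼-suffix _ rd)) red′) us)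

Semi-[] : Semi []
Semi-[] = record { rows = λ _ _ () ; cols = λ _ _ () ; supp = λ _ _ () ; pos = λ _ _ () }

KR′-recorded : ∀ As → Red (concat (map proj₂ As)) → All (λ f → unimodal (proj₂ f) ≡ true) As → Recorded (KR′ As)
KR′-recorded As red us = KRfrom-recorded 0 As [] refl Semi-[] (λ _ _ ()) red us

Can-pos : ∀ {R} → Can R → 0 < length R
Can-pos (can []      m I _ _ _ _) = s≤s z≤n
Can-pos (can (_ ∷ _) m I _ _ _ _) = s≤s z≤n

Good-Full : ∀ {P} → Good P → Full P
Good-Full []             = []
Good-Full (cons c _ _ g) = Can-pos c ∷ Good-Full g

dprRow-length : ∀ R → length (dprRow R) ≡ length R
dprRow-length []      = refl
dprRow-length (x ∷ R) = refl

DPR-lengths : ∀ T → map length (DPR T) ≡ map length T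
DPR-lengths []       = refl
DPR-lengths (R ∷ Rs) = cong₂ _∷_ (dprRow-length R) (DPR-lengths Rs)

HM-preimage : ∀ {PT} → Recorded PT → ∃[ b ] HM b ≡ (DPR (proj₂ PT) , Qrow (DPR (proj₂ PT))) × All (0 <_) b
HM-preimage {P , T} (recorded g e S) with HM-surjective _ (DPR T) refl (Semi⇒SST S)
    (subst (All (0 <_)) (sym (trans (DPR-lengths T) e)) (Good-Full g))
... | b , hm , _ , p = b , hm , p

-- The first two factors

-- The bound is taken after unpriming the diagonal, where the sign of the second factor may leave
-- 2′, of code 3, although the operator sees a 2.
Large LargeD : ℕ → Tab → Set
Large c T = All (All (c ≤_)) T
LargeD c T = Large c (DPR T)

appendAt-LargeD : ∀ {c} x {v} T → c ≤ v → LargeD c T → LargeD c (appendAt x v T)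
appendAt-LargeD zero T p q = q
appendAt-LargeD (suc zero) {v} [] p q = (≤-trans p (evenUp-≥ v) ∷ []) ∷ []
appendAt-LargeD (suc zero) {v} ([] ∷ Rs) p (_ ∷ qs) = (≤-trans p (evenUp-≥ v) ∷ []) ∷ qs
appendAt-LargeD (suc zero) ((y ∷ R) ∷ Rs) p ((q ∷ q′) ∷ qs) = (q ∷ All.++⁺ q′ (p ∷ [])) ∷ qs
appendAt-LargeD (suc (suc x)) [] p q = []
appendAt-LargeD (suc (suc x)) (R ∷ Rs) p (q ∷ qs) = q ∷ appendAt-LargeD (suc x) Rs p qs

-- Labels are only appended behind the first row `R`, and the rows below evolve alike for every `R`.
-- Two tableaux differing inside the first row thus keep exactly that difference.
record Extension (c : ℕ) (F : List ℕ → Tab) : Set where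
  constructor extension
  field
    {tail}  : List ℕ
    {lower} : Tab
    tail≥   : All (c ≤_) tail
    lower≥  : LargeD c lower
    agrees  : ∀ R → F R ≡ (R ++ tail) ∷ lower

fill-extension : ∀ c i s k j bs rs → LargeD c rs → (∀ j′ → j ≤ j′ → c ≤ labelAt i s k j′) →
  Extension c (λ R → fillT i s k j bs (R ∷ rs))
fill-extension c i s k j [] rs q h = extension [] q (λ R → cong (_∷ rs) (sym (++-identityʳ R)))
fill-extension c i s k j ((zero , _) ∷ bs) rs q h = fill-extension c i s k (suc j) bs rs q (λ j′ p → h j′ (<⇒≤ p))
fill-extension c i s k j ((suc zero , _) ∷ bs) rs q h with fill-extension c i s k (suc j) bs rs q (λ j′ p → h j′ (<⇒≤ p))
... | extension z≥ rs≥ e = extension (h j ≤-refl ∷ z≥) rs≥ (λ R → trans (e (R ++ _ ∷ [])) (cong (_∷ _) (++-assoc R _ _)))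
fill-extension c i s k j ((suc (suc x) , _) ∷ bs) rs q h =
  fill-extension c i s k (suc j) bs (appendAt (suc x) _ rs) (appendAt-LargeD (suc x) rs (h j ≤-refl) q) (λ j′ p → h j′ (<⇒≤ p))

label-≥ : ∀ i s k j → suc (2 * i) ≤ labelAt (suc i) s k j
label-≥ i s k j with <-cmp j k
... | tri< p _ _ = ≤-reflexive (sym (labelAt-before i s p))
... | tri> _ _ p = ≤-trans (n≤1+n _) (≤-reflexive (sym (labelAt-after i s p)))
... | tri≈ _ refl _ with labelAt-turn i s j
...   | inj₁ e = ≤-reflexive (sym e)
...   | inj₂ e = ≤-trans (n≤1+n _) (≤-reflexive (sym e))

record KRExtension (c i : ℕ) (As : List Factor) (P rs : Tab) : Set where
  constructor extension
  field
    {final} : Tab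
    {tail}  : List ℕ
    {lower} : Tab
    tail≥   : All (c ≤_) tail
    lower≥  : LargeD c lower
    agrees  : ∀ R → KRfrom i As (P , R ∷ rs) ≡ (final , (R ++ tail) ∷ lower)

-- From the third factor on the labels are at least 3′, of code 5, whence the bound on `c`.
KRfrom-extension : ∀ c i As P rs → c ≤ 5 → LargeD c rs → KRExtension c (suc (suc (suc i))) As P rs
KRfrom-extension c i [] P rs c≤5 q = extension [] q (λ R → cong (λ S → P , S ∷ rs) (sym (++-identityʳ R)))
KRfrom-extension c i ((s , a) ∷ As) P rs c≤5 q with kInsertWord a P in eq
... | P′ , bs with fill-extension c (3 + i) s (incPrefixLen (map proj₁ bs)) 1 bs rs q
                     (λ j _ → ≤-trans (≤-trans c≤5 (s≤s (2*-mono {2} {2 + i} (s≤s (s≤s z≤n))))) (label-≥ (2 + i) s (incPrefixLen (map proj₁ bs)) j))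
...   | extension {z} {rs′} z≥ rs≥ e with KRfrom-extension c (suc i) As P′ rs′ c≤5 rs≥
...     | extension {P″} {z′} {rs″} z′≥ rs″≥ e′ = extension (All.++⁺ z≥ z′≥) rs″≥ (λ R →
            trans (KRfrom-step (3 + i) s a As eq) (trans (cong (λ T → KRfrom (4 + i) As (P′ , T)) (e R)) (trans (e′ (R ++ z)) (cong (λ S → P″ , S ∷ rs″) (++-assoc R z z′)))))

Acc-incB : ∀ x u → Acc (up x) u → incB (x ∷ u) ≡ true
Acc-incB x []      _                = refl
Acc-incB x (y ∷ u) (e , rise p ∷ r) rewrite <⇒<ᵇ≡ p = Acc-incB y u (e , r)

Acc-unimodalFrom : ∀ x u → Acc (dn x) u → unimodalFrom x u ≡ true
Acc-unimodalFrom x []      _                = refl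
Acc-unimodalFrom x (y ∷ u) (e , down p ∷ r) rewrite <⇒<ᵇ≡ p = Acc-unimodalFrom y u (e , r)
Acc-unimodalFrom x (y ∷ u) (e , turn p ∷ r) rewrite ≥⇒<ᵇ≡ (<⇒≤ p) | <⇒<ᵇ≡ p = Acc-incB y u (e , r)

Acc-unimodal : ∀ u → Acc st u → unimodal u ≡ true
Acc-unimodal []      _                = refl
Acc-unimodal (x ∷ u) (e , start ∷ r) = Acc-unimodalFrom x u (e , r)

kInsertWord-row : ∀ w R Rs → Acc st (R ++ w) → ∃[ bs ] kInsertWord w (R ∷ Rs) ≡ ((R ++ w) ∷ Rs , bs) × map proj₁ bs ≡ replicate (length w) 1
kInsertWord-row []      R Rs acc = [] , cong (λ S → S ∷ Rs , []) (sym (++-identityʳ R)) , refl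
kInsertWord-row (x ∷ w) R Rs acc with kInsertWord-row w (R ++ x ∷ []) Rs acc′
  where acc′ = subst (Acc st) (sym (++-assoc R (x ∷ []) w)) acc
... | bs , e , rows = _ ,
  trans (kInsertWord-∷ {x} {w} {R ∷ Rs} (kInsert-append {x} {R} (kIns-append {x} {R} (Acc-unimodal _ (Acc-prefix (R ++ x ∷ []) acc′)))) e)
        (cong (λ S → S ∷ Rs , _) (++-assoc R (x ∷ []) w)) ,
  cong (1 ∷_) rows
  where acc′ = subst (Acc st) (sym (++-assoc R (x ∷ []) w)) acc

-- The label at the turn, hence that of the first box whenever the turn comes at once.
lab : ℕ → Sign → ℕ
lab i s = labelAt i s 1 1

fill-row : ∀ i s j bs R rs n → map proj₁ bs ≡ replicate n 1 →
  fillT i s 1 (suc (suc j)) bs (R ∷ rs) ≡ (R ++ replicate n (unprimedL i)) ∷ rs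
fill-row i s j []                R rs zero    e = cong (_∷ rs) (sym (++-identityʳ R))
fill-row i s j ((x , c) ∷ bs) R rs (suc n) e with ∷-injective e
... | refl , e′ = trans (fill-row i s (suc j) bs (R ++ unprimedL i ∷ []) rs n e′) (cong (_∷ rs) (++-assoc R (unprimedL i ∷ []) _))

incPrefixLen-ones : ∀ n → incPrefixLen (replicate (suc n) 1) ≡ 1
incPrefixLen-ones zero    = refl
incPrefixLen-ones (suc n) = refl

fill-rows : ∀ i s bs R rs n → map proj₁ bs ≡ replicate (suc n) 1 →
  fillT i s (incPrefixLen (map proj₁ bs)) 1 bs (R ∷ rs) ≡ (R ++ lab i s ∷ replicate n (unprimedL i)) ∷ rs
fill-rows i s ((x , c) ∷ bs) R rs n e with ∷-injective e
... | refl , e′ = trans (cong (λ k → fillT i s k 1 ((1 , c) ∷ bs) (R ∷ rs)) (trans (cong incPrefixLen e) (incPrefixLen-ones n)))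
  (trans (fill-row i s 0 bs (R ++ lab i s ∷ []) rs n e′) (cong (_∷ rs) (++-assoc R (lab i s ∷ []) _)))

fill-first : ∀ i s bs n → map proj₁ bs ≡ replicate (suc n) 1 →
  fillT i s (incPrefixLen (map proj₁ bs)) 1 bs [] ≡ (lab i s ∷ replicate n (unprimedL i)) ∷ []
fill-first i s ((x , c) ∷ bs) n e with ∷-injective e
... | refl , e′ = trans (cong (λ k → fillT i s k 1 ((1 , c) ∷ bs) []) (trans (cong incPrefixLen e) (incPrefixLen-ones n)))
  (fill-row i s 0 bs (lab i s ∷ []) [] n e′)

row-factor : ∀ i s a As R S n → Acc st (R ++ a) → length a ≡ suc n →
  KRfrom i ((s , a) ∷ As) (R ∷ [] , S ∷ []) ≡ KRfrom (suc i) As ((R ++ a) ∷ [] , (S ++ lab i s ∷ replicate n (unprimedL i)) ∷ [])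
row-factor i s a As R S n acc len with kInsertWord-row a R [] acc
... | bs , e , rows = trans (KRfrom-step i s a As e)
  (cong (λ T → KRfrom (suc i) As ((R ++ a) ∷ [] , T)) (fill-rows i s bs S [] n (trans rows (cong (λ m → replicate m 1) len))))

first-factor : ∀ i s a As n → Acc st a → length a ≡ suc n →
  KRfrom i ((s , a) ∷ As) ([] , []) ≡ KRfrom (suc i) As (a ∷ [] , (lab i s ∷ replicate n (unprimedL i)) ∷ [])
first-factor i s (x ∷ w) As n acc len with kInsertWord-row w (x ∷ []) [] acc
... | bs , e , rows = trans (KRfrom-step i s (x ∷ w) As {[]} {[]} (kInsertWord-∷ {x} {w} {[]} refl e))
  (cong (λ T → KRfrom (suc i) As ((x ∷ w) ∷ [] , T)) (fill-first i s ((1 , 1) ∷ bs) n (trans (cong (1 ∷_) rows) (cong (λ m → replicate m 1) len))))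

-- The operator on recording tableaux

undefined : ∀ As → Recorded (KR′ As) → Fixed (DPR (proj₂ (KR′ As))) → FoddPM (proj₂ (KR′ As)) nothing
undefined As r F with HM-preimage r
... | b , hm , p = nothing , (b , hm , f1-undefined b p F hm) , refl

-- `modif k` after the primes are restored. For `zero` the only 1 is the diagonal entry, which keeps
-- its sign as a 2.
changed : ℕ → Sign → List ℕ
changed zero    s = lab 2 s ∷ []
changed (suc k) s = (lab 1 s ∷ ones k) ++ 3 ∷ []

prRow-changed : ∀ k s Z → prRow ((lab 1 s ∷ ones k) ++ Z) (modif k ++ Z) ≡ changed k s ++ Z
prRow-changed zero    zeroS  Z = refl
prRow-changed zero    plusS  Z = refl
prRow-changed zero    minusS Z = refl
prRow-changed (suc k) zeroS  Z = refl
prRow-changed (suc k) plusS  Z = refl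
prRow-changed (suc k) minusS Z = refl

dprRow-labels : ∀ k s Z → dprRow ((lab 1 s ∷ ones k) ++ Z) ≡ ones (suc k) ++ Z
dprRow-labels k zeroS  Z = refl
dprRow-labels k plusS  Z = refl
dprRow-labels k minusS Z = refl

prRow-dprRow : ∀ R → prRow R (dprRow R) ≡ R
prRow-dprRow []      = refl
prRow-dprRow (x ∷ R) with evenB x in e
... | true  = refl
... | false rewrite even-suc-odd x e = refl

PR-DPR : ∀ T → PR T (DPR T) ≡ T
PR-DPR []       = refl
PR-DPR (R ∷ Rs) = cong₂ _∷_ (prRow-dprRow R) (PR-DPR Rs)

defined : ∀ {As} k s {Z RS P} → Recorded (KR′ As) → KR′ As ≡ (P , ((lab 1 s ∷ ones k) ++ Z) ∷ RS) → Big Z → LargeD 4 RS →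
  FoddPM (proj₂ (KR′ As)) (just ((changed k s ++ Z) ∷ RS))
defined {As} k s {Z} {RS} r e q qs with HM-preimage r
... | b , hm , p = just ((modif k ++ Z) ∷ DPR RS) ,
  (b , hm , f1-defined b {k} p q qs (trans hm (cong₂ _,_ (trans (cong (λ z → DPR (proj₂ z)) e) (cong (_∷ DPR RS) (dprRow-labels k s Z))) refl))) ,
  cong just (trans (cong (λ z → PR (proj₂ z) ((modif k ++ Z) ∷ DPR RS)) e) (cong₂ _∷_ (prRow-changed k s Z) (PR-DPR RS)))

conclude : ∀ {n m w} As As′ k s {Z RS P} → Recorded (KR′ As) → KR′ As ≡ (P , ((lab 1 s ∷ ones k) ++ Z) ∷ RS) →
  KR′ As′ ≡ (P , (changed k s ++ Z) ∷ RS) → Big Z → LargeD 4 RS → InU n m w As′ → OddF n m w As (just As′)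
conclude As As′ k s r e e′ q qs inU = inU , trans (cong proj₁ e′) (cong proj₁ (sym e)) ,
  subst (λ T → FoddPM (proj₂ (KR′ As)) (just T)) (cong proj₂ (sym e′)) (defined {As} k s r e q qs)

Acc-weaken : ∀ {x} v → Acc (up x) v → Acc (dn x) v
Acc-weaken []      _                = _ , []
Acc-weaken (y ∷ v) (e , rise p ∷ r) = e , turn p ∷ r

Acc-after-step : ∀ {c x g} v → c -[ x ]→ g → Acc (up x) v → Acc g v
Acc-after-step v start    acc = Acc-weaken v acc
Acc-after-step v (down _) acc = Acc-weaken v acc
Acc-after-step v (turn _) acc = acc
Acc-after-step v (rise _) acc = acc

-- After two letters the state depends on them alone: `dn y` after a descent, `up y` after an
-- ascent. So words overlapping in two letters can be joined.
glue : ∀ {c x g y h v} → c -[ x ]→ g → g -[ y ]→ h → Acc (dn x) (y ∷ v) → Acc h v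
glue start    (down _) (_ , down _ ∷ r) = _ , r
glue start    (turn _) (_ , turn _ ∷ r) = _ , r
glue start    (down p) (_ , turn q ∷ r) = ⊥-elim (<-asym p q)
glue start    (turn p) (_ , down q ∷ r) = ⊥-elim (<-asym p q)
glue (down _) (down _) (_ , down _ ∷ r) = _ , r
glue (down _) (turn _) (_ , turn _ ∷ r) = _ , r
glue (down _) (down p) (_ , turn q ∷ r) = ⊥-elim (<-asym p q)
glue (down _) (turn p) (_ , down q ∷ r) = ⊥-elim (<-asym p q)
glue (turn _) (rise _) (_ , turn _ ∷ r) = _ , r
glue (turn _) (rise p) (_ , down q ∷ r) = ⊥-elim (<-asym p q)
glue (rise _) (rise _) (_ , turn _ ∷ r) = _ , r
glue (rise _) (rise p) (_ , down q ∷ r) = ⊥-elim (<-asym p q)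

Acc-snoc : ∀ u {x c v} → Acc c (u ++ x ∷ v) → ∃[ g ] ∃[ h ] Run c u g × g -[ x ]→ h × Acc h v
Acc-snoc u acc with Run-++⁻ u acc
... | g , r , (e , t ∷ q) = g , _ , r , t , (e , q)

glue-word : ∀ pre {x y v} → Acc st ((pre ++ x ∷ []) ++ y ∷ []) → Acc (dn x) (y ∷ v) → Acc st ((pre ++ x ∷ []) ++ y ∷ v)
glue-word pre {x} {y} {v} acc acc′ with Acc-snoc pre (subst (Acc st) (++-assoc pre (x ∷ []) (y ∷ [])) acc)
... | g , h , r , t , (_ , t′ ∷ _) = subst (Acc st) (sym (++-assoc pre (x ∷ []) (y ∷ v))) (Run-++⁺ r (t ∷ᵃ t′ ∷ᵃ glue t t′ acc′))

extend-up : ∀ pre {x} v → Acc st (pre ++ x ∷ []) → Acc (up x) v → Acc st ((pre ++ x ∷ []) ++ v)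
extend-up pre {x} v acc acc′ with Acc-snoc pre acc
... | g , h , r , t , _ = subst (Acc st) (sym (++-assoc pre (x ∷ []) v)) (Run-++⁺ r (t ∷ᵃ Acc-after-step v t acc′))

Falling-≤ : ∀ {c x xs} → Falling x xs → x ≤ c → All (_≤ c) xs
Falling-≤ []      p = []
Falling-≤ (q ∷ f) p = ≤-trans q p ∷ Falling-≤ f (≤-trans q p)

-- A bump needs an ascent in the row, which a single letter lacks.
second-row-short : ∀ {e R a P′ x} → KIns e (R ∷ (a ∷ []) ∷ []) P′ x → x ≤ 2
second-row-short (append _ _)                = s≤s z≤n
second-row-short (bump _ _ (append _ _))     = ≤-refl
second-row-short (bump _ _ (bump B _ _)) with Bump-ascent B
... | _ , _ , s⊆ with ⊆-length s⊆
...   | s≤s ()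

rows-≤2 : ∀ {R a y w P′ xs} → Hist (R ∷ (a ∷ []) ∷ []) y 2 → Acc (dn y) w → KWord w (R ∷ (a ∷ []) ∷ []) P′ xs → All (_≤ 2) xs
rows-≤2 h _ [] = []
rows-≤2 h (_ , turn p ∷ r) ((ki , _) ∷ kw) =
  second-row-short ki ∷ Falling-≤ (falling-up (KIns-Hist ki) (_ , r) kw) (second-row-short ki)
rows-≤2 h (_ , down p ∷ r) ((ki , _) ∷ kw) =
  second-row-short ki ∷ Falling-≤ (falling-settled (settle h p ki (second-row-short ki)) (_ , r) kw) (second-row-short ki)

incPrefixLen-2 : ∀ {xs} → All (_≤ 2) xs → incPrefixLen (2 ∷ xs) ≡ 1
incPrefixLen-2 []       = refl
incPrefixLen-2 (_∷_ {xs = xs} p ps) = incPrefixLen-fall xs p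

incPrefixLen-12 : ∀ {xs} → All (_≤ 2) xs → incPrefixLen (1 ∷ 2 ∷ xs) ≡ 2
incPrefixLen-12 ps = cong suc (incPrefixLen-2 ps)

-- A box put in front of the factor moves the index of every other box and the turn together.
labelAt-shift : ∀ i s k j → labelAt i s (suc k) (suc j) ≡ labelAt i s k j
labelAt-shift i zeroS  k j = refl
labelAt-shift i plusS  k j = refl
labelAt-shift i minusS k j = refl

fillT-shift : ∀ i s k j bs T → fillT i s (suc k) (suc j) bs T ≡ fillT i s k j bs T
fillT-shift i s k j []             T = refl
fillT-shift i s k j ((x , y) ∷ bs) T = trans (fillT-shift i s k (suc j) bs _)
  (cong (λ l → fillT i s k (suc j) bs (appendAt x l T)) (labelAt-shift i s k j))

Good-row : ∀ {R} → Can R → Good (R ∷ [])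
Good-row c = cons c (Max-empty _) (Can-pos c) []

LargeD-lab : ∀ s → LargeD 4 ((lab 2 s ∷ []) ∷ [])
LargeD-lab zeroS  = (≤-refl ∷ []) ∷ []
LargeD-lab plusS  = (≤-refl ∷ []) ∷ []
LargeD-lab minusS = (≤-refl ∷ []) ∷ []

same-concat : ∀ pre x (a₂ : List ℕ) rest → (pre ++ x ∷ []) ++ a₂ ++ rest ≡ pre ++ (x ∷ a₂) ++ rest
same-concat pre x a₂ rest = ++-assoc pre (x ∷ []) (a₂ ++ rest)

InU-Recorded : ∀ {n m w} As → InU n m w As → Recorded (KR′ As)
InU-Recorded As (_ , _ , u , r) = KR′-recorded As (IsReduced⇒Red r) u

fixed-labels : ∀ n s Z Rs → Fixed (DPR (((lab 1 s ∷ ones n) ++ 3 ∷ Z) ∷ Rs))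
fixed-labels n s Z Rs = subst (λ R → Fixed (R ∷ DPR Rs)) (sym (trans (dprRow-labels n s (3 ∷ Z)) (modif-suc n Z))) (has-2′ n)

bumped-factor : ∀ s₁ s₂ pre x y w rest n → length pre ≡ suc n → Acc st (pre ++ x ∷ []) → Acc st (y ∷ w) →
  Red ((pre ++ x ∷ []) ++ y ∷ w) → ¬ Acc st ((pre ++ x ∷ []) ++ y ∷ []) →
  ∃[ P ] ∃[ Z ] ∃[ RS ] KR′ ((s₁ , pre ++ x ∷ []) ∷ (s₂ , y ∷ w) ∷ rest) ≡ (P , ((lab 1 s₁ ∷ ones (suc n)) ++ Z) ∷ RS) ×
    KR′ ((s₁ , pre) ∷ (s₂ , x ∷ y ∷ w) ∷ rest) ≡ (P , (changed (suc n) s₁ ++ Z) ∷ RS) × Big Z × LargeD 4 RS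
bumped-factor s₁ s₂ pre x y w rest n len acc₁ (_ , start ∷ acc₂) red blocked = go (insertWord (y ∷ w) (a₁ ∷ []) (Good-row can₁) red)
  where
  a₁ = pre ++ x ∷ []
  can₁ : Can a₁
  can₁ = unimodal-sound a₁ (Acc-unimodal a₁ acc₁) snoc≢[]
  R₁ = lab 1 s₁ ∷ ones (suc n)
  R₁′ = (lab 1 s₁ ∷ ones n) ++ 3 ∷ []
  go : InsertedWord (y ∷ w) (a₁ ∷ []) → _
  go (inserted {boxes = []} comp () g rd)
  go (inserted {boxes = (.1 , c) ∷ bs} comp ((append _ cn , _) ∷ kw) g rd) = ⊥-elim (blocked (Can⇒Acc cn))
  go (inserted {P} {(.2 , c) ∷ bs} comp ((bump B r new , g′) ∷ kw) g rd)
    -- The box of `y`, on the diagonal in row 2, is the turn at index 1 and carries the sign; from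
    -- index 2 on every label is 2, of code 4.
    with fill-extension 4 2 s₂ 1 2 bs ((lab 2 s₂ ∷ []) ∷ []) (LargeD-lab s₂) (λ j p → ≤-reflexive (sym (labelAt-after 1 s₂ p)))
  ... | extension {z₁} {rs₁} z₁≥ rs₁≥ e₁ with KRfrom-extension 4 0 rest P rs₁ (n≤1+n 4) rs₁≥
  ...   | extension {P′} {z₂} {rs₂} z₂≥ rs₂≥ e₂ = P′ , z₁ ++ z₂ , rs₂ , first , second , All.++⁺ z₁≥ z₂≥ , rs₂≥
    where
    small : All (_≤ 2) (map proj₁ bs)
    small = rows-≤2 (KIns-Hist (bump B r new)) (_ , acc₂) kw
    extended : ∀ R → KRfrom 3 rest (P , fillT 2 s₂ 1 2 bs (R ∷ (lab 2 s₂ ∷ []) ∷ [])) ≡ (P′ , (R ++ z₁ ++ z₂) ∷ rs₂)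
    extended R = trans (cong (λ T → KRfrom 3 rest (P , T)) (e₁ R)) (trans (e₂ (R ++ z₁)) (cong (λ S → P′ , S ∷ rs₂) (++-assoc R z₁ z₂)))
    first : KR′ ((s₁ , a₁) ∷ (s₂ , y ∷ w) ∷ rest) ≡ (P′ , (R₁ ++ z₁ ++ z₂) ∷ rs₂)
    first = trans (first-factor 1 s₁ a₁ ((s₂ , y ∷ w) ∷ rest) (suc n) acc₁ (trans (length-snoc pre x) (cong suc len)))
      (trans (KRfrom-step 2 s₂ (y ∷ w) rest {a₁ ∷ []} {R₁ ∷ []} comp)
      (trans (cong (λ k → KRfrom 3 rest (P , fillT 2 s₂ k 1 ((2 , c) ∷ bs) (R₁ ∷ []))) (incPrefixLen-2 small)) (extended R₁)))
    second : KR′ ((s₁ , pre) ∷ (s₂ , x ∷ y ∷ w) ∷ rest) ≡ (P′ , (R₁′ ++ z₁ ++ z₂) ∷ rs₂)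
    second = trans (first-factor 1 s₁ pre ((s₂ , x ∷ y ∷ w) ∷ rest) n (Acc-prefix pre acc₁) len)
      (trans (KRfrom-step 2 s₂ (x ∷ y ∷ w) rest {pre ∷ []} {(lab 1 s₁ ∷ ones n) ∷ []} (kInsertWord-∷ {x} {y ∷ w} {pre ∷ []} (kInsert-append {x} {pre} (kIns-append {x} {pre} (Acc-unimodal a₁ acc₁))) comp))
      (trans (cong (λ k → KRfrom 3 rest (P , fillT 2 s₂ k 1 ((1 , length a₁) ∷ (2 , c) ∷ bs) ((lab 1 s₁ ∷ ones n) ∷ []))) (incPrefixLen-12 small))
      (trans (cong (λ T → KRfrom 3 rest (P , T)) (fillT-shift 2 s₂ 1 1 ((2 , c) ∷ bs) (R₁′ ∷ []))) (extended R₁′))))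

-- `y` is appended to the first row and `y′` then bumps, so the hill still rises at the box of `y`,
-- which gets 2′ right behind the ones whatever the sign `s₂`.
peak-factor : ∀ s₁ s₂ a₁ y y′ w rest n → length a₁ ≡ suc n → Acc st a₁ → Red (a₁ ++ y ∷ y′ ∷ w) →
  Acc st (a₁ ++ y ∷ []) → ¬ Acc st ((a₁ ++ y ∷ []) ++ y′ ∷ []) →
  ∃[ P ] ∃[ Z ] ∃[ RS ] KR′ ((s₁ , a₁) ∷ (s₂ , y ∷ y′ ∷ w) ∷ rest) ≡ (P , ((lab 1 s₁ ∷ ones n) ++ 3 ∷ Z) ∷ RS)
peak-factor s₁ s₂ a₁ y y′ w rest n len acc₁ red acc₂ blocked =
  go (insertWord (y′ ∷ w) (a₁y ∷ []) (Good-row can₂) (subst Red (sym (++-assoc a₁ (y ∷ []) _)) red))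
  where
  a₁y = a₁ ++ y ∷ []
  can₂ : Can a₁y
  can₂ = unimodal-sound a₁y (Acc-unimodal a₁y acc₂) snoc≢[]
  R₁ = lab 1 s₁ ∷ ones n
  go : InsertedWord (y′ ∷ w) (a₁y ∷ []) → _
  go (inserted {boxes = []} comp () g rd)
  go (inserted {boxes = _ ∷ bs} comp ((append _ cn , _) ∷ kw) g rd) = ⊥-elim (blocked (Can⇒Acc cn))
  go (inserted {P} {(.(suc _) , c) ∷ bs} comp ((bump {x = x} _ _ ki , _) ∷ kw) g rd)
    -- The bound 0 asks nothing of the remaining entries: the 2′ behind the ones already decides.
    with fill-extension 0 2 s₂ (suc (incPrefixLen (suc x ∷ map proj₁ bs))) 2 ((suc x , c) ∷ bs) [] [] (λ _ _ → z≤n)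
  ... | extension {z₁} {rs₁} z₁≥ rs₁≥ e₁ with KRfrom-extension 0 0 rest P rs₁ z≤n rs₁≥
  ...   | extension {P′} {z₂} {rs₂} _ _ e₂ = P′ , z₁ ++ z₂ , rs₂ ,
    trans (first-factor 1 s₁ a₁ ((s₂ , y ∷ y′ ∷ w) ∷ rest) n acc₁ len)
    (trans (KRfrom-step 2 s₂ (y ∷ y′ ∷ w) rest {a₁ ∷ []} {R₁ ∷ []}
             (kInsertWord-∷ {y} {y′ ∷ w} {a₁ ∷ []} (kInsert-append {y} {a₁} (kIns-append {y} {a₁} (Acc-unimodal a₁y acc₂))) comp))
    (trans (cong (λ k′ → KRfrom 3 rest (P , fillT 2 s₂ k′ 1 ((1 , length a₁y) ∷ (suc x , c) ∷ bs) (R₁ ∷ [])))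
             (incPrefixLen-rise (map proj₁ bs) (s≤s (KIns-pos ki))))
    (trans (cong (λ l → KRfrom 3 rest (P , fillT 2 s₂ k 2 ((suc x , c) ∷ bs) ((R₁ ++ l ∷ []) ∷ [])))
             (labelAt-before 1 s₂ {k} {1} (s≤s (incPrefixLen-pos (suc x) (map proj₁ bs)))))
    (trans (cong (λ T → KRfrom 3 rest (P , T)) (e₁ (R₁ ++ 3 ∷ [])))
    (trans (e₂ ((R₁ ++ 3 ∷ []) ++ z₁))
           (cong (λ S → P′ , S ∷ rs₂) (trans (++-assoc (R₁ ++ 3 ∷ []) z₁ z₂) (++-assoc R₁ (3 ∷ []) (z₁ ++ z₂)))))))))
    where k = suc (incPrefixLen (suc x ∷ map proj₁ bs))

fours : ℕ → List ℕ
fours n = replicate n 4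

Big-fours : ∀ n → Big (fours n)
Big-fours n = All.replicate⁺ n ≤-refl

lab-4 : ∀ {s} → s ≢ minusS → lab 2 s ≡ 4
lab-4 {zeroS}  p = refl
lab-4 {plusS}  p = refl
lab-4 {minusS} p = ⊥-elim (p refl)

plain-factor : ∀ s a R S As → Acc st (R ++ a) → ¬ ((a ≢ []) × (s ≡ minusS)) →
  KRfrom 2 ((s , a) ∷ As) (R ∷ [] , S ∷ []) ≡ KRfrom 3 As ((R ++ a) ∷ [] , (S ++ fours (length a)) ∷ [])
plain-factor s []      R S As acc ns = cong₂ (λ r t → KRfrom 3 As (r ∷ [] , t ∷ [])) (sym (++-identityʳ R)) (sym (++-identityʳ S))
plain-factor s (y ∷ w) R S As acc ns = trans (row-factor 2 s (y ∷ w) As R S (length w) acc refl)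
  (cong (λ l → KRfrom 3 As ((R ++ y ∷ w) ∷ [] , (S ++ l ∷ fours (length w)) ∷ [])) (lab-4 (λ e → ns ((λ ()) , e))))

-- The cases of the rule

shifted-InU : ∀ {n m w pre x a₂ s₁ s₂ rest} s₁′ s₂′ → InU n m w ((s₁ , pre ++ x ∷ []) ∷ (s₂ , a₂) ∷ rest) →
  ValidFactor (s₁′ , pre) → s₂′ ≢ zeroS → Acc st (x ∷ a₂) → InU n m w ((s₁′ , pre) ∷ (s₂′ , x ∷ a₂) ∷ rest)
shifted-InU {pre = pre} {x} {a₂} {rest = rest} s₁′ s₂′ (len , _ ∷ _ ∷ vs , u₁ ∷ _ ∷ us , red) v₁ s₂′≢0 acc =
  len , v₁ ∷ inj₂ (s₂′≢0 , λ ()) ∷ vs , Acc-unimodal pre (Acc-prefix pre (unimodal-Acc _ u₁)) ∷ Acc-unimodal (x ∷ a₂) acc ∷ us ,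
  subst (IsReduced _ _) (same-concat pre x a₂ (concat (map proj₂ rest))) red

sign-nonzero : ∀ {s a} → ValidFactor (s , a) → a ≢ [] → s ≢ zeroS
sign-nonzero (inj₁ (_ , e)) ne = ⊥-elim (ne e)
sign-nonzero (inj₂ (p , _)) ne = p

InU-Red : ∀ {n m w s₁ a₁ s₂ a₂ rest} → InU n m w ((s₁ , a₁) ∷ (s₂ , a₂) ∷ rest) → Red (a₁ ++ a₂)
InU-Red {a₁ = a₁} {a₂ = a₂} (_ , _ , _ , red) = Red-prefix (a₁ ++ a₂) _ (subst Red (sym (++-assoc a₁ a₂ _)) (IsReduced⇒Red red))

not-Acc : ∀ {u} → unimodal u ≡ false → ¬ Acc st u
not-Acc {u} e acc = false≢true e (Acc-unimodal u acc)

-- Were `pre x y` unimodal, with `y` the first letter of `a₂`, it would glue with `x a₂` along `x y`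
-- to a unimodal word. So `y` is blocked, and `bumped-factor` compares the two recordings.
shift-not-unimodal : ∀ {n m w s₁ s₂ rest} a₂ pre x → InU n m w ((s₁ , pre ++ x ∷ []) ∷ (s₂ , a₂) ∷ rest) →
  unimodal ((pre ++ x ∷ []) ++ a₂) ≡ false → unimodal (x ∷ a₂) ≡ true →
  OddF n m w ((s₁ , pre ++ x ∷ []) ∷ (s₂ , a₂) ∷ rest) (just ((s₁ , pre) ∷ (s₂ , x ∷ a₂) ∷ rest))
shift-not-unimodal [] pre x (_ , _ , u₁ ∷ _ , _) nu u = ⊥-elim (false≢true nu (trans (cong unimodal (++-identityʳ (pre ++ x ∷ []))) u₁))
shift-not-unimodal (y ∷ w′) [] x inU nu u = ⊥-elim (false≢true nu u)
shift-not-unimodal {s₁ = s₁} {s₂} {rest} (y ∷ w′) (p ∷ ps) x inU@(_ , v₁ ∷ v₂ ∷ _ , u₁ ∷ u₂ ∷ _ , _) nu u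
  with bumped-factor s₁ s₂ (p ∷ ps) x y w′ rest (length ps) refl (unimodal-Acc _ u₁) (unimodal-Acc _ u₂) (InU-Red inU) blocked
  where
  blocked : ¬ Acc st (((p ∷ ps) ++ x ∷ []) ++ y ∷ [])
  blocked acc with unimodal-Acc (x ∷ y ∷ w′) u
  ... | _ , start ∷ r = not-Acc nu (glue-word (p ∷ ps) acc (_ , r))
... | P , Z , RS , e , e′ , q , qs = conclude ((s₁ , (p ∷ ps) ++ x ∷ []) ∷ (s₂ , y ∷ w′) ∷ rest) ((s₁ , p ∷ ps) ∷ (s₂ , x ∷ y ∷ w′) ∷ rest) (suc (length ps)) s₁ (InU-Recorded ((s₁ , (p ∷ ps) ++ x ∷ []) ∷ (s₂ , y ∷ w′) ∷ rest) inU) e e′ q qs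
  (shifted-InU s₁ s₂ inU (inj₂ (sign-nonzero v₁ (λ ()) , λ ())) (sign-nonzero v₂ (λ ())) (unimodal-Acc (x ∷ y ∷ w′) u))

-- Let `y` be the first letter of `a₂`. Here `y < x` would make `x a₂` unimodal, `y = x` contradicts
-- reducedness, and for `y > x` only a descent after `y` remains, which is a peak.
shift-impossible : ∀ {n m w s₁ s₂ rest} a₂ pre x → InU n m w ((s₁ , pre ++ x ∷ []) ∷ (s₂ , a₂) ∷ rest) →
  unimodal ((pre ++ x ∷ []) ++ a₂) ≡ false → unimodal (x ∷ a₂) ≡ false →
  OddF n m w ((s₁ , pre ++ x ∷ []) ∷ (s₂ , a₂) ∷ rest) nothing
shift-impossible [] pre x (_ , _ , u₁ ∷ _ , _) nu u = ⊥-elim (false≢true nu (trans (cong unimodal (++-identityʳ (pre ++ x ∷ []))) u₁))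
shift-impossible {s₁ = s₁} {s₂} {rest} (y ∷ w′) pre x inU@(_ , _ , u₁ ∷ u₂ ∷ _ , _) nu u with <-cmp y x | unimodal-Acc (y ∷ w′) u₂
... | tri< y<x _ _  | _ , start ∷ r = ⊥-elim (not-Acc u (_ , start ∷ down y<x ∷ r))
... | tri≈ _ refl _ | _ = ⊥-elim (InU-Red inU pre x w′ (≡⇒∼ (++-assoc pre (x ∷ []) (x ∷ w′))))
shift-impossible (y ∷ []) pre x inU nu u | tri> _ _ x<y | _ = ⊥-elim (not-Acc u (_ , start ∷ turn x<y ∷ []))
... | tri> _ _ x<y  | _ , start ∷ turn y<y′ ∷ r = ⊥-elim (not-Acc u (_ , start ∷ turn x<y ∷ rise y<y′ ∷ r))
shift-impossible {s₁ = s₁} {s₂} {rest} (y ∷ y′ ∷ w′) pre x inU@(_ , _ , u₁ ∷ _ , _) nu u | tri> _ _ x<y | _ , start ∷ down y′<y ∷ r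
  with peak-factor s₁ s₂ (pre ++ x ∷ []) y y′ w′ rest (length pre) (length-snoc pre x) (unimodal-Acc _ u₁) (InU-Red inU)
         (extend-up pre (y ∷ []) (unimodal-Acc _ u₁) (rise x<y ∷ᵃ (_ , []))) blocked
  where
  blocked : ¬ Acc st (((pre ++ x ∷ []) ++ y ∷ []) ++ y′ ∷ [])
  blocked acc with Acc-snoc pre (subst (Acc st) (trans (++-assoc (pre ++ x ∷ []) (y ∷ []) (y′ ∷ [])) (++-assoc pre (x ∷ []) (y ∷ y′ ∷ []))) acc)
  ... | _ , _ , _ , t , (_ , t′ ∷ t″ ∷ _) with step-up t t′ x<y | t″
  ...   | refl | rise y<y′ = <-asym y<y′ y′<y
... | P , Z , RS , e = undefined ((s₁ , pre ++ x ∷ []) ∷ (s₂ , y ∷ y′ ∷ w′) ∷ rest) (InU-Recorded ((s₁ , pre ++ x ∷ []) ∷ (s₂ , y ∷ y′ ∷ w′) ∷ rest) inU) (subst (λ z → Fixed (DPR (proj₂ z))) (sym e) (fixed-labels (length pre) s₁ Z RS))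

-- After a nonempty first factor, the first box of `a₂` is labelled 2′ right behind the ones, so the
-- operator vanishes.
negative-second : ∀ {n m w s₁ rest} a₁ a₂ → InU n m w ((s₁ , a₁) ∷ (minusS , a₂) ∷ rest) → unimodal (a₁ ++ a₂) ≡ true →
  a₂ ≢ [] → OddF n m w ((s₁ , a₁) ∷ (minusS , a₂) ∷ rest) nothing
negative-second a₁ [] inU u ne = ⊥-elim (ne refl)
-- With an empty first factor this box lies on the diagonal, `DPR` turns it into a 2, and the first
-- row contains no 1.
negative-second {s₁ = s₁} {rest} [] (y ∷ w′) inU u ne with KRfrom-extension 4 0 rest ((y ∷ w′) ∷ []) [] (n≤1+n 4) []
... | extension {P} {z} {rs} z≥ rs≥ e = undefined ((s₁ , []) ∷ (minusS , y ∷ w′) ∷ rest) (InU-Recorded ((s₁ , []) ∷ (minusS , y ∷ w′) ∷ rest) inU) (subst (λ t → Fixed (DPR (proj₂ t)))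
        (sym (trans (first-factor 2 minusS (y ∷ w′) rest (length w′) (unimodal-Acc _ u) refl) (e (3 ∷ fours (length w′)))))
        (no-1 (≤-refl ∷ All.++⁺ (Big-fours (length w′)) z≥)))
negative-second {s₁ = s₁} {rest} (p ∷ ps) (y ∷ w′) inU@(_ , _ , u₁ ∷ _ , _) u ne
  with KRfrom-extension 0 0 rest ((p ∷ ps ++ y ∷ w′) ∷ []) [] z≤n []
... | extension {P} {z} {rs} _ _ e = undefined ((s₁ , p ∷ ps) ∷ (minusS , y ∷ w′) ∷ rest) (InU-Recorded ((s₁ , p ∷ ps) ∷ (minusS , y ∷ w′) ∷ rest) inU) (subst (λ t → Fixed (DPR (proj₂ t)))
        (sym (trans (first-factor 1 s₁ (p ∷ ps) ((minusS , y ∷ w′) ∷ rest) (length ps) (unimodal-Acc _ u₁) refl)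
             (trans (row-factor 2 minusS (y ∷ w′) rest (p ∷ ps) R₁ (length w′) (unimodal-Acc _ u) refl)
             (trans (e (R₁ ++ 3 ∷ fours (length w′))) (cong (λ S → P , S ∷ rs) (++-assoc R₁ (3 ∷ fours (length w′)) z))))))
        (fixed-labels (length ps) s₁ (fours (length w′) ++ z) rs))
  where R₁ = lab 1 s₁ ∷ ones (length ps)

-- The only 1 lies on the diagonal and becomes a 2 whose prime is restored from `s₁`. So `s₁` turns
-- into the sign of the second factor, whose first box this now is.
single-first : ∀ {n m w s₁ s₂ rest} a₂ x → InU n m w ((s₁ , x ∷ []) ∷ (s₂ , a₂) ∷ rest) → unimodal (x ∷ a₂) ≡ true →
  ¬ ((a₂ ≢ []) × (s₂ ≡ minusS)) → OddF n m w ((s₁ , x ∷ []) ∷ (s₂ , a₂) ∷ rest) (just ((zeroS , []) ∷ (s₁ , x ∷ a₂) ∷ rest))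
single-first {s₁ = s₁} {s₂} {rest} a₂ x inU@(_ , v₁ ∷ _ , u₁ ∷ _ , _) u ns with KRfrom-extension 4 0 rest ((x ∷ a₂) ∷ []) [] (n≤1+n 4) []
... | extension {P} {z} {rs} z≥ rs≥ e = conclude ((s₁ , x ∷ []) ∷ (s₂ , a₂) ∷ rest) ((zeroS , []) ∷ (s₁ , x ∷ a₂) ∷ rest) 0 s₁ {fours (length a₂) ++ z} (InU-Recorded ((s₁ , x ∷ []) ∷ (s₂ , a₂) ∷ rest) inU)
  (trans (first-factor 1 s₁ (x ∷ []) ((s₂ , a₂) ∷ rest) 0 (unimodal-Acc (x ∷ []) refl) refl)
    (trans (plain-factor s₂ a₂ (x ∷ []) (lab 1 s₁ ∷ []) rest (unimodal-Acc _ u) ns) (e (lab 1 s₁ ∷ fours (length a₂)))))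
  (trans (first-factor 2 s₁ (x ∷ a₂) rest (length a₂) (unimodal-Acc _ u) refl) (e (lab 2 s₁ ∷ fours (length a₂))))
  (All.++⁺ (Big-fours (length a₂)) z≥) rs≥
  (shifted-InU {pre = []} zeroS s₁ inU (inj₁ (refl , refl)) (sign-nonzero v₁ (λ ())) (unimodal-Acc _ u))

-- The last 1 is off the diagonal and becomes 2′. This is the label that the sign `minusS` gives to
-- the box of `x`, now the first box of the second factor.
long-first : ∀ {n m w s₁ s₂ rest} a₂ pre x → pre ≢ [] → InU n m w ((s₁ , pre ++ x ∷ []) ∷ (s₂ , a₂) ∷ rest) →
  unimodal ((pre ++ x ∷ []) ++ a₂) ≡ true → ¬ ((a₂ ≢ []) × (s₂ ≡ minusS)) →
  OddF n m w ((s₁ , pre ++ x ∷ []) ∷ (s₂ , a₂) ∷ rest) (just ((s₁ , pre) ∷ (minusS , x ∷ a₂) ∷ rest))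
long-first a₂ [] x ne inU u ns = ⊥-elim (ne refl)
long-first {s₁ = s₁} {s₂} {rest} a₂ (p ∷ ps) x ne inU@(_ , v₁ ∷ _ , u₁ ∷ _ , _) u ns
  with KRfrom-extension 4 0 rest (((p ∷ ps ++ x ∷ []) ++ a₂) ∷ []) [] (n≤1+n 4) []
... | extension {P} {z} {rs} z≥ rs≥ e = conclude ((s₁ , p ∷ ps ++ x ∷ []) ∷ (s₂ , a₂) ∷ rest) ((s₁ , p ∷ ps) ∷ (minusS , x ∷ a₂) ∷ rest) (suc n′) s₁ {fours (length a₂) ++ z} (InU-Recorded ((s₁ , p ∷ ps ++ x ∷ []) ∷ (s₂ , a₂) ∷ rest) inU)
  (trans (first-factor 1 s₁ (p ∷ ps ++ x ∷ []) ((s₂ , a₂) ∷ rest) (suc n′) (unimodal-Acc _ u₁) (cong suc (length-snoc ps x)))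
    (trans (plain-factor s₂ a₂ (p ∷ ps ++ x ∷ []) (lab 1 s₁ ∷ ones (suc n′)) rest acc ns)
    (trans (e ((lab 1 s₁ ∷ ones (suc n′)) ++ fours (length a₂))) (cong (λ S → P , S ∷ rs) (++-assoc (lab 1 s₁ ∷ ones (suc n′)) (fours (length a₂)) z)))))
  (trans (first-factor 1 s₁ (p ∷ ps) ((minusS , x ∷ a₂) ∷ rest) n′ (Acc-prefix (p ∷ ps) (unimodal-Acc _ u₁)) refl)
    (trans (row-factor 2 minusS (x ∷ a₂) rest (p ∷ ps) R₁ (length a₂) (subst (Acc st) assoc acc) refl)
    (trans (cong (λ r → KRfrom 3 rest (r ∷ [] , (R₁ ++ 3 ∷ fours (length a₂)) ∷ [])) (sym assoc))
    (trans (e (R₁ ++ 3 ∷ fours (length a₂))) (cong (λ S → P , S ∷ rs) (trans (++-assoc R₁ (3 ∷ fours (length a₂)) z) (sym (++-assoc R₁ (3 ∷ []) _))))))))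
  (All.++⁺ (Big-fours (length a₂)) z≥) rs≥
  (shifted-InU s₁ minusS inU (inj₂ (sign-nonzero v₁ (λ ()) , λ ())) (λ ())
    (Acc-start (proj₂ (proj₂ (Run-++⁻ (p ∷ ps) (subst (Acc st) assoc acc))))))
  where
  n′ = length ps
  R₁ = lab 1 s₁ ∷ ones n′
  acc : Acc st ((p ∷ ps ++ x ∷ []) ++ a₂)
  acc = unimodal-Acc _ u
  assoc : (p ∷ ps ++ x ∷ []) ++ a₂ ≡ (p ∷ ps) ++ x ∷ a₂
  assoc = ++-assoc (p ∷ ps) (x ∷ []) a₂
  Acc-start : ∀ {c} → Acc c (x ∷ a₂) → Acc st (x ∷ a₂)
  Acc-start (_ , start ∷ r)  = _ , start ∷ r
  Acc-start (_ , down _ ∷ r) = _ , start ∷ r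
  Acc-start (_ , turn _ ∷ r) = start ∷ᵃ Acc-weaken a₂ (_ , r)
  Acc-start (_ , rise _ ∷ r) = start ∷ᵃ Acc-weaken a₂ (_ , r)

theorem4p18 : ∀ (n m : ℕ) (w : List ℤ) → InWB n w → 2 ≤ m →
  ∀ (s₁ s₂ : Sign) (a₂ : List ℕ) (rest : List Factor) →
  -- (1), a₂' unimodal
  (∀ (pre : List ℕ) (x : ℕ) →
    InU n m w ((s₁ , pre ++ x ∷ []) ∷ (s₂ , a₂) ∷ rest) →
    unimodal ((pre ++ x ∷ []) ++ a₂) ≡ false →
    unimodal (x ∷ a₂) ≡ true →
    OddF n m w ((s₁ , pre ++ x ∷ []) ∷ (s₂ , a₂) ∷ rest)
      (just ((s₁ , pre) ∷ (s₂ , x ∷ a₂) ∷ rest)))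
  ×
  -- (1), a₂' not unimodal
  (∀ (pre : List ℕ) (x : ℕ) →
    InU n m w ((s₁ , pre ++ x ∷ []) ∷ (s₂ , a₂) ∷ rest) →
    unimodal ((pre ++ x ∷ []) ++ a₂) ≡ false →
    unimodal (x ∷ a₂) ≡ false →
    OddF n m w ((s₁ , pre ++ x ∷ []) ∷ (s₂ , a₂) ∷ rest) nothing)
  ×
  -- (2), a₂ nonempty and s₂ = -
  (∀ (a₁ : List ℕ) →
    InU n m w ((s₁ , a₁) ∷ (s₂ , a₂) ∷ rest) →
    unimodal (a₁ ++ a₂) ≡ true →
    a₂ ≢ [] → s₂ ≡ minusS →
    OddF n m w ((s₁ , a₁) ∷ (s₂ , a₂) ∷ rest) nothing)
  ×
  -- (2), otherwise, |a₁| = 1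
  (∀ (x : ℕ) →
    InU n m w ((s₁ , x ∷ []) ∷ (s₂ , a₂) ∷ rest) →
    unimodal ((x ∷ []) ++ a₂) ≡ true →
    ¬ ((a₂ ≢ []) × (s₂ ≡ minusS)) →
    OddF n m w ((s₁ , x ∷ []) ∷ (s₂ , a₂) ∷ rest)
      (just ((zeroS , []) ∷ (s₁ , x ∷ a₂) ∷ rest)))
  ×
  -- (2), otherwise, |a₁| ≥ 2
  (∀ (pre : List ℕ) (x : ℕ) → pre ≢ [] →
    InU n m w ((s₁ , pre ++ x ∷ []) ∷ (s₂ , a₂) ∷ rest) →
    unimodal ((pre ++ x ∷ []) ++ a₂) ≡ true →
    ¬ ((a₂ ≢ []) × (s₂ ≡ minusS)) →
    OddF n m w ((s₁ , pre ++ x ∷ []) ∷ (s₂ , a₂) ∷ rest)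
      (just ((s₁ , pre) ∷ (minusS , x ∷ a₂) ∷ rest)))
theorem4p18 n m w _ _ s₁ s₂ a₂ rest =
  (λ pre x → shift-not-unimodal a₂ pre x) ,
  (λ pre x → shift-impossible a₂ pre x) ,
  (λ { a₁ inU u ne refl → negative-second a₁ a₂ inU u ne }) ,
  (λ x → single-first a₂ x) ,
  (λ pre x → long-first a₂ pre x)
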